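{- Let $\mathcal{G} \subseteq \widetilde{\mathcal{G}}$ be the subgroup of multiplicative functions and let $\{u_q \mid q \in \mathbb{R}\} \subseteq \widetilde{\mathcal{G}}$ be the 1-parameter subgroup defined in the context. For every $q \in \mathbb{R}$ and every $f \in \mathcal{G}$ one has $$ u_q^{ -1} * f * u_q \in \mathcal{G}. $$
   Context: For $n \ge 1$, $NC(n)$ is the set of non-crossing partitions of $\{1,\ldots,n\}$, partially ordered by reverse refinement: $\pi \le \sigma$ iff every block of $\sigma$ is a union of blocks of $\pi$. $1_n \in NC(n)$ is the partition with a single block, $0_n$ the partition with $n$ singleton blocks; $|\pi|$ is the number of blocks of $\pi$; $\pi \in NC(n)$ is called irreducible if $1$ and $n$ belong to the same block of $\pi$. Put $NC^{(2)} := \sqcup_{n=1}^{\infty} \{ (\pi,\sigma) \mid \pi,\sigma \in NC(n),\ \pi \le \sigma \}$. For $\pi \in NC(n)$ and a non-empty $W = \{p_1 < \cdots < p_m\} \subseteq \{1,\ldots,n\}$, $\pi_W \in NC(m)$ is the partition for which $i,j$ are in the same block of $\pi_W$ iff $p_i,p_j$ are in the same block of $\pi$. $\widetilde{\mathcal{G}}$ is the set of functions $g : NC^{(2)} \to \mathbb{C}$ such that $g(\pi,\pi)=1$ for all $\pi$ and $g(\pi,\sigma) = \prod_{W \in \sigma} g(\pi_W, 1_{|W|})$ for every $n \ge 1$ and $\pi \le \sigma$ in $NC(n)$. It is a group under convolution, $(f*g)(\pi,\sigma) = \sum_{\rho:\ \pi \le \rho \le \sigma} f(\pi,\rho) g(\rho,\sigma)$;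 $g^{ -1}$ denotes the inverse under convolution. A function $g \in \widetilde{\mathcal{G}}$ is uniquely determined by its values $g(\pi,1_n)$, and these values can be prescribed arbitrarily for $\pi \in NC(n)\setminus\{1_n\}$, $n \ge 1$. Kreweras complement: for $\pi \in NC(n)$, $\mathrm{Kr}(\pi) \in NC(n)$ is the largest $\sigma \in NC(n)$ (for $\le$) such that, placing $\pi$ on the points $1,\ldots,n$ and $\sigma$ on the points $1',\ldots,n'$, the union of $\pi$ and $\sigma$ is a non-crossing partition of the ordered set $1<1'<2<2'<\cdots<n<n'$. $\mathcal{G}$ is the set of multiplicative functions, i.e. of those $g \in \widetilde{\mathcal{G}}$ such that $g(\pi,1_n) = g(0_n, \mathrm{Kr}(\pi))$ for all $n \ge 1$ and $\pi \in NC(n)$. For $q \in \mathbb{R}$, $u_q$ is the unique function in $\widetilde{\mathcal{G}}$ such that for all $n \ge 1$ and $\pi \in NC(n)$: $u_q(\pi,1_n) = q^{|\pi|-1}$ if $\pi$ is irreducible, and $u_q(\pi,1_n)=0$ otherwise (with the convention $0^0=1$). -}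

module Defs where

open import Level using (0ℓ)
open import Algebra.Bundles using (CommutativeRing)
open import Algebra.Structures using (IsCommutativeRing)
import Algebra.Consequences.Setoid
import Algebra.Properties.Semiring.Exp as Exponentiation
open import Data.Bool.Base using (if_then_else_)
import Data.Bool.Properties as Bool
open import Data.Empty using (⊥-elim)
open import Data.Fin.Base as Fin using (Fin; zero; suc; toℕ; fromℕ)
import Data.Fin.Properties as Fin
open import Data.Fin.Subset
  using (Subset; inside; outside; _∈_; _⊆_; ∣_∣; ⁅_⁆; ⊤; Nonempty)
open import Data.Fin.Subset.Properties
  using (∈⊤; x∈⁅x⁆; x∈⁅y⁆⇒x≡y; _∈?_; _⊆?_)
open import Data.List.Base
  using (List; []; _∷_; length; filter; foldr; mapMaybe; deduplicate; cartesianProductWith)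
open import Data.List.Membership.Propositional using (mapWith∈) renaming (_∈_ to _∈ˡ_)
open import Data.List.Membership.Propositional.Properties using (∈-filter⁻; ∈-deduplicate⁻)
open import Data.Maybe.Base using (Maybe; just; nothing)
open import Data.Nat.Base as ℕ using (ℕ; zero; suc; z<s; s<s; s<s⁻¹)
import Data.Nat.Properties as ℕ
open import Data.Product.Base using (Σ-syntax; ∃; _×_; _,_; proj₁; proj₂)
open import Data.Rational.Base as ℚ using (ℚ; 0ℚ; 1ℚ; ½)
import Data.Rational.Properties as ℚ
open import Data.Sum.Base using (_⊎_; inj₁; inj₂)
open import Data.Sum.Relation.Binary.Pointwise using (Pointwise)
open import Data.Vec.Base using (Vec; []; _∷_; lookup; tabulate; replicate; toList; there)
open import Data.Vec.Properties
  using (≡-dec; lookup∘tabulate; lookup-replicate; lookup⇒[]=; []=⇒lookup; tabulate-cong)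
open import Data.Vec.Relation.Unary.Any using (index)
open import Data.Vec.Relation.Unary.Any.Properties using (lookup-index)
import Data.Vec.Membership.Propositional.Properties as VecMem
open import Function.Base using (_∘_)
open import Relation.Binary.Bundles using (Setoid)
open import Relation.Binary.Core using (Rel)
open import Relation.Binary.PropositionalEquality
  using (_≡_; refl; sym; trans; cong; subst)
open import Relation.Binary.Structures using (IsEquivalence)
open import Relation.Nullary using (¬_; Dec; yes; no; does; _×-dec_; _→-dec_)
open import Relation.Nullary.Decidable.Core using (dec⇒maybe; recompute)
open import Tactic.RingSolver using (solve-∀)
open import Tactic.RingSolver.Core.AlmostCommutativeRing
  using (AlmostCommutativeRing; fromCommutativeRing)

-- ℝ: Cauchy sequences of rationals modulo null sequences.

module RealNumbers where

  ℚ-ring : AlmostCommutativeRing 0ℓ 0ℓ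
  ℚ-ring = fromCommutativeRing ℚ.+-*-commutativeRing (dec⇒maybe ∘ (0ℚ ℚ.≟_))

  Eventually : (ℕ → Set) → Set
  Eventually P = ∃ λ N → ∀ n → N ℕ.≤ n → P n

  record ℝ : Set where
    constructor mkℝ
    field
      seq    : ℕ → ℚ
      cauchy : ∀ ε → 0ℚ ℚ.< ε →
               ∃ λ N → ∀ m n → N ℕ.≤ m → N ℕ.≤ n → ℚ.∣ seq m ℚ.- seq n ∣ ℚ.< ε

  open ℝ public

  infix 4 _≈_
  _≈_ : Rel ℝ 0ℓ
  x ≈ y = ∀ ε → 0ℚ ℚ.< ε → Eventually λ n → ℚ.∣ seq x n ℚ.- seq y n ∣ ℚ.< ε

  private
    half>0 : ∀ {ε} → 0ℚ ℚ.< ε → 0ℚ ℚ.< ½ ℚ.* ε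
    half>0 0<ε = ℚ.*-monoʳ-<-pos ½ 0<ε

    half+half : ∀ ε → ½ ℚ.* ε ℚ.+ ½ ℚ.* ε ≡ ε
    half+half ε = trans (sym (ℚ.*-distribʳ-+ ε ½ ½)) (ℚ.*-identityˡ ε)

    ∣0∣<ε : ∀ {p ε} → p ≡ 0ℚ → 0ℚ ℚ.< ε → ℚ.∣ p ∣ ℚ.< ε
    ∣0∣<ε refl 0<ε = 0<ε

    ∣a+b∣<ε : ∀ {p a b ε} → p ≡ a ℚ.+ b →
              ℚ.∣ a ∣ ℚ.< ½ ℚ.* ε → ℚ.∣ b ∣ ℚ.< ½ ℚ.* ε → ℚ.∣ p ∣ ℚ.< ε
    ∣a+b∣<ε {a = a} {b} {ε} refl a<ε/2 b<ε/2 =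
      subst (ℚ.∣ a ℚ.+ b ∣ ℚ.<_) (half+half ε)
        (ℚ.≤-<-trans (ℚ.∣p+q∣≤∣p∣+∣q∣ a b) (ℚ.+-mono-< a<ε/2 b<ε/2))

    ∣p-q∣≡∣q-p∣ : ∀ p q → ℚ.∣ p ℚ.- q ∣ ≡ ℚ.∣ q ℚ.- p ∣
    ∣p-q∣≡∣q-p∣ p q =
      trans (cong ℚ.∣_∣ (flip-sign p q)) (ℚ.∣-p∣≡∣p∣ (q ℚ.- p))
      where
      flip-sign : ∀ p q → p ℚ.- q ≡ ℚ.- (q ℚ.- p)
      flip-sign = solve-∀ ℚ-ring

    -- |a b| < ε as soon as |a| < K and |b| < shrink K ε.
    shrink : ∀ K → .{{ℚ.Positive K}} → ℚ → ℚ
    shrink K ε = (ℚ.1/ K) {{ℚ.pos⇒nonZero K}} ℚ.* ε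

    shrink>0 : ∀ K → .{{_ : ℚ.Positive K}} → ∀ {ε} → 0ℚ ℚ.< ε → 0ℚ ℚ.< shrink K ε
    shrink>0 K {ε} 0<ε = subst (ℚ._< shrink K ε) (ℚ.*-zeroʳ r)
      (ℚ.*-monoʳ-<-pos r {{ℚ.1/pos⇒pos K}} 0<ε)
      where
      r = (ℚ.1/ K) {{ℚ.pos⇒nonZero K}}

    ∣a*b∣<ε : ∀ K → .{{_ : ℚ.Positive K}} → ∀ {p a b ε} → p ≡ a ℚ.* b →
              ℚ.∣ a ∣ ℚ.< K → ℚ.∣ b ∣ ℚ.< shrink K ε → ℚ.∣ p ∣ ℚ.< ε
    ∣a*b∣<ε K {p} {a} {b} {ε} refl a<K b<δ = begin-strict
      ℚ.∣ a ℚ.* b ∣           ≡⟨ ℚ.∣p*q∣≡∣p∣*∣q∣ a b ⟩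
      ℚ.∣ a ∣ ℚ.* ℚ.∣ b ∣     ≤⟨ ℚ.*-monoʳ-≤-nonNeg ℚ.∣ b ∣ {{ℚ.∣-∣-nonNeg b}} (ℚ.<⇒≤ a<K) ⟩
      K ℚ.* ℚ.∣ b ∣           <⟨ ℚ.*-monoʳ-<-pos K b<δ ⟩
      K ℚ.* (r ℚ.* ε)         ≡⟨ sym (ℚ.*-assoc K r ε) ⟩
      (K ℚ.* r) ℚ.* ε         ≡⟨ cong (ℚ._* ε) (ℚ.*-inverseʳ K {{ℚ.pos⇒nonZero K}}) ⟩
      1ℚ ℚ.* ε                ≡⟨ ℚ.*-identityˡ ε ⟩
      ε                       ∎
      where
      open ℚ.≤-Reasoning
      r = (ℚ.1/ K) {{ℚ.pos⇒nonZero K}}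

    bounded : (x : ℝ) → Σ[ K ∈ ℚ ] ℚ.Positive K × Eventually λ n → ℚ.∣ seq x n ∣ ℚ.< K
    bounded x with cauchy x 1ℚ (ℚ.positive⁻¹ 1ℚ)
    ... | N , close = K , ℚ.positive 0<K , N , bound
      where
      K = 1ℚ ℚ.+ ℚ.∣ seq x N ∣
      0<K : 0ℚ ℚ.< K
      0<K = ℚ.+-mono-<-≤ (ℚ.positive⁻¹ 1ℚ) (ℚ.0≤∣p∣ (seq x N))
      split : ∀ p q → p ≡ (p ℚ.- q) ℚ.+ q
      split = solve-∀ ℚ-ring
      bound : ∀ n → N ℕ.≤ n → ℚ.∣ seq x n ∣ ℚ.< K
      bound n N≤n = ℚ.≤-<-trans
        (subst (λ p → ℚ.∣ p ∣ ℚ.≤ ℚ.∣ seq x n ℚ.- seq x N ∣ ℚ.+ ℚ.∣ seq x N ∣)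
          (sym (split (seq x n) (seq x N))) (ℚ.∣p+q∣≤∣p∣+∣q∣ (seq x n ℚ.- seq x N) (seq x N)))
        (ℚ.+-monoˡ-< ℚ.∣ seq x N ∣ (close n N N≤n ℕ.≤-refl))

    -- pq - p'q' as a sum of two terms, each with one factor that is a difference.
    *-split : ∀ p q p′ q′ →
              p ℚ.* q ℚ.- p′ ℚ.* q′ ≡ p ℚ.* (q ℚ.- q′) ℚ.+ q′ ℚ.* (p ℚ.- p′)
    *-split = solve-∀ ℚ-ring

    +-split : ∀ p q p′ q′ →
              (p ℚ.+ q) ℚ.- (p′ ℚ.+ q′) ≡ (p ℚ.- p′) ℚ.+ (q ℚ.- q′)
    +-split = solve-∀ ℚ-ring

    neg-split : ∀ p q → (ℚ.- p) ℚ.- (ℚ.- q) ≡ q ℚ.- p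
    neg-split = solve-∀ ℚ-ring

    ⊔ˡ : ∀ {k n} m → k ℕ.⊔ m ℕ.≤ n → k ℕ.≤ n
    ⊔ˡ {k} m = ℕ.≤-trans (ℕ.m≤m⊔n k m)

    ⊔ʳ : ∀ {k n} m → m ℕ.⊔ k ℕ.≤ n → k ℕ.≤ n
    ⊔ʳ {k} m = ℕ.≤-trans (ℕ.m≤n⊔m m k)

  fromℚ : ℚ → ℝ
  fromℚ p = mkℝ (λ _ → p) λ ε 0<ε → 0 , λ _ _ _ _ → ∣0∣<ε (ℚ.+-inverseʳ p) 0<ε

  infixl 6 _+_
  _+_ : ℝ → ℝ → ℝ
  x + y = mkℝ (λ n → seq x n ℚ.+ seq y n) λ ε 0<ε →
    let N₁ , close₁ = cauchy x (½ ℚ.* ε) (half>0 0<ε)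
        N₂ , close₂ = cauchy y (½ ℚ.* ε) (half>0 0<ε)
    in N₁ ℕ.⊔ N₂ , λ m n N≤m N≤n →
         ∣a+b∣<ε (+-split (seq x m) (seq y m) (seq x n) (seq y n))
                 (close₁ m n (⊔ˡ N₂ N≤m) (⊔ˡ N₂ N≤n))
                 (close₂ m n (⊔ʳ N₁ N≤m) (⊔ʳ N₁ N≤n))

  infix 8 -_
  -_ : ℝ → ℝ
  - x = mkℝ (λ n → ℚ.- seq x n) λ ε 0<ε →
    let N , close = cauchy x ε 0<ε
    in N , λ m n N≤m N≤n →
         subst (λ p → ℚ.∣ p ∣ ℚ.< ε) (sym (neg-split (seq x m) (seq x n)))
               (close n m N≤n N≤m)

  infixl 7 _*_
  _*_ : ℝ → ℝ → ℝ
  x * y = mkℝ (λ n → seq x n ℚ.* seq y n) λ ε 0<ε →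
    let K , K>0 , N₁ , x<K = bounded x
        L , L>0 , N₂ , y<L = bounded y
        N₃ , close₃ = cauchy y _ (shrink>0 K {{K>0}} (half>0 0<ε))
        N₄ , close₄ = cauchy x _ (shrink>0 L {{L>0}} (half>0 0<ε))
        N₅ = N₁ ℕ.⊔ N₂
        N₆ = N₃ ℕ.⊔ N₄
    in N₅ ℕ.⊔ N₆ , λ m n N≤m N≤n →
         ∣a+b∣<ε (*-split (seq x m) (seq y m) (seq x n) (seq y n))
                 (∣a*b∣<ε K {{K>0}} {a = seq x m} refl
                    (x<K m (⊔ˡ N₂ (⊔ˡ N₆ N≤m)))
                    (close₃ m n (⊔ˡ N₄ (⊔ʳ N₅ N≤m)) (⊔ˡ N₄ (⊔ʳ N₅ N≤n))))
                 (∣a*b∣<ε L {{L>0}} {a = seq y n} refl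
                    (y<L n (⊔ʳ N₁ (⊔ˡ N₆ N≤n)))
                    (close₄ m n (⊔ʳ N₃ (⊔ʳ N₅ N≤m)) (⊔ʳ N₃ (⊔ʳ N₅ N≤n))))

  pointwise : ∀ x y → (∀ n → seq x n ≡ seq y n) → x ≈ y
  pointwise x y eq ε 0<ε = 0 , λ n _ →
    ∣0∣<ε (trans (cong (ℚ._- seq y n) (eq n)) (ℚ.+-inverseʳ (seq y n))) 0<ε

  private
    ≈-refl : ∀ {x} → x ≈ x
    ≈-refl {x} = pointwise x x (λ _ → refl)

    ≈-sym : ∀ {x y} → x ≈ y → y ≈ x
    ≈-sym {x} {y} x≈y ε 0<ε =
      let N , close = x≈y ε 0<ε
      in N , λ n N≤n → subst (ℚ._< ε) (∣p-q∣≡∣q-p∣ (seq x n) (seq y n)) (close n N≤n)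

    ≈-trans : ∀ {x y z} → x ≈ y → y ≈ z → x ≈ z
    ≈-trans {x} {y} {z} x≈y y≈z ε 0<ε =
      let N₁ , close₁ = x≈y (½ ℚ.* ε) (half>0 0<ε)
          N₂ , close₂ = y≈z (½ ℚ.* ε) (half>0 0<ε)
      in N₁ ℕ.⊔ N₂ , λ n N≤n →
           ∣a+b∣<ε (telescope (seq x n) (seq y n) (seq z n))
                   (close₁ n (⊔ˡ N₂ N≤n)) (close₂ n (⊔ʳ N₁ N≤n))
      where
      telescope : ∀ p q r → p ℚ.- r ≡ (p ℚ.- q) ℚ.+ (q ℚ.- r)
      telescope = solve-∀ ℚ-ring

    +-cong : ∀ {x x′ y y′} → x ≈ x′ → y ≈ y′ → x + y ≈ x′ + y′
    +-cong {x} {x′} {y} {y′} x≈x′ y≈y′ ε 0<ε =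
      let N₁ , close₁ = x≈x′ (½ ℚ.* ε) (half>0 0<ε)
          N₂ , close₂ = y≈y′ (½ ℚ.* ε) (half>0 0<ε)
      in N₁ ℕ.⊔ N₂ , λ n N≤n →
           ∣a+b∣<ε (+-split (seq x n) (seq y n) (seq x′ n) (seq y′ n))
                   (close₁ n (⊔ˡ N₂ N≤n)) (close₂ n (⊔ʳ N₁ N≤n))

    -‿cong : ∀ {x y} → x ≈ y → - x ≈ - y
    -‿cong {x} {y} x≈y ε 0<ε =
      let N , close = ≈-sym {x} {y} x≈y ε 0<ε
      in N , λ n N≤n →
           subst (λ p → ℚ.∣ p ∣ ℚ.< ε) (sym (neg-split (seq x n) (seq y n))) (close n N≤n)

    *-cong : ∀ {x x′ y y′} → x ≈ x′ → y ≈ y′ → x * y ≈ x′ * y′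
    *-cong {x} {x′} {y} {y′} x≈x′ y≈y′ ε 0<ε =
      let K , K>0 , N₁ , x<K = bounded x
          L , L>0 , N₂ , y′<L = bounded y′
          N₃ , close₃ = y≈y′ _ (shrink>0 K {{K>0}} (half>0 0<ε))
          N₄ , close₄ = x≈x′ _ (shrink>0 L {{L>0}} (half>0 0<ε))
          N₅ = N₁ ℕ.⊔ N₂
          N₆ = N₃ ℕ.⊔ N₄
      in N₅ ℕ.⊔ N₆ , λ n N≤n →
           ∣a+b∣<ε (*-split (seq x n) (seq y n) (seq x′ n) (seq y′ n))
                   (∣a*b∣<ε K {{K>0}} {a = seq x n} refl
                      (x<K n (⊔ˡ N₂ (⊔ˡ N₆ N≤n))) (close₃ n (⊔ˡ N₄ (⊔ʳ N₅ N≤n))))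
                   (∣a*b∣<ε L {{L>0}} {a = seq y′ n} refl
                      (y′<L n (⊔ʳ N₁ (⊔ˡ N₆ N≤n))) (close₄ n (⊔ʳ N₃ (⊔ʳ N₅ N≤n))))

  isCommutativeRing : IsCommutativeRing _≈_ _+_ _*_ -_ (fromℚ 0ℚ) (fromℚ 1ℚ)
  isCommutativeRing = record
    { isRing = record
      { +-isAbelianGroup = record
        { isGroup = record
          { isMonoid = record
            { isSemigroup = record
              { isMagma = record
                { isEquivalence = record
                  { refl  = λ {x} → ≈-refl {x}
                  ; sym   = λ {x} {y} → ≈-sym {x} {y}
                  ; trans = λ {x} {y} {z} → ≈-trans {x} {y} {z}
                  }
                ; ∙-cong = λ {x} {x′} {y} {y′} → +-cong {x} {x′} {y} {y′}
                }
              ; assoc = λ x y z → pointwise ((x + y) + z) (x + (y + z))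
                  λ n → ℚ.+-assoc (seq x n) (seq y n) (seq z n)
              }
            ; identity =
                (λ x → pointwise (fromℚ 0ℚ + x) x λ n → ℚ.+-identityˡ (seq x n)) ,
                (λ x → pointwise (x + fromℚ 0ℚ) x λ n → ℚ.+-identityʳ (seq x n))
            }
          ; inverse =
              (λ x → pointwise (- x + x) (fromℚ 0ℚ) λ n → ℚ.+-inverseˡ (seq x n)) ,
              (λ x → pointwise (x + - x) (fromℚ 0ℚ) λ n → ℚ.+-inverseʳ (seq x n))
          ; ⁻¹-cong = λ {x} {y} → -‿cong {x} {y}
          }
        ; comm = λ x y → pointwise (x + y) (y + x) λ n → ℚ.+-comm (seq x n) (seq y n)
        }
      ; *-cong = λ {x} {x′} {y} {y′} → *-cong {x} {x′} {y} {y′}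
      ; *-assoc = λ x y z → pointwise ((x * y) * z) (x * (y * z))
          λ n → ℚ.*-assoc (seq x n) (seq y n) (seq z n)
      ; *-identity =
          (λ x → pointwise (fromℚ 1ℚ * x) x λ n → ℚ.*-identityˡ (seq x n)) ,
          (λ x → pointwise (x * fromℚ 1ℚ) x λ n → ℚ.*-identityʳ (seq x n))
      ; distrib =
          (λ x y z → pointwise (x * (y + z)) (x * y + x * z)
             λ n → ℚ.*-distribˡ-+ (seq x n) (seq y n) (seq z n)) ,
          (λ x y z → pointwise ((y + z) * x) (y * x + z * x)
             λ n → ℚ.*-distribʳ-+ (seq x n) (seq y n) (seq z n))
      }
    ; *-comm = λ x y → pointwise (x * y) (y * x) λ n → ℚ.*-comm (seq x n) (seq y n)
    }

open RealNumbers public using (ℝ)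

ℝ-commutativeRing : CommutativeRing 0ℓ 0ℓ
ℝ-commutativeRing = record { isCommutativeRing = RealNumbers.isCommutativeRing }

-- ℂ: (a , b) is a + b i.

module ComplexNumbers where

  open RealNumbers using (seq; ℚ-ring; pointwise)
  private
    module R = CommutativeRing ℝ-commutativeRing

    infixl 6 _⊕_ _⊖_
    infixl 7 _⊛_
    _⊕_ _⊖_ _⊛_ : ℝ → ℝ → ℝ
    _⊕_ = R._+_
    _⊖_ = R._-_
    _⊛_ = R._*_

  ℂ : Set
  ℂ = ℝ × ℝ

  infix 4 _≈_
  _≈_ : Rel ℂ 0ℓ
  (a , b) ≈ (a′ , b′) = (a R.≈ a′) × (b R.≈ b′)

  infixl 6 _+_
  _+_ : ℂ → ℂ → ℂ
  (a , b) + (a′ , b′) = a ⊕ a′ , b ⊕ b′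

  infixl 7 _*_
  _*_ : ℂ → ℂ → ℂ
  (a , b) * (a′ , b′) = a ⊛ a′ ⊖ b ⊛ b′ , a ⊛ b′ ⊕ b ⊛ a′

  infix 8 -_
  -_ : ℂ → ℂ
  - (a , b) = R.- a , R.- b

  fromℝ : ℝ → ℂ
  fromℝ a = a , R.0#

  0# 1# : ℂ
  0# = fromℝ R.0#
  1# = fromℝ R.1#

  private
    *-comm : ∀ x y → x * y ≈ y * x
    *-comm (a , b) (c , d) =
      pointwise (a ⊛ c ⊖ b ⊛ d) (c ⊛ a ⊖ d ⊛ b)
        (λ n → re (seq a n) (seq b n) (seq c n) (seq d n)) ,
      pointwise (a ⊛ d ⊕ b ⊛ c) (c ⊛ b ⊕ d ⊛ a)
        (λ n → im (seq a n) (seq b n) (seq c n) (seq d n))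
      where
      re : ∀ a b c d → a ℚ.* c ℚ.- b ℚ.* d ≡ c ℚ.* a ℚ.- d ℚ.* b
      re = solve-∀ ℚ-ring
      im : ∀ a b c d → a ℚ.* d ℚ.+ b ℚ.* c ≡ c ℚ.* b ℚ.+ d ℚ.* a
      im = solve-∀ ℚ-ring

    *-assoc : ∀ x y z → (x * y) * z ≈ x * (y * z)
    *-assoc (a , b) (c , d) (e , f) =
      pointwise ((a ⊛ c ⊖ b ⊛ d) ⊛ e ⊖ (a ⊛ d ⊕ b ⊛ c) ⊛ f)
                (a ⊛ (c ⊛ e ⊖ d ⊛ f) ⊖ b ⊛ (c ⊛ f ⊕ d ⊛ e))
        (λ n → re (seq a n) (seq b n) (seq c n) (seq d n) (seq e n) (seq f n)) ,
      pointwise ((a ⊛ c ⊖ b ⊛ d) ⊛ f ⊕ (a ⊛ d ⊕ b ⊛ c) ⊛ e)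
                (a ⊛ (c ⊛ f ⊕ d ⊛ e) ⊕ b ⊛ (c ⊛ e ⊖ d ⊛ f))
        (λ n → im (seq a n) (seq b n) (seq c n) (seq d n) (seq e n) (seq f n))
      where
      re : ∀ a b c d e f →
        (a ℚ.* c ℚ.- b ℚ.* d) ℚ.* e ℚ.- (a ℚ.* d ℚ.+ b ℚ.* c) ℚ.* f ≡
        a ℚ.* (c ℚ.* e ℚ.- d ℚ.* f) ℚ.- b ℚ.* (c ℚ.* f ℚ.+ d ℚ.* e)
      re = solve-∀ ℚ-ring
      im : ∀ a b c d e f →
        (a ℚ.* c ℚ.- b ℚ.* d) ℚ.* f ℚ.+ (a ℚ.* d ℚ.+ b ℚ.* c) ℚ.* e ≡
        a ℚ.* (c ℚ.* f ℚ.+ d ℚ.* e) ℚ.+ b ℚ.* (c ℚ.* e ℚ.- d ℚ.* f)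
      im = solve-∀ ℚ-ring

    *-identityˡ : ∀ x → 1# * x ≈ x
    *-identityˡ (a , b) =
      pointwise (R.1# ⊛ a ⊖ R.0# ⊛ b) a (λ n → re (seq a n) (seq b n)) ,
      pointwise (R.1# ⊛ b ⊕ R.0# ⊛ a) b (λ n → im (seq a n) (seq b n))
      where
      re : ∀ a b → 1ℚ ℚ.* a ℚ.- 0ℚ ℚ.* b ≡ a
      re = solve-∀ ℚ-ring
      im : ∀ a b → 1ℚ ℚ.* b ℚ.+ 0ℚ ℚ.* a ≡ b
      im = solve-∀ ℚ-ring

    distribˡ : ∀ x y z → x * (y + z) ≈ x * y + x * z
    distribˡ (a , b) (c , d) (e , f) =
      pointwise (a ⊛ (c ⊕ e) ⊖ b ⊛ (d ⊕ f)) ((a ⊛ c ⊖ b ⊛ d) ⊕ (a ⊛ e ⊖ b ⊛ f))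
        (λ n → re (seq a n) (seq b n) (seq c n) (seq d n) (seq e n) (seq f n)) ,
      pointwise (a ⊛ (d ⊕ f) ⊕ b ⊛ (c ⊕ e)) ((a ⊛ d ⊕ b ⊛ c) ⊕ (a ⊛ f ⊕ b ⊛ e))
        (λ n → im (seq a n) (seq b n) (seq c n) (seq d n) (seq e n) (seq f n))
      where
      re : ∀ a b c d e f →
        a ℚ.* (c ℚ.+ e) ℚ.- b ℚ.* (d ℚ.+ f) ≡
        (a ℚ.* c ℚ.- b ℚ.* d) ℚ.+ (a ℚ.* e ℚ.- b ℚ.* f)
      re = solve-∀ ℚ-ring
      im : ∀ a b c d e f →
        a ℚ.* (d ℚ.+ f) ℚ.+ b ℚ.* (c ℚ.+ e) ≡
        (a ℚ.* d ℚ.+ b ℚ.* c) ℚ.+ (a ℚ.* f ℚ.+ b ℚ.* e)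
      im = solve-∀ ℚ-ring

    ≈-isEquivalence : IsEquivalence _≈_
    ≈-isEquivalence = record
      { refl  = λ {(a , b)} → R.refl {a} , R.refl {b}
      ; sym   = λ {(a , b)} {(c , d)} (p , q) → R.sym {a} {c} p , R.sym {b} {d} q
      ; trans = λ {(a , b)} {(c , d)} {(e , f)} (p , q) (r , s) →
          R.trans {a} {c} {e} p r , R.trans {b} {d} {f} q s
      }

    +-cong : ∀ {x x′ y y′} → x ≈ x′ → y ≈ y′ → x + y ≈ x′ + y′
    +-cong {a , b} {a′ , b′} {c , d} {c′ , d′} (p , q) (r , s) =
      R.+-cong {a} {a′} {c} {c′} p r , R.+-cong {b} {b′} {d} {d′} q s

    *-cong : ∀ {x x′ y y′} → x ≈ x′ → y ≈ y′ → x * y ≈ x′ * y′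
    *-cong {a , b} {a′ , b′} {c , d} {c′ , d′} (p , q) (r , s) =
      R.+-cong {a ⊛ c} {a′ ⊛ c′} {R.- (b ⊛ d)} {R.- (b′ ⊛ d′)}
        (R.*-cong {a} {a′} {c} {c′} p r)
        (R.-‿cong {b ⊛ d} {b′ ⊛ d′} (R.*-cong {b} {b′} {d} {d′} q s)) ,
      R.+-cong {a ⊛ d} {a′ ⊛ d′} {b ⊛ c} {b′ ⊛ c′}
        (R.*-cong {a} {a′} {d} {d′} p s)
        (R.*-cong {b} {b′} {c} {c′} q r)

    ≈-setoid : Setoid 0ℓ 0ℓ
    ≈-setoid = record { isEquivalence = ≈-isEquivalence }

    module Derive = Algebra.Consequences.Setoid ≈-setoid

  isCommutativeRing : IsCommutativeRing _≈_ _+_ _*_ -_ 0# 1#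
  isCommutativeRing = record
    { isRing = record
      { +-isAbelianGroup = record
        { isGroup = record
          { isMonoid = record
            { isSemigroup = record
              { isMagma = record
                { isEquivalence = ≈-isEquivalence
                ; ∙-cong = λ {x} {x′} {y} {y′} → +-cong {x} {x′} {y} {y′}
                }
              ; assoc = λ (a , b) (c , d) (e , f) → R.+-assoc a c e , R.+-assoc b d f
              }
            ; identity =
                (λ (a , b) → R.+-identityˡ a , R.+-identityˡ b) ,
                (λ (a , b) → R.+-identityʳ a , R.+-identityʳ b)
            }
          ; inverse =
              (λ (a , b) → R.-‿inverseˡ a , R.-‿inverseˡ b) ,
              (λ (a , b) → R.-‿inverseʳ a , R.-‿inverseʳ b)
          ; ⁻¹-cong = λ {(a , b)} {(c , d)} (p , q) →
              R.-‿cong {a} {c} p , R.-‿cong {b} {d} q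
          }
        ; comm = λ (a , b) (c , d) → R.+-comm a c , R.+-comm b d
        }
      ; *-cong = λ {x} {x′} {y} {y′} → *-cong {x} {x′} {y} {y′}
      ; *-assoc = *-assoc
      ; *-identity = Derive.comm∧idˡ⇒id {_*_} *-comm {1#} *-identityˡ
      ; distrib = Derive.comm∧distrˡ⇒distr {_*_} {_+_} (λ {x} {x′} {y} {y′} → +-cong {x} {x′} {y} {y′})
                    *-comm distribˡ
      }
    ; *-comm = *-comm
    }

open ComplexNumbers public using (ℂ; fromℝ)

ℂ-commutativeRing : CommutativeRing 0ℓ 0ℓ
ℂ-commutativeRing = record { isCommutativeRing = ComplexNumbers.isCommutativeRing }

-- Partitions of {1,…,n} are taken on Fin n: points are numbered from 0 instead of 1.
-- A partition is encoded as the vector whose i-th entry is the block of i.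
IsPartition : ∀ {n} → Vec (Subset n) n → Set
IsPartition V = (∀ i → i ∈ lookup V i) ×
                (∀ i j → j ∈ lookup V i → lookup V j ≡ lookup V i)

NonCrossing : {A : Set} (_<_ _~_ : Rel A 0ℓ) → Set
NonCrossing _<_ _~_ = ∀ a b c d → a < b → b < c → c < d → a ~ c → b ~ d → a ~ b

SameBlock : ∀ {n} → Vec (Subset n) n → Rel (Fin n) 0ℓ
SameBlock V i j = j ∈ lookup V i

IsNC : ∀ {n} → Vec (Subset n) n → Set
IsNC V = IsPartition V × NonCrossing Fin._<_ (SameBlock V)

infix 4 _≟ˢ_ _≟ᵛ_
_≟ˢ_ : ∀ {n} (W W′ : Subset n) → Dec (W ≡ W′)
_≟ˢ_ = ≡-dec Bool._≟_

_≟ᵛ_ : ∀ {n} (V V′ : Vec (Subset n) n) → Dec (V ≡ V′)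
_≟ᵛ_ = ≡-dec _≟ˢ_

isNC? : ∀ {n} (V : Vec (Subset n) n) → Dec (IsNC V)
isNC? V =
  (Fin.all? (λ i → i ∈? lookup V i) ×-dec
   Fin.all? (λ i → Fin.all? λ j →
     (j ∈? lookup V i) →-dec (lookup V j ≟ˢ lookup V i)))
  ×-dec
  Fin.all? (λ a → Fin.all? λ b → Fin.all? λ c → Fin.all? λ d →
    (a Fin.<? b) →-dec ((b Fin.<? c) →-dec ((c Fin.<? d) →-dec
    ((c ∈? lookup V a) →-dec ((d ∈? lookup V b) →-dec (b ∈? lookup V a))))))

-- NC(n).  The proof is irrelevant, so _≡_ on NC n is equality of partitions.
record NC (n : ℕ) : Set where
  constructor mkNC
  field
    blockVec : Vec (Subset n) n
    .isNC    : IsNC blockVec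

open NC public

isNC! : ∀ {n} (π : NC n) → IsNC (blockVec π)
isNC! (mkNC V p) = recompute (isNC? V) p

block : ∀ {n} → NC n → Fin n → Subset n
block π = lookup (blockVec π)

_[_∼_] : ∀ {n} → NC n → Rel (Fin n) 0ℓ
π [ i ∼ j ] = SameBlock (blockVec π) i j

-- The blocks of π, each listed once.
blocks : ∀ {n} → NC n → List (Subset n)
blocks π = deduplicate _≟ˢ_ (toList (blockVec π))

#blocks : ∀ {n} → NC n → ℕ
#blocks π = length (blocks π)

allVec : {A : Set} → List A → ∀ n → List (Vec A n)
allVec xs zero    = [] ∷ []
allVec xs (suc n) = cartesianProductWith _∷_ xs (allVec xs n)

-- The elements of NC(n), each listed once.
allNC : ∀ n → List (NC n)
allNC n = mapMaybe toNC (allVec (allVec (outside ∷ inside ∷ []) n) n)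
  where
  toNC : Vec (Subset n) n → Maybe (NC n)
  toNC V with isNC? V
  ... | yes p = just (mkNC V p)
  ... | no  _ = nothing

-- W is a union of blocks of π iff it contains the π-block of each of its points.
_IsUnionOfBlocksOf_ : ∀ {n} → Subset n → NC n → Set
W IsUnionOfBlocksOf π = ∀ i → i ∈ W → block π i ⊆ W

-- Reverse refinement: every block of σ is a union of blocks of π.
_≼_ : ∀ {n} → NC n → NC n → Set
π ≼ σ = ∀ i → block σ i IsUnionOfBlocksOf π

infix 4 _≼_ _≼?_
_≼?_ : ∀ {n} (π σ : NC n) → Dec (π ≼ σ)
π ≼? σ = Fin.all? λ i → Fin.all? λ j →
  (j ∈? block σ i) →-dec (block π j ⊆? block σ i)

interval : ∀ {n} → NC n → NC n → List (NC n)
interval π σ = filter (λ ρ → (π ≼? ρ) ×-dec (ρ ≼? σ)) (allNC _)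

∈-interval : ∀ {n} (π σ : NC n) {ρ} → ρ ∈ˡ interval π σ → π ≼ ρ × ρ ≼ σ
∈-interval π σ = proj₂ ∘ ∈-filter⁻ (λ ρ → (π ≼? ρ) ×-dec (ρ ≼? σ)) {xs = allNC _}

≼-refl : ∀ {n} (π : NC n) → π ≼ π
≼-refl π i j j∈πᵢ {k} = subst (k ∈_) (proj₂ (proj₁ (isNC! π)) i j j∈πᵢ)

1ₙ : ∀ {n} → NC n
1ₙ {n} = mkNC everything (((λ i → all-in i i) , same) , λ a b _ _ _ _ _ _ _ → all-in a b)
  where
  everything : Vec (Subset n) n
  everything = replicate n ⊤
  all-in : ∀ i j → j ∈ lookup everything i
  all-in i j = subst (j ∈_) (sym (lookup-replicate i ⊤)) ∈⊤
  same : ∀ i j → j ∈ lookup everything i → lookup everything j ≡ lookup everything i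
  same i j _ = trans (lookup-replicate j ⊤) (sym (lookup-replicate i ⊤))

0ₙ : ∀ {n} → NC n
0ₙ {n} = mkNC singletons ((in-own , same) , noncrossing)
  where
  singletons : Vec (Subset n) n
  singletons = tabulate ⁅_⁆
  in-own : ∀ i → i ∈ lookup singletons i
  in-own i rewrite lookup∘tabulate ⁅_⁆ i = x∈⁅x⁆ i
  only : ∀ i j → j ∈ lookup singletons i → j ≡ i
  only i j j∈ rewrite lookup∘tabulate ⁅_⁆ i = x∈⁅y⁆⇒x≡y i j∈
  same : ∀ i j → j ∈ lookup singletons i → lookup singletons j ≡ lookup singletons i
  same i j j∈ = cong (lookup singletons) (only i j j∈)
  noncrossing : NonCrossing Fin._<_ (SameBlock singletons)
  noncrossing a b c d a<b b<c c<d a~c b~d =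
    ⊥-elim (ℕ.<-irrefl (cong toℕ (sym (only a c a~c))) (ℕ.<-trans a<b b<c))

≼1ₙ : ∀ {n} (π : NC n) → π ≼ 1ₙ
≼1ₙ π i j _ {k} _ = subst (k ∈_) (sym (lookup-replicate i ⊤)) ∈⊤

0ₙ≼ : ∀ {n} (π : NC n) → 0ₙ ≼ π
0ₙ≼ π i j j∈πᵢ {k} k∈ rewrite lookup∘tabulate ⁅_⁆ j =
  subst (_∈ block π i) (sym (x∈⁅y⁆⇒x≡y j k∈)) j∈πᵢ

-- The increasing enumeration p₁ < ⋯ < pₘ of W.
element : ∀ {n} (W : Subset n) → Fin ∣ W ∣ → Fin n
element (inside  ∷ W) zero    = zero
element (inside  ∷ W) (suc k) = suc (element W k)
element (outside ∷ W) k       = suc (element W k)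

element-mono-< : ∀ {n} (W : Subset n) {i j} → i Fin.< j → element W i Fin.< element W j
element-mono-< (inside  ∷ W) {zero}  {suc j} _   = z<s
element-mono-< (inside  ∷ W) {suc i} {suc j} i<j = s<s (element-mono-< W (s<s⁻¹ i<j))
element-mono-< (outside ∷ W)                 i<j = s<s (element-mono-< W i<j)

restrict : ∀ {n} → NC n → (W : Subset n) → NC ∣ W ∣
restrict {n} π W = mkNC V ((in-own , same) , noncrossing)
  where
  p : Fin ∣ W ∣ → Fin n
  p = element W

  row : Fin ∣ W ∣ → Subset ∣ W ∣
  row i = tabulate λ j → lookup (block π (p i)) (p j)

  V : Vec (Subset ∣ W ∣) ∣ W ∣
  V = tabulate row

  into : ∀ i j → π [ p i ∼ p j ] → j ∈ lookup V i
  into i j pᵢ∼pⱼ rewrite lookup∘tabulate row i =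
    lookup⇒[]= j (row i) (trans (lookup∘tabulate _ j) ([]=⇒lookup pᵢ∼pⱼ))

  out : ∀ i j → j ∈ lookup V i → π [ p i ∼ p j ]
  out i j j∈ rewrite lookup∘tabulate row i =
    lookup⇒[]= (p j) (block π (p i)) (trans (sym (lookup∘tabulate _ j)) ([]=⇒lookup j∈))

  in-own : ∀ i → i ∈ lookup V i
  in-own i = into i i (proj₁ (proj₁ (isNC! π)) (p i))

  same : ∀ i j → j ∈ lookup V i → lookup V j ≡ lookup V i
  same i j j∈ rewrite lookup∘tabulate row j = trans
    (tabulate-cong λ k → cong (λ B → lookup B (p k))
      (proj₂ (proj₁ (isNC! π)) (p i) (p j) (out i j j∈)))
    (sym (lookup∘tabulate row i))

  noncrossing : NonCrossing Fin._<_ (SameBlock V)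
  noncrossing a b c d a<b b<c c<d a∼c b∼d = into a b
    (proj₂ (isNC! π) (p a) (p b) (p c) (p d)
      (element-mono-< W a<b) (element-mono-< W b<c) (element-mono-< W c<d)
      (out a c a∼c) (out b d b∼d))

first last : ∀ {n} → .{{ℕ.NonZero n}} → Fin n
first {suc n} = zero
last  {suc n} = fromℕ n

Irreducible : ∀ {n} → .{{ℕ.NonZero n}} → NC n → Set
Irreducible π = π [ first ∼ last ]

-- The order 1 < 1′ < 2 < 2′ < ⋯ on Fin n ⊎ Fin n, where i = inj₁ i and i′ = inj₂ i.
position : ∀ {n} → Fin n ⊎ Fin n → ℕ
position (inj₁ i) = 2 ℕ.* toℕ i
position (inj₂ i) = 1 ℕ.+ 2 ℕ.* toℕ i

-- π on the unprimed points together with σ on the primed points is non-crossing.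
Compatible : ∀ {n} → NC n → NC n → Set
Compatible π σ = NonCrossing (λ x y → position x ℕ.< position y)
                             (Pointwise (π [_∼_]) (σ [_∼_]))

infix 4 _IsKrewerasComplementOf_
record _IsKrewerasComplementOf_ {n} (κ π : NC n) : Set where
  field
    compatible : Compatible π κ
    largest    : ∀ σ → Compatible π σ → σ ≼ κ

record NC² : Set where
  constructor ⟨_,_⟩by_
  field
    {size}       : ℕ
    .{{size≢0}}  : ℕ.NonZero size
    lower upper  : NC size
    .lower≼upper : lower ≼ upper

⟨_,1⟩ : ∀ {n} → .{{ℕ.NonZero n}} → NC n → NC²
⟨ π ,1⟩ = ⟨ π , 1ₙ ⟩by ≼1ₙ π

⟨0,_⟩ : ∀ {n} → .{{ℕ.NonZero n}} → NC n → NC²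
⟨0, π ⟩ = ⟨ 0ₙ , π ⟩by 0ₙ≼ π

nonempty⇒nonZero : ∀ {n} (W : Subset n) → Nonempty W → ℕ.NonZero ∣ W ∣
nonempty⇒nonZero (inside  ∷ W) _                 = _
nonempty⇒nonZero (outside ∷ W) (suc i , there i∈W) = nonempty⇒nonZero W (i , i∈W)

∈-blocks⇒nonempty : ∀ {n} (σ : NC n) {W} → W ∈ˡ blocks σ → Nonempty W
∈-blocks⇒nonempty σ W∈σ =
  let W∈V = VecMem.∈-toList⁻ (∈-deduplicate⁻ _≟ˢ_ (toList (blockVec σ)) W∈σ)
      i   = index W∈V
  in i , subst (i ∈_) (sym (lookup-index W∈V)) (proj₁ (proj₁ (isNC! σ)) i)

module Convolution {c ℓ} (R : CommutativeRing c ℓ) where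

  open CommutativeRing R
  open Exponentiation semiring using (_^_)

  ∑ ∏ : ∀ {A : Set} (xs : List A) → (∀ {x} → x ∈ˡ xs → Carrier) → Carrier
  ∑ xs f = foldr _+_ 0# (mapWith∈ xs f)
  ∏ xs f = foldr _*_ 1# (mapWith∈ xs f)

  infix 4 _≐_
  _≐_ : Rel (NC² → Carrier) ℓ
  f ≐ g = ∀ x → f x ≈ g x

  infixl 7 _⋆_
  _⋆_ : (f g : NC² → Carrier) → NC² → Carrier
  (f ⋆ g) (⟨ π , σ ⟩by _) = ∑ (interval π σ) λ {ρ} ρ∈ →
    f (⟨ π , ρ ⟩by proj₁ (∈-interval π σ ρ∈)) * g (⟨ ρ , σ ⟩by proj₂ (∈-interval π σ ρ∈))

  δ : NC² → Carrier
  δ (⟨ π , σ ⟩by _) = if does (blockVec π ≟ᵛ blockVec σ) then 1# else 0#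

  -- Two-sided inverses for ⋆ are unique up to ≐, so v is g⁻¹.
  record _IsInverseOf_ (v g : NC² → Carrier) : Set ℓ where
    field
      inverseˡ : v ⋆ g ≐ δ
      inverseʳ : g ⋆ v ≐ δ

  -- g(π_W, 1_{|W|})
  atBlock : (NC² → Carrier) → ∀ {n} → NC n → (W : Subset n) → .(Nonempty W) → Carrier
  atBlock g π W W≢∅ = g (⟨_,1⟩ {{nonempty⇒nonZero W W≢∅}} (restrict π W))

  record 𝒢̃ (g : NC² → Carrier) : Set ℓ where
    field
      unital         : ∀ {n} → .{{_ : ℕ.NonZero n}} (π : NC n) →
                       g (⟨ π , π ⟩by ≼-refl π) ≈ 1#
      multiplicative : ∀ {n} → .{{_ : ℕ.NonZero n}} (π σ : NC n) .(π≼σ : π ≼ σ) →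
                       g (⟨ π , σ ⟩by π≼σ) ≈
                       ∏ (blocks σ) (λ {W} W∈σ → atBlock g π W (∈-blocks⇒nonempty σ W∈σ))

  record 𝒢 (g : NC² → Carrier) : Set ℓ where
    field
      semi-multiplicative : 𝒢̃ g
      kreweras            : ∀ {n} → .{{_ : ℕ.NonZero n}} (π κ : NC n) →
                            κ IsKrewerasComplementOf π → g ⟨ π ,1⟩ ≈ g ⟨0, κ ⟩

  -- g is the function u_q, which these conditions determine up to ≐.  Here x ^ 0 is 1#, also for x = 0#.
  record IsU (q : Carrier) (g : NC² → Carrier) : Set ℓ where
    field
      semi-multiplicative : 𝒢̃ g
      irreducible         : ∀ {n} → .{{_ : ℕ.NonZero n}} (π : NC n) →
                            Irreducible π → g ⟨ π ,1⟩ ≈ q ^ (#blocks π ℕ.∸ 1)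
      reducible           : ∀ {n} → .{{_ : ℕ.NonZero n}} (π : NC n) →
                            ¬ Irreducible π → g ⟨ π ,1⟩ ≈ 0#

open Convolution ℂ-commutativeRing public

{-# OPTIONS --safe #-}
-- Write h = u⁻¹ ⋆ f ⋆ u, so that u ⋆ h = f ⋆ u.  If i < j lie in the same block of π, the chord from i to j cuts
-- π into its restrictions to S = [i,j] and to T = [1,i) ∪ [j,n], and [π,1ₙ] ≅ [π_S,1] × [π_T,1].  Both u and f
-- satisfy g(π,1ₙ) = g(π_S,1) g(π_T,1), and therefore so does h.  By induction, h(π,1ₙ) = h(0ₙ,Kr(π)) then follows
-- from the case where the only two points in a common block are 1 and n: the claim is h(π,1ₙ) = h(0ₙ₋₁,1ₙ₋₁).
-- Put z(π,σ) = q^(|π|-|σ|) and v = u⁻¹ ⋆ z.  Multiplicative functions commute, so f ⋆ z = z ⋆ f and h ⋆ v = v ⋆ f.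
-- Since u(π,1ₙ) = z(π,1ₙ) for irreducible π, v(π,1ₙ) vanishes for irreducible π ≠ 1ₙ.  At the partition π in
-- question this gives h(π,1ₙ) = (h ⋆ v)(π,1ₙ) = (v ⋆ f)(π,1ₙ), and the last sum, reindexed by Kreweras complements
-- of partitions of n-1 points, is (f ⋆ u)(0ₙ₋₁,1ₙ₋₁) = (u ⋆ h)(0ₙ₋₁,1ₙ₋₁) = h(0ₙ₋₁,1ₙ₋₁).
module Submission where

open import Algebra.Bundles using (CommutativeMonoid; CommutativeRing)
open import Data.Bool.Base using (Bool; true; false; _xor_; _∧_; not)
import Data.Bool.Properties as Bool
open import Data.Empty using (⊥; ⊥-elim)
open import Data.Fin.Base as Fin using (Fin; zero; suc; toℕ; inject₁; fromℕ)
import Data.Fin.Properties as Fin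
open import Data.Fin.Subset using (Subset; inside; outside; _∈_; _∉_; _⊆_; ∣_∣; ⊤; ⁅_⁆; _∩_; ∁)
open import Data.Fin.Subset.Properties
  using (_∈?_; ⊆-antisym; ∈⊤; ∣⊤∣≡n; p⊂q⇒∣p∣<∣q∣; x∈⁅x⁆; x∈⁅y⁆⇒x≡y; p∩q⊆p; p∩q⊆q; x∈p∩q⁺; x∈p∩q⁻;
         x∈p⇒x∉∁p; x∈∁p⇒x∉p; x∉p⇒x∈∁p)
open import Data.List.Base as List
  using (List; []; _∷_; _++_; map; filter; length; mapMaybe; cartesianProduct)
import Data.List.Properties as List
open import Data.List.Membership.Propositional using () renaming (_∈_ to _∈ˡ_)
open import Data.List.Membership.Propositional.Properties
  using (∈-map⁺; ∈-map⁻; ∈-++⁺ˡ; ∈-++⁺ʳ; ∈-++⁻; ∈-∃++; ∈-filter⁺; ∈-filter⁻; ∈-tabulate⁺; ∈-tabulate⁻;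
         ∈-cartesianProduct⁺; ∈-cartesianProduct⁻; ∈-cartesianProductWith⁺; ∈-deduplicate⁺; ∈-deduplicate⁻)
open import Data.List.Membership.Propositional.Properties.WithK using (unique∧set⇒bag)
open import Data.List.Relation.Binary.BagAndSetEquality using (∼bag⇒↭)
import Data.List.Relation.Binary.Permutation.Propositional as ↭
open import Data.List.Relation.Binary.Permutation.Propositional using (_↭_)
open import Data.List.Relation.Binary.Permutation.Propositional.Properties using (↭-length)
open import Data.List.Relation.Unary.All as All using (All; []; _∷_)
import Data.List.Relation.Unary.All.Properties as All
open import Data.List.Relation.Unary.AllPairs using ([]; _∷_)
open import Data.List.Relation.Unary.Any using (here; there; any?)
import Data.List.Relation.Unary.Unique.DecPropositional.Properties as DecUnique
open import Data.List.Relation.Unary.Unique.Propositional using (Unique)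
import Data.List.Relation.Unary.Unique.Propositional.Properties as Unique
open import Data.Maybe.Base using (Maybe; just; nothing)
open import Data.Nat.Base as ℕ using (ℕ; zero; suc; z≤n; s≤s; s<s⁻¹; s≤s⁻¹)
open import Data.Nat.Induction using (<-wellFounded)
import Data.Nat.Properties as ℕ
open import Data.Product.Base using (Σ-syntax; ∃; _×_; _,_; proj₁; proj₂)
open import Data.Sum.Base using (_⊎_; inj₁; inj₂)
open import Data.Sum.Relation.Binary.Pointwise using (inj₁; inj₂)
open import Data.Unit.Base using (tt) renaming (⊤ to Unit)
open import Data.Vec.Base as Vec using (Vec; []; _∷_; lookup; tabulate)
import Data.Vec.Membership.Propositional.Properties as VecMem
open import Data.Vec.Properties
  using (∷-injective; lookup∘tabulate; tabulate∘lookup; tabulate-cong; lookup⇒[]=; []=⇒lookup; lookup-replicate)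
open import Data.Vec.Relation.Unary.Any using (index)
open import Data.Vec.Relation.Unary.Any.Properties using (lookup-index)
open import Function.Base using (_∘_; id)
open import Function.Bundles using (mk⇔)
open import Induction.WellFounded using (Acc; acc)
open import Level using (0ℓ)
open import Relation.Binary.Core using (Rel)
open import Relation.Binary.Definitions using (Decidable; tri<; tri≈; tri>)
open import Relation.Binary.PropositionalEquality as ≡ using (_≡_; _≢_; cong; cong₂; subst; subst₂)
open import Relation.Binary.Structures using (IsEquivalence)
open import Relation.Nullary using (¬_; Dec; yes; no; does; _×-dec_; _⊎-dec_; _→-dec_)
open import Relation.Nullary.Decidable using (dec-true)
open import Relation.Nullary.Decidable.Core using (recompute)
import Relation.Unary as U

open import Defs hiding (𝒢̃; 𝒢; IsU; _⋆_; δ; _≐_; _IsInverseOf_; atBlock; ∑; ∏)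

-- Subsets and partitions given by decidable predicates

-- The obstacle is that Kreweras complements and `u` ask for different cuts. Complements turn a
-- chord from i to j into a separation of [i,j) from the outer side T, so multiplicative functions
-- factor naturally over [i,j) and T, and both parts are smaller. For `u` this fails in general: in
-- [i,j) the end j is lost, and irreducibility with it. The closed side [i,j] is irreducible, and T
-- is irreducible exactly when π is, so `u` factors over [i,j] and T. Multiplicative functions obey
-- both laws, but u ⋆ h = f ⋆ u hands down to `h` only the closed one. For the chord from 1 to n the
-- closed side is everything, which is why that one partition needs its own argument. The function z
-- continues the formula for `u` from irreducible partitions to all of them while being
-- multiplicative. The final reindexing rests on v(π,ρ) = u(Kr(ρ'),1), with ρ' the restriction of ρ
-- to [1,n): the block of ρ through the chord contributes 1 if it is {1,n} and 0 otherwise, and it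
-- is {1,n} exactly when Kr(ρ') is irreducible. The last equality holds because u(0,τ) = 0 for τ ≠
-- 0.

module _ {n : ℕ} {P : Fin n → Set} (P? : U.Decidable P) where

  ⟪_⟫ : Subset n
  ⟪_⟫ = tabulate λ x → does (P? x)

  ∈⟪⟫⁺ : ∀ {x} → P x → x ∈ ⟪_⟫
  ∈⟪⟫⁺ {x} Px = lookup⇒[]= x ⟪_⟫ (≡.trans (lookup∘tabulate _ x) (dec-true (P? x) Px))

  ∈⟪⟫⁻ : ∀ {x} → x ∈ ⟪_⟫ → P x
  ∈⟪⟫⁻ {x} x∈ with P? x | ≡.trans (≡.sym (lookup∘tabulate (λ y → does (P? y)) x)) ([]=⇒lookup x∈)
  ... | yes Px | _ = Px
  ... | no  _  | ()

module _ {n : ℕ} (π : NC n) where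

  ∼-refl : ∀ x → π [ x ∼ x ]
  ∼-refl = proj₁ (proj₁ (isNC! π))

  ∼⇒≡ : ∀ {x y} → π [ x ∼ y ] → block π y ≡ block π x
  ∼⇒≡ {x} {y} = proj₂ (proj₁ (isNC! π)) x y

  ∼-sym : ∀ {x y} → π [ x ∼ y ] → π [ y ∼ x ]
  ∼-sym {x} x∼y = subst (x ∈_) (≡.sym (∼⇒≡ x∼y)) (∼-refl x)

  ∼-trans : ∀ {x y z} → π [ x ∼ y ] → π [ y ∼ z ] → π [ x ∼ z ]
  ∼-trans {z = z} x∼y = subst (z ∈_) (∼⇒≡ x∼y)

  ∼-reflexive : ∀ {x y} → x ≡ y → π [ x ∼ y ]
  ∼-reflexive {x} ≡.refl = ∼-refl x

  noncrossing : NonCrossing Fin._<_ (π [_∼_])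
  noncrossing = proj₂ (isNC! π)

  ∼? : ∀ x y → Dec (π [ x ∼ y ])
  ∼? x y = y ∈? block π x

blockVec-injective : ∀ {n} {π σ : NC n} → blockVec π ≡ blockVec σ → π ≡ σ
blockVec-injective {π = mkNC _ _} {mkNC _ _} ≡.refl = ≡.refl

NC-ext : ∀ {n} {π σ : NC n} → (∀ x y → π [ x ∼ y ] → σ [ x ∼ y ]) →
         (∀ x y → σ [ x ∼ y ] → π [ x ∼ y ]) → π ≡ σ
NC-ext {π = π} {σ} to from = blockVec-injective
  (≡.trans (≡.sym (tabulate∘lookup (blockVec π)))
  (≡.trans (tabulate-cong λ x → ⊆-antisym (λ {y} → to x y) (λ {y} → from x y))
         (tabulate∘lookup (blockVec σ))))

_≟ᴺ_ : ∀ {n} (π σ : NC n) → Dec (π ≡ σ)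
π ≟ᴺ σ with blockVec π ≟ᵛ blockVec σ
... | yes eq = yes (blockVec-injective eq)
... | no ¬eq = no (¬eq ∘ cong blockVec)

≼⇒∼ : ∀ {n} (π σ : NC n) → π ≼ σ → ∀ {x y} → π [ x ∼ y ] → σ [ x ∼ y ]
≼⇒∼ π σ π≼σ {x} = π≼σ x x (∼-refl σ x)

∼⇒≼ : ∀ {n} (π σ : NC n) → (∀ {x y} → π [ x ∼ y ] → σ [ x ∼ y ]) → π ≼ σ
∼⇒≼ π σ f x y x∼y y∼z = ∼-trans σ x∼y (f y∼z)

≼-trans : ∀ {n} (π ρ σ : NC n) → π ≼ ρ → ρ ≼ σ → π ≼ σ
≼-trans π ρ σ p q = ∼⇒≼ π σ (≼⇒∼ ρ σ q ∘ ≼⇒∼ π ρ p)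

≼-antisym : ∀ {n} (π σ : NC n) → π ≼ σ → σ ≼ π → π ≡ σ
≼-antisym π σ p q = NC-ext (λ _ _ → ≼⇒∼ π σ p) (λ _ _ → ≼⇒∼ σ π q)

1ₙ-∼ : ∀ {n} (x y : Fin n) → 1ₙ [ x ∼ y ]
1ₙ-∼ x y = subst (y ∈_) (≡.sym (lookup-replicate x ⊤)) ∈⊤

0ₙ-∼ : ∀ {n} {x y : Fin n} → 0ₙ [ x ∼ y ] → x ≡ y
0ₙ-∼ {x = x} {y} x∼y = ≡.sym (x∈⁅y⁆⇒x≡y x (subst (y ∈_) (lookup∘tabulate _ x) x∼y))
  where open import Data.Fin.Subset.Properties using (x∈⁅y⁆⇒x≡y)

module FromRelation {n : ℕ} {_~_ : Rel (Fin n) 0ℓ} (_~?_ : Decidable _~_)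
                    (equiv : IsEquivalence _~_) (nc : NonCrossing Fin._<_ _~_) where

  private
    module E = IsEquivalence equiv

    row : Fin n → Subset n
    row x = ⟪ (x ~?_) ⟫

    V : Vec (Subset n) n
    V = tabulate row

    into : ∀ {x y} → x ~ y → y ∈ lookup V x
    into {x} {y} x~y = subst (y ∈_) (≡.sym (lookup∘tabulate row x)) (∈⟪⟫⁺ (x ~?_) x~y)

    out : ∀ {x y} → y ∈ lookup V x → x ~ y
    out {x} {y} y∈ = ∈⟪⟫⁻ (x ~?_) (subst (y ∈_) (lookup∘tabulate row x) y∈)

    same : ∀ x y → y ∈ lookup V x → lookup V y ≡ lookup V x
    same x y y∈ = ⊆-antisym (λ z∈ → into (E.trans (out y∈) (out z∈)))
                            (λ z∈ → into (E.trans (E.sym (out y∈)) (out z∈)))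

  partition : NC n
  partition = mkNC V (((λ x → into E.refl) , same) ,
    λ a b c d a<b b<c c<d a~c b~d → into (nc a b c d a<b b<c c<d (out a~c) (out b~d)))

  ∼⁺ : ∀ {x y} → x ~ y → partition [ x ∼ y ]
  ∼⁺ = into

  ∼⁻ : ∀ {x y} → partition [ x ∼ y ] → x ~ y
  ∼⁻ = out

-- The list allNC

∈-allVec : ∀ {A : Set} {xs : List A} → (∀ x → x ∈ˡ xs) → ∀ {n} (v : Vec A n) → v ∈ˡ allVec xs n
∈-allVec all []      = here ≡.refl
∈-allVec all (x ∷ v) = ∈-cartesianProductWith⁺ _∷_ (all x) (∈-allVec all v)

allVec-! : ∀ {A : Set} {xs : List A} → Unique xs → ∀ n → Unique (allVec xs n)
allVec-! xs! zero    = [] ∷ []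
allVec-! xs! (suc n) = Unique.cartesianProductWith⁺ _∷_ ∷-injective xs! (allVec-! xs! n)

∈-mapMaybe⁺ : ∀ {A B : Set} (f : A → Maybe B) {xs x y} → x ∈ˡ xs → f x ≡ just y → y ∈ˡ mapMaybe f xs
∈-mapMaybe⁺ f (here ≡.refl) eq rewrite eq = here ≡.refl
∈-mapMaybe⁺ f {x′ ∷ _} (there x∈) eq with f x′
... | nothing = ∈-mapMaybe⁺ f x∈ eq
... | just _  = there (∈-mapMaybe⁺ f x∈ eq)

mapMaybe-! : ∀ {A B : Set} (f : A → Maybe B) (g : B → A) → (∀ x {y} → f x ≡ just y → g y ≡ x) →
             ∀ {xs} → Unique xs → Unique (mapMaybe f xs)
mapMaybe-! f g inv []         = []
mapMaybe-! f g inv {x ∷ xs} (x∉ ∷ xs!) with f x in eq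
... | nothing = mapMaybe-! f g inv xs!
... | just y  = fresh xs x∉ ∷ mapMaybe-! f g inv xs!
  where
  fresh : ∀ xs → All (x ≢_) xs → All (y ≢_) (mapMaybe f xs)
  fresh []        []         = []
  fresh (x′ ∷ xs) (x≢ ∷ x∉′) with f x′ in eq′
  ... | nothing = fresh xs x∉′
  ... | just y′ = (λ y≡y′ → x≢ (≡.trans (≡.sym (inv x eq)) (≡.trans (cong g y≡y′) (inv x′ eq′))))
                  ∷ fresh xs x∉′

private
  -- The filter used by `allNC` is local to it. Unification recovers it from the defining equation
  -- and so gives it a name for the two lemmas below.
  filterNC : ∀ n → Σ[ f ∈ (Vec (Subset n) n → Maybe (NC n)) ]
                   allNC n ≡ mapMaybe f (allVec (allVec (outside ∷ inside ∷ []) n) n)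
  filterNC n = _ , ≡.refl

  filterNC-complete : ∀ {n} (π : NC n) → proj₁ (filterNC n) (blockVec π) ≡ just π
  filterNC-complete {n} π with isNC? (blockVec π)
  ... | yes _ = ≡.refl
  ... | no ¬p = ⊥-elim (¬p (isNC! π))

  filterNC-sound : ∀ n V {π} → proj₁ (filterNC n) V ≡ just π → blockVec π ≡ V
  filterNC-sound n V eq with isNC? V
  filterNC-sound n V ≡.refl | yes _ = ≡.refl
  filterNC-sound n V ()   | no _

∈-allNC : ∀ {n} (π : NC n) → π ∈ˡ allNC n
∈-allNC {n} π = ∈-mapMaybe⁺ (proj₁ (filterNC n)) (∈-allVec (∈-allVec side) (blockVec π)) (filterNC-complete π)
  where
  side : ∀ b → b ∈ˡ (outside ∷ inside ∷ [])
  side false = here ≡.refl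
  side true  = there (here ≡.refl)

allNC-! : ∀ n → Unique (allNC n)
allNC-! n = mapMaybe-! (proj₁ (filterNC n)) blockVec (filterNC-sound n)
  (allVec-! (allVec-! (((λ ()) ∷ []) ∷ [] ∷ []) n) n)

-- The increasing enumeration of a subset

rank : ∀ {n} (W : Subset n) {x} → x ∈ W → Fin ∣ W ∣
rank (inside  ∷ W) Vec.here      = zero
rank (inside  ∷ W) (Vec.there p) = suc (rank W p)
rank (outside ∷ W) (Vec.there p) = rank W p

element-rank : ∀ {n} (W : Subset n) {x} (p : x ∈ W) → element W (rank W p) ≡ x
element-rank (inside  ∷ W) Vec.here      = ≡.refl
element-rank (inside  ∷ W) (Vec.there p) = cong suc (element-rank W p)
element-rank (outside ∷ W) (Vec.there p) = cong suc (element-rank W p)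

element-∈ : ∀ {n} (W : Subset n) a → element W a ∈ W
element-∈ (inside  ∷ W) zero    = Vec.here
element-∈ (inside  ∷ W) (suc a) = Vec.there (element-∈ W a)
element-∈ (outside ∷ W) a       = Vec.there (element-∈ W a)

Increasing : ∀ {m n} → (Fin m → Fin n) → Set
Increasing p = ∀ {a b} → a Fin.< b → p a Fin.< p b

module _ {m n} {p : Fin m → Fin n} (p↑ : Increasing p) where

  increasing⇒reflects-< : ∀ {a b} → p a Fin.< p b → a Fin.< b
  increasing⇒reflects-< {a} {b} pa<pb with Fin.<-cmp a b
  ... | tri< a<b _ _ = a<b
  ... | tri≈ _ ≡.refl _ = ⊥-elim (ℕ.<-irrefl ≡.refl pa<pb)
  ... | tri> _ _ b<a = ⊥-elim (ℕ.<-asym pa<pb (p↑ b<a))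

  increasing⇒injective : ∀ {a b} → p a ≡ p b → a ≡ b
  increasing⇒injective {a} {b} pa≡pb with Fin.<-cmp a b
  ... | tri< a<b _ _ = ⊥-elim (ℕ.<-irrefl (cong toℕ pa≡pb) (p↑ a<b))
  ... | tri≈ _ a≡b _ = a≡b
  ... | tri> _ _ b<a = ⊥-elim (ℕ.<-irrefl (cong toℕ (≡.sym pa≡pb)) (p↑ b<a))

element-injective : ∀ {n} (W : Subset n) {a b} → element W a ≡ element W b → a ≡ b
element-injective W = increasing⇒injective (element-mono-< W)

rank-cong : ∀ {n} (W : Subset n) {x y} {p : x ∈ W} {q : y ∈ W} → x ≡ y → rank W p ≡ rank W q
rank-cong W {p = p} {q} x≡y =
  element-injective W (≡.trans (element-rank W p) (≡.trans x≡y (≡.sym (element-rank W q))))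

rank-element : ∀ {n} (W : Subset n) a {p : element W a ∈ W} → rank W p ≡ a
rank-element W a {p} = element-injective W (element-rank W p)

rank-mono-< : ∀ {n} (W : Subset n) {x y} (p : x ∈ W) (q : y ∈ W) → x Fin.< y → rank W p Fin.< rank W q
rank-mono-< W p q x<y = increasing⇒reflects-< (element-mono-< W)
  (subst₂ Fin._<_ (≡.sym (element-rank W p)) (≡.sym (element-rank W q)) x<y)

increasing⇒≤ : ∀ {m n} (p : Fin m → Fin n) → Increasing p → ∀ a → toℕ a ℕ.≤ toℕ (p a)
increasing⇒≤ p p↑ zero    = z≤n
increasing⇒≤ {suc m} p p↑ (suc a) = ℕ.≤-trans
  (s≤s (increasing⇒≤ (p ∘ inject₁) (p↑ ∘ inject₁-mono) a))
  (p↑ {inject₁ a} {suc a} (s≤s (ℕ.≤-reflexive (Fin.toℕ-inject₁ a))))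
  where
  inject₁-mono : ∀ {a b : Fin m} → a Fin.< b → inject₁ a Fin.< inject₁ b
  inject₁-mono {a} {b} = subst₂ ℕ._<_ (≡.sym (Fin.toℕ-inject₁ a)) (≡.sym (Fin.toℕ-inject₁ b))

_⊆ᵢ_ : ∀ {m m′ n} → (Fin m → Fin n) → (Fin m′ → Fin n) → Set
p ⊆ᵢ p′ = ∀ a → ∃ λ b → p a ≡ p′ b

private
  -- By `sub` there is an increasing map r of indices with p = p′ ∘ r. An increasing self-map of
  -- `Fin m` satisfies a ≤ r a, hence p′ a ≤ p a.
  enumeration-≤ : ∀ {m n} {p p′ : Fin m → Fin n} → Increasing p → Increasing p′ →
                  p ⊆ᵢ p′ → ∀ a → p a Fin.≤ p′ a → p a ≡ p′ a
  enumeration-≤ {p = p} {p′} p↑ p′↑ sub a pa≤p′a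
    with b , pa≡p′b ← sub a with Fin.<-cmp a b
  ... | tri≈ _ ≡.refl _ = pa≡p′b
  ... | tri< a<b _ _ = ⊥-elim (ℕ.<-irrefl ≡.refl
          (ℕ.<-≤-trans (subst (p′ a Fin.<_) (≡.sym pa≡p′b) (p′↑ a<b)) pa≤p′a))
  ... | tri> _ _ b<a = ⊥-elim (ℕ.<⇒≱ b<a (subst (a Fin.≤_) rᵃ≡b (increasing⇒≤ r r↑ a)))
    where
    r = λ x → proj₁ (sub x)
    r↑ : Increasing r
    r↑ {x} {y} x<y = increasing⇒reflects-< p′↑
      (subst₂ Fin._<_ (proj₂ (sub x)) (proj₂ (sub y)) (p↑ x<y))
    rᵃ≡b : r a ≡ b
    rᵃ≡b = increasing⇒injective p′↑ (≡.trans (≡.sym (proj₂ (sub a))) pa≡p′b)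

enumeration-unique : ∀ {m n} {p p′ : Fin m → Fin n} → Increasing p → Increasing p′ →
                     p ⊆ᵢ p′ → p′ ⊆ᵢ p → ∀ a → p a ≡ p′ a
enumeration-unique {p = p} {p′} p↑ p′↑ sub sup a with ℕ.≤-total (toℕ (p a)) (toℕ (p′ a))
... | inj₁ pa≤p′a = enumeration-≤ p↑ p′↑ sub a pa≤p′a
... | inj₂ p′a≤pa = ≡.sym (enumeration-≤ p′↑ p↑ sup a p′a≤pa)

enumeration-size : ∀ {m m′ n} {p : Fin m → Fin n} {p′ : Fin m′ → Fin n} → Increasing p →
                   p ⊆ᵢ p′ → m ℕ.≤ m′
enumeration-size {p′ = p′} p↑ sub = Fin.injective⇒≤ {f = λ a → proj₁ (sub a)} λ {a} {b} eq →
  increasing⇒injective p↑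
    (≡.trans (proj₂ (sub a)) (≡.trans (cong p′ eq) (≡.sym (proj₂ (sub b)))))

_IsPullbackOf_Along_ : ∀ {m n} → NC m → NC n → (Fin m → Fin n) → Set
τ IsPullbackOf π Along p = ∀ a b → (τ [ a ∼ b ] → π [ p a ∼ p b ]) × (π [ p a ∼ p b ] → τ [ a ∼ b ])

-- Two enumerations of the same points have equal but not definitionally equal sizes, so the pulled
-- back partitions have different types. The equality is therefore stated under an arbitrary `Q`
-- uniform in the size, on two partitions at once as kernels need.
pullback-unique : ∀ {m m′ n} {p : Fin m → Fin n} {p′ : Fin m′ → Fin n} →
  Increasing p → Increasing p′ → p ⊆ᵢ p′ → p′ ⊆ᵢ p →
  ∀ {ℓ} {X : Set ℓ} (Q : ∀ {k} → NC k → NC k → X) {τ₁ τ₂ : NC m} {τ₁′ τ₂′ : NC m′} (π₁ π₂ : NC n) →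
  τ₁ IsPullbackOf π₁ Along p → τ₁′ IsPullbackOf π₁ Along p′ →
  τ₂ IsPullbackOf π₂ Along p → τ₂′ IsPullbackOf π₂ Along p′ →
  Q τ₁ τ₂ ≡ Q τ₁′ τ₂′
pullback-unique {p = p} {p′} p↑ p′↑ sub sup Q π₁ π₂ t₁ t₁′ t₂ t₂′
  with ≡.refl ← ℕ.≤-antisym (enumeration-size {p = p} {p′} p↑ sub) (enumeration-size {p = p′} {p} p′↑ sup) =
  cong₂ Q (same π₁ t₁ t₁′) (same π₂ t₂ t₂′)
  where
  same : ∀ {τ τ′} π → τ IsPullbackOf π Along p → τ′ IsPullbackOf π Along p′ → τ ≡ τ′
  same π t t′ = NC-ext
    (λ a b → proj₂ (t′ a b) ∘ subst₂ (π [_∼_]) (eq a) (eq b) ∘ proj₁ (t a b))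
    (λ a b → proj₂ (t a b) ∘ subst₂ (π [_∼_]) (≡.sym (eq a)) (≡.sym (eq b)) ∘ proj₁ (t′ a b))
    where eq = enumeration-unique p↑ p′↑ sub sup

-- Restriction

infixl 6 _↾_
_↾_ : ∀ {n} → NC n → (W : Subset n) → NC ∣ W ∣
_↾_ = restrict

module _ {n} (π : NC n) (W : Subset n) where

  private
    row : Fin ∣ W ∣ → Subset ∣ W ∣
    row a = tabulate λ b → lookup (block π (element W a)) (element W b)

  ↾-∼⁺ : ∀ {a b} → π [ element W a ∼ element W b ] → (π ↾ W) [ a ∼ b ]
  ↾-∼⁺ {a} {b} a∼b = subst (b ∈_) (≡.sym (lookup∘tabulate row a))
    (lookup⇒[]= b (row a) (≡.trans (lookup∘tabulate _ b) ([]=⇒lookup a∼b)))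

  ↾-∼⁻ : ∀ {a b} → (π ↾ W) [ a ∼ b ] → π [ element W a ∼ element W b ]
  ↾-∼⁻ {a} {b} a∼b = lookup⇒[]= (element W b) (block π (element W a))
    (≡.trans (≡.sym (lookup∘tabulate _ b)) ([]=⇒lookup (subst (b ∈_) (lookup∘tabulate row a) a∼b)))

  ↾-isPullback : (π ↾ W) IsPullbackOf π Along element W
  ↾-isPullback a b = ↾-∼⁻ , ↾-∼⁺

  ↾-rank⁺ : ∀ {x y} (p : x ∈ W) (q : y ∈ W) → π [ x ∼ y ] → (π ↾ W) [ rank W p ∼ rank W q ]
  ↾-rank⁺ p q = ↾-∼⁺ ∘ subst₂ (π [_∼_]) (≡.sym (element-rank W p)) (≡.sym (element-rank W q))

  ↾-rank⁻ : ∀ {x y} (p : x ∈ W) (q : y ∈ W) → (π ↾ W) [ rank W p ∼ rank W q ] → π [ x ∼ y ]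
  ↾-rank⁻ p q = subst₂ (π [_∼_]) (element-rank W p) (element-rank W q) ∘ ↾-∼⁻

↾-mono : ∀ {n} (π σ : NC n) → π ≼ σ → (W : Subset n) → π ↾ W ≼ σ ↾ W
↾-mono π σ π≼σ W = ∼⇒≼ (π ↾ W) (σ ↾ W) (↾-∼⁺ σ W ∘ ≼⇒∼ π σ π≼σ ∘ ↾-∼⁻ π W)

≡1ₙ : ∀ {n} {π : NC n} → (∀ x y → π [ x ∼ y ]) → π ≡ 1ₙ
≡1ₙ all = NC-ext (λ x y _ → 1ₙ-∼ x y) (λ x y _ → all x y)

≡0ₙ : ∀ {n} {π : NC n} → (∀ {x y} → π [ x ∼ y ] → x ≡ y) → π ≡ 0ₙ
≡0ₙ {π = π} only = NC-ext (λ x y x∼y → ∼-reflexive 0ₙ (only x∼y)) (λ x y x∼y → ∼-reflexive π (0ₙ-∼ x∼y))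

1ₙ↾ : ∀ {n} (W : Subset n) → 1ₙ ↾ W ≡ 1ₙ
1ₙ↾ W = ≡1ₙ λ a b → ↾-∼⁺ 1ₙ W (1ₙ-∼ (element W a) (element W b))

0ₙ↾ : ∀ {n} (W : Subset n) → 0ₙ ↾ W ≡ 0ₙ
0ₙ↾ W = ≡0ₙ λ a∼b → element-injective W (0ₙ-∼ (↾-∼⁻ 0ₙ W a∼b))

-- `A` comes with proofs that it is the image of `S′` in the ambient points, because it usually has
-- a description of its own, such as an intersection with a block.
↾-↾ : ∀ {n} (S : Subset n) (S′ : Subset ∣ S ∣) (A : Subset n) →
      (∀ {x} → x ∈ A → Σ[ p ∈ x ∈ S ] rank S p ∈ S′) → (∀ {a} → a ∈ S′ → element S a ∈ A) →
      ∀ {ℓ} {X : Set ℓ} (Q : ∀ {k} → NC k → NC k → X) (π σ : NC n) →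
      Q (π ↾ S ↾ S′) (σ ↾ S ↾ S′) ≡ Q (π ↾ A) (σ ↾ A)
↾-↾ S S′ A into onto Q π σ = pullback-unique
  {p = element S ∘ element S′} {element A}
  (element-mono-< S ∘ element-mono-< S′) (element-mono-< A)
  (λ a → rank A (onto (element-∈ S′ a)) , ≡.sym (element-rank A (onto (element-∈ S′ a))))
  (λ a → let p , q = into (element-∈ A a) in
     rank S′ q , ≡.trans (≡.sym (element-rank S p)) (cong (element S) (≡.sym (element-rank S′ q))))
  Q π σ (twice π) (↾-isPullback π A) (twice σ) (↾-isPullback σ A)
  where
  twice : ∀ π → (π ↾ S ↾ S′) IsPullbackOf π Along (element S ∘ element S′)
  twice π a b = ↾-∼⁻ π S ∘ ↾-∼⁻ (π ↾ S) S′ , ↾-∼⁺ (π ↾ S) S′ ∘ ↾-∼⁺ π S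

↾-all : ∀ {n} (W : Subset n) → (∀ x → x ∈ W) →
        ∀ {ℓ} {X : Set ℓ} (Q : ∀ {k} → NC k → NC k → X) (π σ : NC n) →
        Q (π ↾ W) (σ ↾ W) ≡ Q π σ
↾-all W all Q π σ = pullback-unique {p = element W} {id} (element-mono-< W) id
  (λ a → element W a , ≡.refl) (λ x → rank W (all x) , ≡.sym (element-rank W (all x)))
  Q π σ (↾-isPullback π W) (λ _ _ → id , id) (↾-isPullback σ W) (λ _ _ → id , id)

-- This relation on the ambient points is reflexive only on `W`; a gluing has to combine it with a
-- second such relation or with a retraction onto `W`.
Extend : ∀ {n} (W : Subset n) → NC ∣ W ∣ → Fin n → Fin n → Set
Extend W τ x y = Σ[ p ∈ x ∈ W ] Σ[ q ∈ y ∈ W ] τ [ rank W p ∼ rank W q ]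

module _ {n} (W : Subset n) (τ : NC ∣ W ∣) where

  extend? : ∀ x y → Dec (Extend W τ x y)
  extend? x y with x ∈? W | y ∈? W
  ... | no x∉ | _     = no (x∉ ∘ proj₁)
  ... | yes _ | no y∉ = no (y∉ ∘ proj₁ ∘ proj₂)
  ... | yes p | yes q with ∼? τ (rank W p) (rank W q)
  ...   | yes p∼q = yes (p , q , p∼q)
  ...   | no p≁q  = no λ (p′ , q′ , p′∼q′) →
          p≁q (subst₂ (τ [_∼_]) (rank-cong W ≡.refl) (rank-cong W ≡.refl) p′∼q′)

  extend-refl : ∀ {x y} → x ∈ W → x ≡ y → Extend W τ x y
  extend-refl p ≡.refl = p , p , ∼-refl τ _

  extend-sym : ∀ {x y} → Extend W τ x y → Extend W τ y x
  extend-sym (p , q , p∼q) = q , p , ∼-sym τ p∼q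

  extend-trans : ∀ {x y z} → Extend W τ x y → Extend W τ y z → Extend W τ x z
  extend-trans (p , q , p∼q) (q′ , r , q∼r) =
    p , r , ∼-trans τ p∼q (subst (λ a → τ [ a ∼ rank W r ]) (rank-cong W ≡.refl) q∼r)

  extend-noncrossing : NonCrossing Fin._<_ (Extend W τ)
  extend-noncrossing a b c d a<b b<c c<d (a∈ , c∈ , a∼c) (b∈ , d∈ , b∼d) =
    a∈ , b∈ , noncrossing τ _ _ _ _ (rank-mono-< W a∈ b∈ a<b) (rank-mono-< W b∈ c∈ b<c)
                (rank-mono-< W c∈ d∈ c<d) a∼c b∼d

  ↾≡ : (ρ : NC n) → (∀ {x y} → x ∈ W → y ∈ W → ρ [ x ∼ y ] → Extend W τ x y) →
       (∀ {x y} → Extend W τ x y → ρ [ x ∼ y ]) → ρ ↾ W ≡ τ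
  ↾≡ ρ to from = NC-ext
    (λ a b a∼b → let p , q , r = to (element-∈ W a) (element-∈ W b) (↾-∼⁻ ρ W a∼b) in
       subst₂ (τ [_∼_]) (rank-element W a) (rank-element W b) r)
    (λ a b a∼b → ↾-∼⁺ ρ W (from (element-∈ W a , element-∈ W b ,
       subst₂ (τ [_∼_]) (≡.sym (rank-element W a)) (≡.sym (rank-element W b)) a∼b)))

extend-mono : ∀ {n} (W : Subset n) (τ τ′ : NC ∣ W ∣) → τ ≼ τ′ → ∀ {x y} → Extend W τ x y → Extend W τ′ x y
extend-mono W τ τ′ τ≼τ′ (p , q , r) = p , q , ≼⇒∼ τ τ′ τ≼τ′ r

module _ {n} (ρ : NC n) (W : Subset n) where

  extend-↾⁺ : ∀ {x y} → x ∈ W → y ∈ W → ρ [ x ∼ y ] → Extend W (ρ ↾ W) x y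
  extend-↾⁺ p q x∼y = p , q , ↾-rank⁺ ρ W p q x∼y

  extend-↾⁻ : ∀ {x y} → Extend W (ρ ↾ W) x y → ρ [ x ∼ y ]
  extend-↾⁻ (p , q , p∼q) = ↾-rank⁻ ρ W p q p∼q

-- Finite sums and products

unique⇒↭ : ∀ {A : Set} {xs ys : List A} → Unique xs → Unique ys →
           (∀ {z} → z ∈ˡ xs → z ∈ˡ ys) → (∀ {z} → z ∈ˡ ys → z ∈ˡ xs) → xs ↭ ys
unique⇒↭ xs! ys! to from = ∼bag⇒↭ (unique∧set⇒bag xs! ys! (mk⇔ to from))

map-!-on : ∀ {A B : Set} {f : A → B} {xs} → (∀ {x y} → x ∈ˡ xs → y ∈ˡ xs → f x ≡ f y → x ≡ y) →
           Unique xs → Unique (map f xs)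
map-!-on inj [] = []
map-!-on {f = f} {xs = x ∷ xs} inj (x∉ ∷ xs!) =
  fresh xs id x∉ ∷ map-!-on (λ p q → inj (there p) (there q)) xs!
  where
  fresh : ∀ ys → (∀ {y} → y ∈ˡ ys → y ∈ˡ xs) → All (x ≢_) ys → All (f x ≢_) (map f ys)
  fresh []       sub []         = []
  fresh (y ∷ ys) sub (x≢ ∷ x∉′) =
    (λ eq → x≢ (inj (here ≡.refl) (there (sub (here ≡.refl))) eq)) ∷ fresh ys (sub ∘ there) x∉′

module BigOp {c ℓ} (M : CommutativeMonoid c ℓ) where

  open CommutativeMonoid M
  open import Algebra.Properties.CommutativeSemigroup commutativeSemigroup using (interchange)

  ⨀ : {A : Set} → List A → (A → Carrier) → Carrier
  ⨀ []       f = ε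
  ⨀ (x ∷ xs) f = f x ∙ ⨀ xs f

  ⨀-cong : ∀ {A : Set} (xs : List A) {f g : A → Carrier} → (∀ {x} → x ∈ˡ xs → f x ≈ g x) → ⨀ xs f ≈ ⨀ xs g
  ⨀-cong []       eq = refl
  ⨀-cong (x ∷ xs) eq = ∙-cong (eq (here ≡.refl)) (⨀-cong xs (eq ∘ there))

  ⨀-ε : ∀ {A : Set} (xs : List A) {f : A → Carrier} → (∀ {x} → x ∈ˡ xs → f x ≈ ε) → ⨀ xs f ≈ ε
  ⨀-ε []       eq = refl
  ⨀-ε (x ∷ xs) eq = trans (∙-cong (eq (here ≡.refl)) (⨀-ε xs (eq ∘ there))) (identityˡ ε)

  ⨀-∙ : ∀ {A : Set} (xs : List A) (f g : A → Carrier) → ⨀ xs (λ x → f x ∙ g x) ≈ ⨀ xs f ∙ ⨀ xs g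
  ⨀-∙ []       f g = sym (identityˡ ε)
  ⨀-∙ (x ∷ xs) f g = trans (∙-congˡ (⨀-∙ xs f g)) (interchange (f x) (g x) (⨀ xs f) (⨀ xs g))

  ⨀-swap : ∀ {A B : Set} (xs : List A) (ys : List B) (f : A → B → Carrier) →
           ⨀ xs (λ x → ⨀ ys (f x)) ≈ ⨀ ys (λ y → ⨀ xs (λ x → f x y))
  ⨀-swap []       ys f = sym (⨀-ε ys (λ _ → refl))
  ⨀-swap (x ∷ xs) ys f = trans (∙-congˡ (⨀-swap xs ys f)) (sym (⨀-∙ ys (f x) _))

  ⨀-++ : ∀ {A : Set} (xs ys : List A) (f : A → Carrier) → ⨀ (xs ++ ys) f ≈ ⨀ xs f ∙ ⨀ ys f
  ⨀-++ []       ys f = sym (identityˡ _)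
  ⨀-++ (x ∷ xs) ys f = trans (∙-congˡ (⨀-++ xs ys f)) (sym (assoc _ _ _))

  ⨀-map : ∀ {A B : Set} (h : A → B) (xs : List A) (f : B → Carrier) → ⨀ (map h xs) f ≡ ⨀ xs (f ∘ h)
  ⨀-map h []       f = ≡.refl
  ⨀-map h (x ∷ xs) f = cong (f (h x) ∙_) (⨀-map h xs f)

  ⨀-↭ : ∀ {A : Set} {xs ys : List A} → xs ↭ ys → (f : A → Carrier) → ⨀ xs f ≈ ⨀ ys f
  ⨀-↭ ↭.refl          f = refl
  ⨀-↭ (↭.prep x p)    f = ∙-congˡ (⨀-↭ p f)
  ⨀-↭ (↭.swap x y p) f =
    trans (∙-congˡ (∙-congˡ (⨀-↭ p f))) (trans (sym (assoc (f x) (f y) _))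
      (trans (∙-congʳ (comm (f x) (f y))) (assoc (f y) (f x) _)))
  ⨀-↭ (↭.trans p q)   f = trans (⨀-↭ p f) (⨀-↭ q f)

  ⨀-filter : ∀ {A : Set} {P : A → Set} (P? : U.Decidable P) (xs : List A) (f : A → Carrier) →
             (∀ {x} → ¬ P x → f x ≈ ε) → ⨀ (filter P? xs) f ≈ ⨀ xs f
  ⨀-filter P? []       f out = refl
  ⨀-filter P? (x ∷ xs) f out with P? x
  ... | yes _ = ∙-congˡ (⨀-filter P? xs f out)
  ... | no ¬p = trans (⨀-filter P? xs f out) (sym (trans (∙-congʳ (out ¬p)) (identityˡ _)))

  ⨀-single : ∀ {A : Set} {xs : List A} → Unique xs → (f : A → Carrier) → ∀ {x} → x ∈ˡ xs →
             (∀ {y} → y ≢ x → f y ≈ ε) → ⨀ xs f ≈ f x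
  ⨀-single {xs = x ∷ xs} (x∉ ∷ _) f (here ≡.refl) out =
    trans (∙-congˡ (⨀-ε xs λ y∈ → out λ y≡x → All.lookup x∉ y∈ (≡.sym y≡x))) (identityʳ _)
  ⨀-single (y∉ ∷ xs!) f (there x∈) out =
    trans (∙-congʳ (out (All.lookup y∉ x∈))) (trans (identityˡ _) (⨀-single xs! f x∈ out))

  ⨀-reindex : ∀ {A B : Set} {xs : List A} {ys : List B} → Unique xs → Unique ys → (φ : A → B) →
              (∀ {x} → x ∈ˡ xs → φ x ∈ˡ ys) →
              (∀ {x x′} → x ∈ˡ xs → x′ ∈ˡ xs → φ x ≡ φ x′ → x ≡ x′) →
              (∀ {y} → y ∈ˡ ys → ∃ λ x → x ∈ˡ xs × φ x ≡ y) →
              (f : B → Carrier) → ⨀ xs (f ∘ φ) ≈ ⨀ ys f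
  ⨀-reindex {xs = xs} {ys} xs! ys! φ into inj onto f = trans (sym (reflexive (⨀-map φ xs f)))
    (⨀-↭ (unique⇒↭ (map-!-on inj xs!) ys! to from) f)
    where
    to : ∀ {z} → z ∈ˡ map φ xs → z ∈ˡ ys
    to z∈ with _ , x∈ , ≡.refl ← ∈-map⁻ φ z∈ = into x∈
    from : ∀ {z} → z ∈ˡ ys → z ∈ˡ map φ xs
    from z∈ with _ , x∈ , ≡.refl ← onto z∈ = ∈-map⁺ φ x∈

module BigSum {c ℓ} (R : CommutativeRing c ℓ) where

  open CommutativeRing R
  open BigOp +-commutativeMonoid public
    renaming (⨀ to Sum; ⨀-cong to Sum-cong; ⨀-ε to Sum-0; ⨀-∙ to Sum-+; ⨀-swap to Sum-swap; ⨀-++ to Sum-++;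
              ⨀-map to Sum-map; ⨀-filter to Sum-filter; ⨀-single to Sum-single; ⨀-reindex to Sum-reindex)
    hiding (⨀-↭)

  Sum-*ˡ : ∀ {A : Set} (xs : List A) (c : Carrier) (f : A → Carrier) → c * Sum xs f ≈ Sum xs (λ x → c * f x)
  Sum-*ˡ []       c f = zeroʳ c
  Sum-*ˡ (x ∷ xs) c f = trans (distribˡ c (f x) _) (+-congˡ (Sum-*ˡ xs c f))

  Sum-*ʳ : ∀ {A : Set} (xs : List A) (c : Carrier) (f : A → Carrier) → Sum xs f * c ≈ Sum xs (λ x → f x * c)
  Sum-*ʳ xs c f = trans (*-comm _ c) (trans (Sum-*ˡ xs c f) (Sum-cong xs λ _ → *-comm c _))

  Sum-× : ∀ {A B : Set} (xs : List A) (ys : List B) (f : A → Carrier) (g : B → Carrier) →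
          Sum (cartesianProduct xs ys) (λ (x , y) → f x * g y) ≈ Sum xs f * Sum ys g
  Sum-× []       ys f g = sym (zeroˡ _)
  Sum-× (x ∷ xs) ys f g = trans (Sum-++ (map (x ,_) ys) _ _)
    (trans (+-cong (trans (reflexive (Sum-map (x ,_) ys _)) (sym (Sum-*ˡ ys (f x) g))) (Sum-× xs ys f g))
           (sym (distribʳ _ _ _)))

  -- The form in which a product decomposition of an interval enters a convolution: (φ , ψ) is a
  -- bijection from `xs` to the pairs from `ys` and `zs`, and the summand is a product along it.
  Sum-factor : ∀ {A B C : Set} {xs : List A} {ys : List B} {zs : List C} →
    Unique xs → Unique ys → Unique zs → (φ : A → B) (ψ : A → C) →
    (∀ {x} → x ∈ˡ xs → φ x ∈ˡ ys × ψ x ∈ˡ zs) →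
    (∀ {x x′} → x ∈ˡ xs → x′ ∈ˡ xs → φ x ≡ φ x′ → ψ x ≡ ψ x′ → x ≡ x′) →
    (∀ {y z} → y ∈ˡ ys → z ∈ˡ zs → ∃ λ x → x ∈ˡ xs × φ x ≡ y × ψ x ≡ z) →
    (f : A → Carrier) (g : B → Carrier) (h : C → Carrier) →
    (∀ {x} → x ∈ˡ xs → f x ≈ g (φ x) * h (ψ x)) →
    Sum xs f ≈ Sum ys g * Sum zs h
  Sum-factor {xs = xs} {ys} {zs} xs! ys! zs! φ ψ into inj onto f g h eq =
    trans (Sum-cong xs eq) (trans
      (Sum-reindex xs! (Unique.cartesianProduct⁺ ys! zs!) (λ x → φ x , ψ x)
        (λ x∈ → ∈-cartesianProduct⁺ (proj₁ (into x∈)) (proj₂ (into x∈)))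
        (λ x∈ x′∈ e → inj x∈ x′∈ (cong proj₁ e) (cong proj₂ e))
        (λ yz∈ → let y∈ , z∈ = ∈-cartesianProduct⁻ ys zs yz∈
                     x , x∈ , p , q = onto y∈ z∈ in x , x∈ , cong₂ _,_ p q)
        (λ (y , z) → g y * h z))
      (Sum-× ys zs g h))

-- Blocks of a restriction

module _ {n} (W : Subset n) (V : Subset ∣ W ∣) where

  image : Subset n
  image = ⟪ member? ⟫
    module Image where
    Member : Fin n → Set
    Member x = Σ[ p ∈ x ∈ W ] rank W p ∈ V
    member? : U.Decidable Member
    member? x with x ∈? W
    ... | no x∉ = no (x∉ ∘ proj₁)
    ... | yes p with rank W p ∈? V
    ...   | yes q = yes (p , q)
    ...   | no ¬q = no λ (p′ , q′) → ¬q (subst (_∈ V) (rank-cong W ≡.refl) q′)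

  ∈-image⁺ : ∀ {x} (p : x ∈ W) → rank W p ∈ V → x ∈ image
  ∈-image⁺ p q = ∈⟪⟫⁺ Image.member? (p , q)

  ∈-image⁻ : ∀ {x} → x ∈ image → Σ[ p ∈ x ∈ W ] rank W p ∈ V
  ∈-image⁻ = ∈⟪⟫⁻ Image.member?

  element-∈-image : ∀ {a} → a ∈ V → element W a ∈ image
  element-∈-image {a} a∈ = ∈-image⁺ (element-∈ W a) (subst (_∈ V) (≡.sym (rank-element W a)) a∈)

image-injective : ∀ {n} (W : Subset n) {V V′} → image W V ≡ image W V′ → V ≡ V′
image-injective W {V} {V′} eq = ⊆-antisym (sub V V′ eq) (sub V′ V (≡.sym eq))
  where
  sub : ∀ V V′ → image W V ≡ image W V′ → V ⊆ V′
  sub V V′ eq {a} a∈ = subst (_∈ V′) (rank-element W a)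
    (proj₂ (∈-image⁻ W V′ (subst (element W a ∈_) eq (element-∈-image W V a∈))))

module _ {n} (σ : NC n) where

  blocks-! : Unique (blocks σ)
  blocks-! = DecUnique.deduplicate-! _≟ˢ_ (Vec.toList (blockVec σ))

  ∈-blocks⁺ : ∀ x → block σ x ∈ˡ blocks σ
  ∈-blocks⁺ x = ∈-deduplicate⁺ _≟ˢ_ (VecMem.∈-toList⁺ (VecMem.∈-lookup x (blockVec σ)))

  ∈-blocks⁻ : ∀ {W} → W ∈ˡ blocks σ → ∃ λ x → W ≡ block σ x
  ∈-blocks⁻ W∈ =
    let W∈V = VecMem.∈-toList⁻ (∈-deduplicate⁻ _≟ˢ_ (Vec.toList (blockVec σ)) W∈)
    in index W∈V , lookup-index W∈V

Separates : ∀ {n} → Subset n → Subset n → NC n → Set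
Separates A B σ = ∀ {x y} → x ∈ A → y ∈ B → ¬ σ [ x ∼ y ]

module _ {n} {A B : Subset n} (σ : NC n) (cover : ∀ x → x ∈ A ⊎ x ∈ B) (sep : Separates A B σ) where

  private
    -- Separation keeps the `σ`-block of a point of `A` inside `A`, so restricting loses none of it.
    block-image : ∀ {A B : Subset n} → (∀ x → x ∈ A ⊎ x ∈ B) → Separates A B σ →
                  ∀ {x} (p : x ∈ A) → image A (block (σ ↾ A) (rank A p)) ≡ block σ x
    block-image {A} {B} cover sep {x} p = ⊆-antisym
      (λ y∈ → let q , r = ∈-image⁻ A _ y∈ in ↾-rank⁻ σ A p q r)
      (λ {y} x∼y → let q = inA y x∼y in ∈-image⁺ A _ q (↾-rank⁺ σ A p q x∼y))
      where
      inA : ∀ y → σ [ x ∼ y ] → y ∈ A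
      inA y x∼y with cover y
      ... | inj₁ y∈A = y∈A
      ... | inj₂ y∈B = ⊥-elim (sep p y∈B x∼y)

    flip-cover : ∀ x → x ∈ B ⊎ x ∈ A
    flip-cover x with cover x
    ... | inj₁ p = inj₂ p
    ... | inj₂ p = inj₁ p

    flip-sep : Separates B A σ
    flip-sep p q = sep q p ∘ ∼-sym σ

    pieces : List (Subset n)
    pieces = map (image A) (blocks (σ ↾ A)) ++ map (image B) (blocks (σ ↾ B))

    side : ∀ {A B : Subset n} → (∀ x → x ∈ A ⊎ x ∈ B) → Separates A B σ →
           ∀ {W} → W ∈ˡ map (image A) (blocks (σ ↾ A)) → Σ[ x ∈ Fin n ] x ∈ A × W ≡ block σ x
    side {A} {B} cover sep W∈ with V , V∈ , ≡.refl ← ∈-map⁻ (image A) W∈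
      with a , ≡.refl ← ∈-blocks⁻ (σ ↾ A) V∈ = element A a , element-∈ A a ,
        ≡.trans (cong (image A ∘ block (σ ↾ A)) (≡.sym (rank-element A a)))
                (block-image {A} {B} cover sep (element-∈ A a))

    disjoint : ∀ {W} → W ∈ˡ map (image A) (blocks (σ ↾ A)) × W ∈ˡ map (image B) (blocks (σ ↾ B)) → ⊥
    disjoint (p , q) with x , x∈A , ≡.refl ← side {A} {B} cover sep p
      with y , y∈B , eq ← side {B} {A} flip-cover flip-sep q =
      sep x∈A y∈B (subst (y ∈_) (≡.sym eq) (∼-refl σ y))

    to : ∀ {W} → W ∈ˡ blocks σ → W ∈ˡ pieces
    to W∈ with x , ≡.refl ← ∈-blocks⁻ σ W∈ with cover x
    ... | inj₁ x∈A = ∈-++⁺ˡ (subst (_∈ˡ _) (block-image {A} {B} cover sep x∈A)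
                                   (∈-map⁺ (image A) (∈-blocks⁺ (σ ↾ A) _)))
    ... | inj₂ x∈B = ∈-++⁺ʳ _ (subst (_∈ˡ _) (block-image {B} {A} flip-cover flip-sep x∈B)
                                     (∈-map⁺ (image B) (∈-blocks⁺ (σ ↾ B) _)))

    from : ∀ {W} → W ∈ˡ pieces → W ∈ˡ blocks σ
    from W∈ with ∈-++⁻ (map (image A) (blocks (σ ↾ A))) W∈
    ... | inj₁ p with x , _ , ≡.refl ← side {A} {B} cover sep p = ∈-blocks⁺ σ x
    ... | inj₂ q with x , _ , ≡.refl ← side {B} {A} flip-cover flip-sep q = ∈-blocks⁺ σ x

  blocks-split : blocks σ ↭ map (image A) (blocks (σ ↾ A)) ++ map (image B) (blocks (σ ↾ B))
  blocks-split = unique⇒↭ (blocks-! σ)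
    (Unique.++⁺ (Unique.map⁺ (image-injective A) (blocks-! (σ ↾ A)))
                (Unique.map⁺ (image-injective B) (blocks-! (σ ↾ B))) disjoint) to from

  #blocks-split : #blocks σ ≡ #blocks (σ ↾ A) ℕ.+ #blocks (σ ↾ B)
  #blocks-split = ≡.trans (↭-length blocks-split)
    (≡.trans (List.length-++ (map (image A) (blocks (σ ↾ A))))
      (cong₂ ℕ._+_ (List.length-map (image A) (blocks (σ ↾ A))) (List.length-map (image B) (blocks (σ ↾ B)))))

blocks-1ₙ : ∀ {n} → blocks (1ₙ {suc n}) ≡ ⊤ ∷ []
blocks-1ₙ {n} = only (blocks 1ₙ) (blocks-! (1ₙ {suc n})) (∈-blocks⁺ 1ₙ zero)
  (λ W∈ → let x , eq = ∈-blocks⁻ (1ₙ {suc n}) W∈ in ≡.trans eq (all x))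
  where
  all : ∀ x → block (1ₙ {suc n}) x ≡ ⊤
  all x = ⊆-antisym (λ _ → ∈⊤) (λ {y} _ → 1ₙ-∼ x y)
  only : ∀ Ws → Unique Ws → block (1ₙ {suc n}) zero ∈ˡ Ws → (∀ {W} → W ∈ˡ Ws → W ≡ ⊤) → Ws ≡ ⊤ ∷ []
  only []            _             () _
  only (W ∷ [])      _             _  eq = cong (_∷ []) (eq (here ≡.refl))
  only (W ∷ W′ ∷ Ws) ((W≢ ∷ _) ∷ _) _ eq =
    ⊥-elim (W≢ (≡.trans (eq (here ≡.refl)) (≡.sym (eq (there (here ≡.refl))))))

-- Cutting along a chord

-- Together with `Outer`, the side [i,j) given by `false` partitions the points, as complements and
-- counting require. The side [i,j] given by `true` repeats `j`, so that both ends of the chord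
-- survive the restriction.
Inner : ∀ {n} → Bool → Fin n → Fin n → Fin n → Set
Inner false i j x = i Fin.≤ x × x Fin.< j
Inner true  i j x = i Fin.≤ x × x Fin.≤ j

Outer : ∀ {n} → Fin n → Fin n → Fin n → Set
Outer i j x = x Fin.< i ⊎ j Fin.≤ x

inner? : ∀ {n} b (i j : Fin n) → U.Decidable (Inner b i j)
inner? false i j x = (i Fin.≤? x) ×-dec (x Fin.<? j)
inner? true  i j x = (i Fin.≤? x) ×-dec (x Fin.≤? j)

outer? : ∀ {n} (i j : Fin n) → U.Decidable (Outer i j)
outer? i j x = (x Fin.<? i) ⊎-dec (j Fin.≤? x)

inner : ∀ {n} → Bool → Fin n → Fin n → Subset n
inner b i j = ⟪ inner? b i j ⟫

outer : ∀ {n} → Fin n → Fin n → Subset n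
outer i j = ⟪ outer? i j ⟫

inner⁻ : ∀ {n} b (i j : Fin n) {x} → x ∈ inner b i j → i Fin.≤ x × x Fin.≤ j
inner⁻ false i j x∈ = let p , q = ∈⟪⟫⁻ (inner? false i j) x∈ in p , ℕ.<⇒≤ q
inner⁻ true  i j x∈ = ∈⟪⟫⁻ (inner? true i j) x∈

inner⁺ : ∀ {n} b (i j : Fin n) {x} → i Fin.≤ x → x Fin.< j → x ∈ inner b i j
inner⁺ false i j p q = ∈⟪⟫⁺ (inner? false i j) (p , q)
inner⁺ true  i j p q = ∈⟪⟫⁺ (inner? true i j) (p , ℕ.<⇒≤ q)

-- A weakening of `Separates`: one block, that of `i`, may meet both sides.
record Cut {n} (A T : Subset n) (ρ : NC n) (i : Fin n) : Set where
  field
    cover : ∀ x → x ∈ A ⊎ x ∈ T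
    apart : ∀ {x y} → x ∈ A → y ∈ T → ρ [ x ∼ y ] → ρ [ i ∼ x ]

open Cut public

-- A block joining a point strictly between `i` and `j` to a point outside would cross the chord, so
-- by non-crossing it is the block of the chord.
cut : ∀ {n} b {i j : Fin n} (ρ : NC n) → i Fin.< j → ρ [ i ∼ j ] → Cut (inner b i j) (outer i j) ρ i
cut b {i} {j} ρ i<j i∼j .cover x with ℕ.<-≤-connex (toℕ x) (toℕ i) | ℕ.<-≤-connex (toℕ x) (toℕ j)
... | inj₁ x<i | _        = inj₂ (∈⟪⟫⁺ (outer? i j) (inj₁ x<i))
... | inj₂ i≤x | inj₁ x<j = inj₁ (inner⁺ b i j i≤x x<j)
... | inj₂ _   | inj₂ j≤x = inj₂ (∈⟪⟫⁺ (outer? i j) (inj₂ j≤x))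
cut b {i} {j} ρ i<j i∼j .apart {x} {y} x∈A y∈T x∼y
  with i≤x , x≤j ← inner⁻ b i j x∈A with Fin.<-cmp i x | Fin.<-cmp x j
... | tri≈ _ ≡.refl _ | _               = ∼-refl ρ i
... | tri> _ _ x<i    | _               = ⊥-elim (ℕ.<⇒≱ x<i i≤x)
... | tri< _ _ _      | tri≈ _ ≡.refl _ = i∼j
... | tri< _ _ _      | tri> _ _ j<x    = ⊥-elim (ℕ.<⇒≱ j<x x≤j)
... | tri< i<x _ _    | tri< x<j _ _ with ∈⟪⟫⁻ (outer? i j) y∈T | Fin.<-cmp j y
...   | inj₁ y<i | _ = ∼-trans ρ (∼-sym ρ (noncrossing ρ y i x j y<i i<x x<j (∼-sym ρ x∼y) i∼j)) (∼-sym ρ x∼y)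
...   | inj₂ _   | tri< j<y _ _    = noncrossing ρ i x j y i<x x<j j<y i∼j x∼y
...   | inj₂ _   | tri≈ _ ≡.refl _ = ∼-trans ρ i∼j (∼-sym ρ x∼y)
...   | inj₂ j≤y | tri> _ _ y<j    = ⊥-elim (ℕ.<⇒≱ y<j j≤y)

module _ {n} (S A : Subset n) where

  comap : Subset ∣ S ∣
  comap = ⟪ (λ a → element S a ∈? A) ⟫

  ∈-comap⁺ : ∀ {x} (p : x ∈ S) → x ∈ A → rank S p ∈ comap
  ∈-comap⁺ p q = ∈⟪⟫⁺ (λ a → element S a ∈? A) (subst (_∈ A) (≡.sym (element-rank S p)) q)

  ∈-comap⁻ : ∀ {a} → a ∈ comap → element S a ∈ A
  ∈-comap⁻ = ∈⟪⟫⁻ (λ a → element S a ∈? A)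

block-↾ : ∀ {n} (ρ : NC n) i → ρ ↾ block ρ i ≡ 1ₙ
block-↾ ρ i = ≡1ₙ λ a b → ↾-∼⁺ ρ (block ρ i)
  (∼-trans ρ (∼-sym ρ (element-∈ (block ρ i) a)) (element-∈ (block ρ i) b))

↾-1ₙ : ∀ {n} (ρ : NC n) (W : Subset n) i → (∀ {x} → x ∈ W → ρ [ i ∼ x ]) → ρ ↾ W ≡ 1ₙ
↾-1ₙ ρ W i sub = ≡1ₙ λ a b → ↾-∼⁺ ρ W (∼-trans ρ (∼-sym ρ (sub (element-∈ W a))) (sub (element-∈ W b)))

-- Quantities that factor over separated parts and along chords

module Splitting {c ℓ} (M : CommutativeMonoid c ℓ) where

  open CommutativeMonoid M
  open import Algebra.Properties.CommutativeSemigroup commutativeSemigroup using (interchange)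

  -- The monoid is left open because kernels factor under multiplication and block numbers under
  -- addition.
  Quantity : Set c
  Quantity = ∀ {n} → NC n → NC n → Carrier

  Splits : Quantity → Set ℓ
  Splits Q = ∀ {n} (A B : Subset n) (π σ : NC n) → π ≼ σ → (∀ x → x ∈ A ⊎ x ∈ B) → Separates A B σ →
             Q π σ ≈ Q (π ↾ A) (σ ↾ A) ∙ Q (π ↾ B) (σ ↾ B)

  ChordLaw : Bool → Quantity → Set ℓ
  ChordLaw b Q = ∀ {n} (π : NC n) {i j : Fin n} → i Fin.< j → π [ i ∼ j ] →
                 Q π 1ₙ ≈ Q (π ↾ inner b i j) 1ₙ ∙ Q (π ↾ outer i j) 1ₙ

  module _ (Q : Quantity) (splits : Splits Q) {n} (π σ : NC n) (π≼σ : π ≼ σ) where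

    split-within : (S A B : Subset n) → A ⊆ S → B ⊆ S → (∀ {x} → x ∈ S → x ∈ A ⊎ x ∈ B) → Separates A B σ →
                   Q (π ↾ S) (σ ↾ S) ≈ Q (π ↾ A) (σ ↾ A) ∙ Q (π ↾ B) (σ ↾ B)
    split-within S A B A⊆S B⊆S cov sep = trans
      (splits (comap S A) (comap S B) (π ↾ S) (σ ↾ S) (↾-mono π σ π≼σ S) cov′
        (λ p q → sep (∈-comap⁻ S A p) (∈-comap⁻ S B q) ∘ ↾-∼⁻ σ S))
      (reflexive (cong₂ _∙_ (collapse A A⊆S) (collapse B B⊆S)))
      where
      collapse : ∀ A → A ⊆ S → Q (π ↾ S ↾ comap S A) (σ ↾ S ↾ comap S A) ≡ Q (π ↾ A) (σ ↾ A)
      collapse A A⊆S = ↾-↾ S (comap S A) A (λ p → A⊆S p , ∈-comap⁺ S A (A⊆S p) p) (∈-comap⁻ S A) Q π σ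
      cov′ : ∀ a → a ∈ comap S A ⊎ a ∈ comap S B
      cov′ a with cov (element-∈ S a)
      ... | inj₁ p = inj₁ (∈⟪⟫⁺ (λ a → element S a ∈? A) p)
      ... | inj₂ p = inj₂ (∈⟪⟫⁺ (λ a → element S a ∈? B) p)

    split-at : (A W : Subset n) → (∀ {x y} → x ∈ W → σ [ x ∼ y ] → y ∈ W) →
               Q (π ↾ A) (σ ↾ A) ≈ Q (π ↾ A ∩ W) (σ ↾ A ∩ W) ∙ Q (π ↾ A ∩ ∁ W) (σ ↾ A ∩ ∁ W)
    split-at A W closed = split-within A (A ∩ W) (A ∩ ∁ W) (p∩q⊆p A W) (p∩q⊆p A (∁ W)) cov
      (λ p q x∼y → x∈∁p⇒x∉p (p∩q⊆q A (∁ W) q) (closed (p∩q⊆q A W p) x∼y))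
      where
      cov : ∀ {x} → x ∈ A → x ∈ A ∩ W ⊎ x ∈ A ∩ ∁ W
      cov {x} p with x ∈? W
      ... | yes q = inj₁ (x∈p∩q⁺ (p , q))
      ... | no ¬q = inj₂ (x∈p∩q⁺ (p , x∉p⇒x∈∁p ¬q))

    split-block : ∀ i → Q π σ ≈ Q (π ↾ block σ i) 1ₙ ∙ Q (π ↾ ∁ (block σ i)) (σ ↾ ∁ (block σ i))
    split-block i = trans
      (splits W (∁ W) π σ π≼σ cov λ p q x∼y → x∈∁p⇒x∉p q (∼-trans σ p x∼y))
      (∙-congʳ (reflexive (cong (Q (π ↾ W)) (block-↾ σ i))))
      where
      W = block σ i
      cov : ∀ x → x ∈ W ⊎ x ∈ ∁ W
      cov x with x ∈? W
      ... | yes q = inj₁ q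
      ... | no ¬q = inj₂ (x∉p⇒x∈∁p ¬q)

    module _ {i} {A T : Subset n} (ct : Cut A T σ i) where

      private
        W = block σ i

      split-cut : Q π σ ≈ Q (π ↾ W) 1ₙ ∙ (Q (π ↾ A ∩ ∁ W) (σ ↾ A ∩ ∁ W) ∙ Q (π ↾ T ∩ ∁ W) (σ ↾ T ∩ ∁ W))
      split-cut = trans (split-block i) (∙-congˡ
        (split-within (∁ W) (A ∩ ∁ W) (T ∩ ∁ W) (p∩q⊆q A (∁ W)) (p∩q⊆q T (∁ W)) cov
          (λ p q x∼y → x∈∁p⇒x∉p (p∩q⊆q A (∁ W) p) (apart ct (p∩q⊆p A (∁ W) p) (p∩q⊆p T (∁ W) q) x∼y))))
        where
        cov : ∀ {x} → x ∈ ∁ W → x ∈ A ∩ ∁ W ⊎ x ∈ T ∩ ∁ W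
        cov {x} p with cover ct x
        ... | inj₁ q = inj₁ (x∈p∩q⁺ (q , p))
        ... | inj₂ q = inj₂ (x∈p∩q⁺ (q , p))

      split-part : ∀ A → Q (π ↾ A) (σ ↾ A) ≈ Q (π ↾ A ∩ W) 1ₙ ∙ Q (π ↾ A ∩ ∁ W) (σ ↾ A ∩ ∁ W)
      split-part A = trans (split-at A W (∼-trans σ))
        (∙-congʳ (reflexive (cong (Q (π ↾ A ∩ W)) (↾-1ₙ σ (A ∩ W) i (p∩q⊆q A W)))))

  -- Only the block W of `σ` through the chord meets both sides. On W, where `σ` restricts to `1ₙ`,
  -- the given law applies. The other blocks are already sorted by side, and `interchange` reunites
  -- each side with its share of W.
  chord-extend : (Q : Quantity) → Splits Q → ∀ b → ChordLaw b Q →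
    ∀ {n} (π σ : NC n) → π ≼ σ → ∀ {i j : Fin n} → i Fin.< j → π [ i ∼ j ] →
    Q π σ ≈ Q (π ↾ inner b i j) (σ ↾ inner b i j) ∙ Q (π ↾ outer i j) (σ ↾ outer i j)
  chord-extend Q splits b law π σ π≼σ {i} {j} i<j i∼j = trans
    (split-cut Q splits π σ π≼σ ct)
    (trans (∙-congʳ law′) (trans (interchange _ _ _ _)
      (∙-cong (sym (split-part Q splits π σ π≼σ ct (inner b i j)))
              (sym (split-part Q splits π σ π≼σ ct (outer i j))))))
    where
    i∼j′ = ≼⇒∼ π σ π≼σ i∼j
    ct = cut b σ i<j i∼j′
    W = block σ i
    i∈ : i ∈ W
    i∈ = ∼-refl σ i
    i′ = rank W i∈
    j′ = rank W i∼j′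

    ≤⁺ : ∀ {x y} (p : x ∈ W) (q : y ∈ W) → x Fin.≤ y → rank W p Fin.≤ rank W q
    ≤⁺ {x} {y} p q x≤y with ℕ.<-≤-connex (toℕ (rank W q)) (toℕ (rank W p))
    ... | inj₂ p≤q = p≤q
    ... | inj₁ q<p = ⊥-elim (ℕ.<⇒≱ (subst₂ Fin._<_ (element-rank W q) (element-rank W p) (element-mono-< W q<p)) x≤y)

    ≤⁻ : ∀ {x} (p : x ∈ W) a → rank W p Fin.≤ a → x Fin.≤ element W a
    ≤⁻ {x} p a p≤a with ℕ.<-≤-connex (toℕ (element W a)) (toℕ x)
    ... | inj₂ x≤a = x≤a
    ... | inj₁ a<x = ⊥-elim (ℕ.<⇒≱ (subst (Fin._< rank W p) (rank-element W a) (rank-mono-< W (element-∈ W a) p a<x)) p≤a)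

    ≤⁻ʳ : ∀ {x} (p : x ∈ W) a → a Fin.≤ rank W p → element W a Fin.≤ x
    ≤⁻ʳ {x} p a a≤p with ℕ.<-≤-connex (toℕ x) (toℕ (element W a))
    ... | inj₂ a≤x = a≤x
    ... | inj₁ x<a = ⊥-elim (ℕ.<⇒≱ (subst (rank W p Fin.<_) (rank-element W a) (rank-mono-< W p (element-∈ W a) x<a)) a≤p)

    <⁻ : ∀ {x} (p : x ∈ W) a → a Fin.< rank W p → element W a Fin.< x
    <⁻ {x} p a a<p = subst (element W a Fin.<_) (element-rank W p) (element-mono-< W a<p)

    inner⇒ : ∀ b {x} (p : x ∈ W) → x ∈ inner b i j → rank W p ∈ inner b i′ j′
    inner⇒ false p x∈ = let u , v = ∈⟪⟫⁻ (inner? false i j) x∈ in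
      ∈⟪⟫⁺ (inner? false i′ j′) (≤⁺ i∈ p u , rank-mono-< W p i∼j′ v)
    inner⇒ true  p x∈ = let u , v = ∈⟪⟫⁻ (inner? true i j) x∈ in
      ∈⟪⟫⁺ (inner? true i′ j′) (≤⁺ i∈ p u , ≤⁺ p i∼j′ v)

    inner⇐ : ∀ b {a} → a ∈ inner b i′ j′ → element W a ∈ inner b i j
    inner⇐ false {a} a∈ = let u , v = ∈⟪⟫⁻ (inner? false i′ j′) a∈ in
      ∈⟪⟫⁺ (inner? false i j) (≤⁻ i∈ a u , <⁻ i∼j′ a v)
    inner⇐ true  {a} a∈ = let u , v = ∈⟪⟫⁻ (inner? true i′ j′) a∈ in
      ∈⟪⟫⁺ (inner? true i j) (≤⁻ i∈ a u , ≤⁻ʳ i∼j′ a v)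

    outer⇒ : ∀ {x} (p : x ∈ W) → x ∈ outer i j → rank W p ∈ outer i′ j′
    outer⇒ p x∈ with ∈⟪⟫⁻ (outer? i j) x∈
    ... | inj₁ x<i = ∈⟪⟫⁺ (outer? i′ j′) (inj₁ (rank-mono-< W p i∈ x<i))
    ... | inj₂ j≤x = ∈⟪⟫⁺ (outer? i′ j′) (inj₂ (≤⁺ i∼j′ p j≤x))

    outer⇐ : ∀ {a} → a ∈ outer i′ j′ → element W a ∈ outer i j
    outer⇐ {a} a∈ with ∈⟪⟫⁻ (outer? i′ j′) a∈
    ... | inj₁ a<i = ∈⟪⟫⁺ (outer? i j) (inj₁ (<⁻ i∈ a a<i))
    ... | inj₂ j≤a = ∈⟪⟫⁺ (outer? i j) (inj₂ (≤⁻ i∼j′ a j≤a))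

    collapse : (A : Subset _) (A′ : Subset ∣ W ∣) → (∀ {x} (p : x ∈ W) → x ∈ A → rank W p ∈ A′) →
               (∀ {a} → a ∈ A′ → element W a ∈ A) →
               Q (π ↾ W ↾ A′) 1ₙ ≡ Q (π ↾ A ∩ W) 1ₙ
    collapse A A′ into onto = ≡.trans
      (cong (Q (π ↾ W ↾ A′)) (≡.sym (≡.trans (cong (_↾ A′) (1ₙ↾ W)) (1ₙ↾ A′))))
      (≡.trans (↾-↾ W A′ (A ∩ W)
                 (λ p → let u , v = x∈p∩q⁻ A W p in v , into v u)
                 (λ p → x∈p∩q⁺ (onto p , element-∈ W _)) Q π 1ₙ)
               (cong (Q (π ↾ A ∩ W)) (1ₙ↾ (A ∩ W))))

    law′ : Q (π ↾ W) 1ₙ ≈ Q (π ↾ inner b i j ∩ W) 1ₙ ∙ Q (π ↾ outer i j ∩ W) 1ₙ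
    law′ = trans
      (law (π ↾ W) (rank-mono-< W i∈ i∼j′ i<j) (↾-rank⁺ π W i∈ i∼j′ i∼j))
      (reflexive (cong₂ _∙_
        (collapse (inner b i j) (inner b i′ j′) (inner⇒ b) (inner⇐ b))
        (collapse (outer i j) (outer i′ j′) outer⇒ outer⇐)))

-- Counting blocks

#blocks-1ₙ : ∀ {n} → Fin n → #blocks (1ₙ {n}) ≡ 1
#blocks-1ₙ {suc n} _ = cong Data.List.Base.length (blocks-1ₙ {n})
  where import Data.List.Base

module _ where
  open Splitting ℕ.+-0-commutativeMonoid

  #blocksˡ : Quantity
  #blocksˡ π _ = #blocks π

  #blocks-splits : Splits #blocksˡ
  #blocks-splits A B π σ π≼σ cov sep = #blocks-split π cov λ p q → sep p q ∘ ≼⇒∼ π σ π≼σ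

  -- The block of the chord is counted on both sides, every other block on exactly one.
  #blocks-chord : ∀ b {n} (π : NC n) {i j : Fin n} → i Fin.< j → π [ i ∼ j ] →
    suc (#blocks π) ≡ #blocks (π ↾ inner b i j) ℕ.+ #blocks (π ↾ outer i j)
  #blocks-chord b π {i} {j} i<j i∼j = ≡.trans (cong suc whole) (≡.sym (≡.trans (cong₂ ℕ._+_
      (part (inner b i j) i (inner⁺ b i j ℕ.≤-refl i<j) (∼-refl π i))
      (part (outer i j) j (∈⟪⟫⁺ (outer? i j) (inj₂ ℕ.≤-refl)) i∼j))
      (ℕ.+-suc (suc (rest (inner b i j))) (rest (outer i j)))))
    where
    W = block π i
    ct = cut b π i<j i∼j
    rest = λ A → #blocks (π ↾ A ∩ ∁ W)
    ones : ∀ A x → x ∈ A → x ∈ W → (∀ {x} → x ∈ A → π [ i ∼ x ]) → #blocks (π ↾ A) ≡ 1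
    ones A x x∈A x∈W sub = ≡.trans (cong #blocks (↾-1ₙ π A i sub)) (#blocks-1ₙ (rank A x∈A))
    part : ∀ A x → x ∈ A → x ∈ W → #blocks (π ↾ A) ≡ suc (rest A)
    part A x x∈A x∈W = ≡.trans
      (split-part #blocksˡ #blocks-splits π π (≼-refl π) ct A)
      (cong (ℕ._+ rest A) (ones (A ∩ W) x (x∈p∩q⁺ (x∈A , x∈W)) x∈W (p∩q⊆q A W)))
    whole : #blocks π ≡ suc (rest (inner b i j) ℕ.+ rest (outer i j))
    whole = ≡.trans (split-cut #blocksˡ #blocks-splits π π (≼-refl π) ct)
      (cong (ℕ._+ (rest (inner b i j) ℕ.+ rest (outer i j))) (ones W i (∼-refl π i) (∼-refl π i) id))

-- Intervals of NC(n) as lists without repetition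

abstract
  -- Opaque, so that sums over NC(n) are compared term by term and never by unfolding the
  -- enumeration.
  elements : ∀ n → List (NC n)
  elements = allNC

  ∈-elements : ∀ {n} (π : NC n) → π ∈ˡ elements n
  ∈-elements = ∈-allNC

  elements-! : ∀ n → Unique (elements n)
  elements-! = allNC-!

between? : ∀ {n} (π σ ρ : NC n) → Dec (π ≼ ρ × ρ ≼ σ)
between? π σ ρ = (π ≼? ρ) ×-dec (ρ ≼? σ)

abstract
  segment : ∀ {n} → NC n → NC n → List (NC n)
  segment {n} π σ = filter (between? π σ) (elements n)

  segment≡ : ∀ {n} (π σ : NC n) → segment π σ ≡ filter (between? π σ) (elements n)
  segment≡ π σ = ≡.refl

  interval≡ : ∀ {n} (π σ : NC n) → interval π σ ≡ segment π σ
  interval≡ π σ = ≡.refl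

  ∈-segment⁺ : ∀ {n} (π ρ σ : NC n) → π ≼ ρ → ρ ≼ σ → ρ ∈ˡ segment π σ
  ∈-segment⁺ π ρ σ π≼ρ ρ≼σ = ∈-filter⁺ (between? π σ) (∈-elements ρ) (π≼ρ , ρ≼σ)

  ∈-segment⁻ : ∀ {n} (π ρ σ : NC n) → ρ ∈ˡ segment π σ → π ≼ ρ × ρ ≼ σ
  ∈-segment⁻ {n} π ρ σ = proj₂ ∘ ∈-filter⁻ (between? π σ) {xs = elements n}

  segment-! : ∀ {n} (π σ : NC n) → Unique (segment π σ)
  segment-! {n} π σ = Unique.filter⁺ (between? π σ) (elements-! n)

↾≡⇒∼ : ∀ {n} (ρ ρ′ : NC n) (W : Subset n) → ρ ↾ W ≡ ρ′ ↾ W → ∀ {x y} → x ∈ W → y ∈ W →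
       ρ [ x ∼ y ] → ρ′ [ x ∼ y ]
↾≡⇒∼ ρ ρ′ W eq p q = ↾-rank⁻ ρ′ W p q ∘ subst (λ τ → τ [ rank W p ∼ rank W q ]) eq ∘ ↾-rank⁺ ρ W p q

-- Gluing partitions of two separated parts

module _ {n} {A B : Subset n} (σ : NC n) (cov : ∀ x → x ∈ A ⊎ x ∈ B) (sep : Separates A B σ) where

  split-injective : (ρ ρ′ : NC n) → ρ ≼ σ → ρ′ ≼ σ → ρ ↾ A ≡ ρ′ ↾ A → ρ ↾ B ≡ ρ′ ↾ B → ρ ≡ ρ′
  split-injective ρ ρ′ ρ≼σ ρ′≼σ eqA eqB =
    NC-ext (λ _ _ → to ρ ρ′ ρ≼σ eqA eqB) (λ _ _ → to ρ′ ρ ρ′≼σ (≡.sym eqA) (≡.sym eqB))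
    where
    to : ∀ ρ ρ′ → ρ ≼ σ → ρ ↾ A ≡ ρ′ ↾ A → ρ ↾ B ≡ ρ′ ↾ B → ∀ {x y} → ρ [ x ∼ y ] → ρ′ [ x ∼ y ]
    to ρ ρ′ ρ≼σ eqA eqB {x} {y} x∼y with cov x | cov y
    ... | inj₁ p | inj₁ q = ↾≡⇒∼ ρ ρ′ A eqA p q x∼y
    ... | inj₂ p | inj₂ q = ↾≡⇒∼ ρ ρ′ B eqB p q x∼y
    ... | inj₁ p | inj₂ q = ⊥-elim (sep p q (≼⇒∼ ρ σ ρ≼σ x∼y))
    ... | inj₂ p | inj₁ q = ⊥-elim (sep q p (≼⇒∼ ρ σ ρ≼σ (∼-sym ρ x∼y)))

  split-glue : (π : NC n) → π ≼ σ → (ρ₁ : NC ∣ A ∣) (ρ₂ : NC ∣ B ∣) → π ↾ A ≼ ρ₁ → ρ₁ ≼ σ ↾ A →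
               π ↾ B ≼ ρ₂ → ρ₂ ≼ σ ↾ B →
               Σ[ ρ ∈ NC n ] (π ≼ ρ × ρ ≼ σ) × ρ ↾ A ≡ ρ₁ × ρ ↾ B ≡ ρ₂
  split-glue π π≼σ ρ₁ ρ₂ π≼ρ₁ ρ₁≼σ π≼ρ₂ ρ₂≼σ =
    ρ , (∼⇒≼ π ρ (∼⁺ ∘ lower) , ∼⇒≼ ρ σ (upper ∘ ∼⁻)) ,
    ↾≡ A ρ₁ ρ (λ p q → restrictA p q ∘ ∼⁻) (∼⁺ ∘ inj₁) ,
    ↾≡ B ρ₂ ρ (λ p q → restrictB p q ∘ ∼⁻) (∼⁺ ∘ inj₂)
    where
    _~_ : Fin n → Fin n → Set
    x ~ y = Extend A ρ₁ x y ⊎ Extend B ρ₂ x y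

    disjoint : ∀ {x} → x ∈ A → x ∈ B → ⊥
    disjoint p q = sep p q (∼-refl σ _)

    upper : ∀ {x y} → x ~ y → σ [ x ∼ y ]
    upper (inj₁ r) = extend-↾⁻ σ A (extend-mono A ρ₁ (σ ↾ A) ρ₁≼σ r)
    upper (inj₂ r) = extend-↾⁻ σ B (extend-mono B ρ₂ (σ ↾ B) ρ₂≼σ r)

    lower : ∀ {x y} → π [ x ∼ y ] → x ~ y
    lower {x} {y} x∼y with cov x | cov y
    ... | inj₁ p | inj₁ q = inj₁ (extend-mono A (π ↾ A) ρ₁ π≼ρ₁ (extend-↾⁺ π A p q x∼y))
    ... | inj₂ p | inj₂ q = inj₂ (extend-mono B (π ↾ B) ρ₂ π≼ρ₂ (extend-↾⁺ π B p q x∼y))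
    ... | inj₁ p | inj₂ q = ⊥-elim (sep p q (≼⇒∼ π σ π≼σ x∼y))
    ... | inj₂ p | inj₁ q = ⊥-elim (sep q p (≼⇒∼ π σ π≼σ (∼-sym π x∼y)))

    tr : ∀ {x y z} → x ~ y → y ~ z → x ~ z
    tr (inj₁ p) (inj₁ q) = inj₁ (extend-trans A ρ₁ p q)
    tr (inj₂ p) (inj₂ q) = inj₂ (extend-trans B ρ₂ p q)
    tr (inj₁ (_ , p , _)) (inj₂ (q , _)) = ⊥-elim (disjoint p q)
    tr (inj₂ (_ , p , _)) (inj₁ (q , _)) = ⊥-elim (disjoint q p)

    sm : ∀ {x y} → x ~ y → y ~ x
    sm (inj₁ p) = inj₁ (extend-sym A ρ₁ p)
    sm (inj₂ p) = inj₂ (extend-sym B ρ₂ p)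

    rf : ∀ {x} → x ~ x
    rf {x} with cov x
    ... | inj₁ p = inj₁ (extend-refl A ρ₁ p ≡.refl)
    ... | inj₂ p = inj₂ (extend-refl B ρ₂ p ≡.refl)

    nc : NonCrossing Fin._<_ _~_
    nc a b c d a<b b<c c<d (inj₁ p) (inj₁ q) = inj₁ (extend-noncrossing A ρ₁ a b c d a<b b<c c<d p q)
    nc a b c d a<b b<c c<d (inj₂ p) (inj₂ q) = inj₂ (extend-noncrossing B ρ₂ a b c d a<b b<c c<d p q)
    -- Pairs from different parts cannot cross: both are joined in `σ`, where the crossing would
    -- join `A` to `B`.
    nc a b c d a<b b<c c<d (inj₁ p) (inj₂ q) = ⊥-elim (sep (proj₁ p) (proj₁ q)
      (noncrossing σ a b c d a<b b<c c<d (upper (inj₁ p)) (upper (inj₂ q))))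
    nc a b c d a<b b<c c<d (inj₂ p) (inj₁ q) = ⊥-elim (sep (proj₁ q) (proj₁ p)
      (∼-sym σ (noncrossing σ a b c d a<b b<c c<d (upper (inj₂ p)) (upper (inj₁ q)))))

    restrictA : ∀ {x y} → x ∈ A → y ∈ A → x ~ y → Extend A ρ₁ x y
    restrictA p q (inj₁ r) = r
    restrictA p q (inj₂ r) = ⊥-elim (disjoint p (proj₁ r))

    restrictB : ∀ {x y} → x ∈ B → y ∈ B → x ~ y → Extend B ρ₂ x y
    restrictB p q (inj₂ r) = r
    restrictB p q (inj₁ r) = ⊥-elim (disjoint (proj₁ r) p)

    _~?_ : ∀ x y → Dec (x ~ y)
    x ~? y = extend? A ρ₁ x y ⊎-dec extend? B ρ₂ x y

    ~-isEquivalence : IsEquivalence _~_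
    ~-isEquivalence = record { refl = rf ; sym = sm ; trans = tr }

    open FromRelation _~?_ ~-isEquivalence nc renaming (partition to ρ)

-- Gluing partitions of the two sides of a chord

module _ {n} (A : Subset n) (i : Fin n) where

  -- Collapses everything outside `A` onto a base point. For a cut along a chord the base point is
  -- an end of the chord, so that the block shared by the two sides is represented on each of them.
  retract : Fin n → Fin n
  retract x with x ∈? A
  ... | yes _ = x
  ... | no  _ = i

  retract-in : ∀ {x} → x ∈ A → retract x ≡ x
  retract-in {x} p with x ∈? A
  ... | yes _ = ≡.refl
  ... | no ¬p = ⊥-elim (¬p p)

  retract-∈ : i ∈ A → ∀ x → retract x ∈ A
  retract-∈ i∈A x with x ∈? A
  ... | yes p = p
  ... | no _  = i∈A

module _ {n} (b : Bool) {i j : Fin n} (i<j : i Fin.< j) where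

  private
    A T : Subset n
    A = inner b i j
    T = outer i j

    toA toT : Fin n → Fin n
    toA = retract A i
    toT = retract T j

    i∈A : i ∈ A
    i∈A = inner⁺ b i j ℕ.≤-refl i<j

    j∈T : j ∈ T
    j∈T = ∈⟪⟫⁺ (outer? i j) (inj₂ ℕ.≤-refl)

    cov : ∀ x → x ∈ A ⊎ x ∈ T
    cov = cover (cut b 1ₙ i<j (1ₙ-∼ i j))

    ∉A⇒∈T : ∀ {x} → x ∉ A → x ∈ T
    ∉A⇒∈T {x} x∉A with cov x
    ... | inj₁ p = ⊥-elim (x∉A p)
    ... | inj₂ p = p

    ∉T⇒∈A : ∀ {x} → x ∉ T → x ∈ A
    ∉T⇒∈A {x} x∉T with cov x
    ... | inj₁ p = p
    ... | inj₂ p = ⊥-elim (x∉T p)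

    ∈A∩T⇒≡j : ∀ {x} → x ∈ A → x ∈ T → x ≡ j
    ∈A∩T⇒≡j p q with ∈⟪⟫⁻ (outer? i j) q
    ... | inj₁ x<i = ⊥-elim (ℕ.<⇒≱ x<i (proj₁ (inner⁻ b i j p)))
    ... | inj₂ j≤x = Fin.toℕ-injective (ℕ.≤-antisym (proj₂ (inner⁻ b i j p)) j≤x)

    ∈A⇒toT : ∀ {x} → x ∈ A → toT x ≡ j
    ∈A⇒toT {x} p with x ∈? T
    ... | yes q = ∈A∩T⇒≡j p q
    ... | no _  = ≡.refl

    A-convex : ∀ {x y z} → x ∈ A → x Fin.< y → y Fin.< z → z ∈ A → y ∈ A
    A-convex p x<y y<z q = inner⁺ b i j
      (ℕ.≤-trans (proj₁ (inner⁻ b i j p)) (ℕ.<⇒≤ x<y))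
      (ℕ.<-≤-trans y<z (proj₂ (inner⁻ b i j q)))

    i≡⊎i< : ∀ {x} → x ∈ A → i ≡ x ⊎ i Fin.< x
    i≡⊎i< {x} p with Fin.<-cmp i x
    ... | tri< i<x _ _ = inj₂ i<x
    ... | tri≈ _ i≡x _ = inj₁ i≡x
    ... | tri> _ _ x<i = ⊥-elim (ℕ.<⇒≱ x<i (proj₁ (inner⁻ b i j p)))

  module _ (σ : NC n) (i∼j : σ [ i ∼ j ]) where

    private
      ct = cut b σ i<j i∼j

    -- If only one of the two points is in `A`, then by `apart` it lies in the block of `i`, and `i`
    -- is where the other point is sent.
    chord-toA : ∀ {x y} → σ [ x ∼ y ] → σ [ toA x ∼ toA y ]
    chord-toA {x} {y} x∼y with x ∈? A | y ∈? A
    ... | yes _ | yes _ = x∼y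
    ... | no _  | no _  = ∼-refl σ i
    ... | yes p | no ¬q = ∼-sym σ (apart ct p (∉A⇒∈T ¬q) x∼y)
    ... | no ¬p | yes q = apart ct q (∉A⇒∈T ¬p) (∼-sym σ x∼y)

    chord-toT : ∀ {x y} → σ [ x ∼ y ] → σ [ toT x ∼ toT y ]
    chord-toT {x} {y} x∼y with x ∈? T | y ∈? T
    ... | yes _ | yes _ = x∼y
    ... | no _  | no _  = ∼-refl σ j
    ... | no ¬p | yes q = ∼-trans σ (∼-sym σ i∼j) (∼-trans σ (apart ct (∉T⇒∈A ¬p) q x∼y) x∼y)
    ... | yes p | no ¬q = ∼-sym σ (∼-trans σ (∼-sym σ i∼j)
                            (∼-trans σ (apart ct (∉T⇒∈A ¬q) p (∼-sym σ x∼y)) (∼-sym σ x∼y)))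

    -- Conversely, the two collapses determine a partition containing the chord: points on different
    -- sides are compared through i ∼ j.
    chord-from : ∀ {x y} → σ [ toA x ∼ toA y ] → σ [ toT x ∼ toT y ] → σ [ x ∼ y ]
    chord-from {x} {y} u v with x ∈? A | y ∈? A
    ... | yes _ | yes _ = u
    ... | no ¬p | no ¬q = subst₂ (σ [_∼_]) (retract-in T j (∉A⇒∈T ¬p)) (retract-in T j (∉A⇒∈T ¬q)) v
    ... | yes p | no ¬q = ∼-trans σ u (∼-trans σ i∼j
                            (subst₂ (σ [_∼_]) (∈A⇒toT p) (retract-in T j (∉A⇒∈T ¬q)) v))
    ... | no ¬p | yes q = ∼-sym σ (∼-trans σ (∼-sym σ u) (∼-trans σ i∼j
                            (∼-sym σ (subst₂ (σ [_∼_]) (retract-in T j (∉A⇒∈T ¬p)) (∈A⇒toT q) v))))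

  chord-injective : (ρ ρ′ : NC n) → ρ [ i ∼ j ] → ρ′ [ i ∼ j ] → ρ ↾ A ≡ ρ′ ↾ A → ρ ↾ T ≡ ρ′ ↾ T → ρ ≡ ρ′
  chord-injective ρ ρ′ p p′ eqA eqT =
    NC-ext (λ _ _ → to ρ ρ′ p p′ eqA eqT) (λ _ _ → to ρ′ ρ p′ p (≡.sym eqA) (≡.sym eqT))
    where
    to : ∀ ρ ρ′ → ρ [ i ∼ j ] → ρ′ [ i ∼ j ] → ρ ↾ A ≡ ρ′ ↾ A → ρ ↾ T ≡ ρ′ ↾ T →
         ∀ {x y} → ρ [ x ∼ y ] → ρ′ [ x ∼ y ]
    to ρ ρ′ p p′ eqA eqT {x} {y} x∼y = chord-from ρ′ p′
      (↾≡⇒∼ ρ ρ′ A eqA (retract-∈ A i i∈A x) (retract-∈ A i i∈A y) (chord-toA ρ p x∼y))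
      (↾≡⇒∼ ρ ρ′ T eqT (retract-∈ T j j∈T x) (retract-∈ T j j∈T y) (chord-toT ρ p x∼y))

  -- The glued relation is the intersection of the pullbacks of `ρ₁` and `ρ₂` along the two
  -- collapses, hence visibly an equivalence. A union of the two would need a transitive closure
  -- through the shared block.
  chord-glue : (π : NC n) → π [ i ∼ j ] → (ρ₁ : NC ∣ A ∣) (ρ₂ : NC ∣ T ∣) → π ↾ A ≼ ρ₁ → π ↾ T ≼ ρ₂ →
               Σ[ ρ ∈ NC n ] π ≼ ρ × ρ ↾ A ≡ ρ₁ × ρ ↾ T ≡ ρ₂
  chord-glue π i∼j ρ₁ ρ₂ π≼ρ₁ π≼ρ₂ =
    ρ , ∼⇒≼ π ρ (λ {x} {y} r → ∼⁺ {x} {y} (lower r)) ,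
    ↾≡ A ρ₁ ρ (λ {x} {y} p q r → restrictA p q (∼⁻ {x} {y} r)) (λ {x} {y} r → ∼⁺ {x} {y} (extendA r)) ,
    ↾≡ T ρ₂ ρ (λ {x} {y} p q r → restrictT p q (∼⁻ {x} {y} r)) (λ {x} {y} r → ∼⁺ {x} {y} (extendT r))
    where
    R₁ R₂ : Fin n → Fin n → Set
    R₁ = Extend A ρ₁
    R₂ = Extend T ρ₂

    _~_ : Fin n → Fin n → Set
    x ~ y = R₁ (toA x) (toA y) × R₂ (toT x) (toT y)

    lower : ∀ {x y} → π [ x ∼ y ] → x ~ y
    lower {x} {y} x∼y =
      extend-mono A (π ↾ A) ρ₁ π≼ρ₁
        (extend-↾⁺ π A (retract-∈ A i i∈A x) (retract-∈ A i i∈A y) (chord-toA π i∼j x∼y)) ,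
      extend-mono T (π ↾ T) ρ₂ π≼ρ₂
        (extend-↾⁺ π T (retract-∈ T j j∈T x) (retract-∈ T j j∈T y) (chord-toT π i∼j x∼y))

    restrictA : ∀ {x y} → x ∈ A → y ∈ A → x ~ y → R₁ x y
    restrictA p q (r , _) = subst₂ R₁ (retract-in A i p) (retract-in A i q) r

    restrictT : ∀ {x y} → x ∈ T → y ∈ T → x ~ y → R₂ x y
    restrictT p q (_ , r) = subst₂ R₂ (retract-in T j p) (retract-in T j q) r

    extendA : ∀ {x y} → R₁ x y → x ~ y
    extendA {x} r@(p , q , _) = subst₂ R₁ (≡.sym (retract-in A i p)) (≡.sym (retract-in A i q)) r ,
      extend-refl T ρ₂ (retract-∈ T j j∈T x) (≡.trans (∈A⇒toT p) (≡.sym (∈A⇒toT q)))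

    -- A point of T lies outside A, or it is j, which is in A only if the inner side is closed.
    toA∼i : ∀ {x} → x ∈ T → R₁ (toA x) i
    toA∼i {x} q with x ∈? A
    ... | no _  = extend-refl A ρ₁ i∈A ≡.refl
    ... | yes p = extend-mono A (π ↾ A) ρ₁ π≼ρ₁
      (extend-↾⁺ π A p i∈A (∼-sym π (subst (λ x → π [ i ∼ x ]) (≡.sym (∈A∩T⇒≡j p q)) i∼j)))

    extendT : ∀ {x y} → R₂ x y → x ~ y
    extendT r@(p , q , _) = extend-trans A ρ₁ (toA∼i p) (extend-sym A ρ₁ (toA∼i q)) ,
      subst₂ R₂ (≡.sym (retract-in T j p)) (≡.sym (retract-in T j q)) r

    tr₁ : ∀ {x y z} → R₁ x y → R₁ y z → R₁ x z
    tr₁ = extend-trans A ρ₁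

    sm₁ : ∀ {x y} → R₁ x y → R₁ y x
    sm₁ = extend-sym A ρ₁

    -- Past A the retraction jumps back to i, the least point of A, so it is only cyclically monotone.
    nc₁ : NonCrossing Fin._<_ (λ x y → R₁ (toA x) (toA y))
    nc₁ a b c d a<b b<c c<d u v with a ∈? A | b ∈? A | c ∈? A | d ∈? A
    ... | no _   | no _   | _      | _      = extend-refl A ρ₁ i∈A ≡.refl
    ... | yes _  | no _   | no _   | _      = u
    ... | yes a∈ | no b∉  | yes c∈ | _      = ⊥-elim (b∉ (A-convex a∈ a<b b<c c∈))
    ... | yes _  | yes b∈ | no c∉  | yes d∈ = ⊥-elim (c∉ (A-convex b∈ b<c c<d d∈))
    ... | no _   | yes b∈ | no c∉  | yes d∈ = ⊥-elim (c∉ (A-convex b∈ b<c c<d d∈))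
    ... | yes _  | yes _  | no _   | no _   = tr₁ u (sm₁ v)
    ... | no _   | yes _  | no _   | no _   = sm₁ v
    ... | no _   | yes _  | yes _  | no _   = sm₁ v
    ... | yes _  | yes _  | yes _  | yes _  = extend-noncrossing A ρ₁ a b c d a<b b<c c<d u v
    ... | no _   | yes b∈ | yes _  | yes _  with i≡⊎i< b∈
    ...   | inj₁ ≡.refl = extend-refl A ρ₁ i∈A ≡.refl
    ...   | inj₂ i<b  = extend-noncrossing A ρ₁ i b c d i<b b<c c<d u v
    nc₁ a b c d a<b b<c c<d u v | yes a∈ | yes _ | yes _ | no _ with i≡⊎i< a∈
    ...   | inj₁ ≡.refl = sm₁ v
    -- The point `d` has been sent to `i`, so the crossing is read in the order i < a < b < c.
    ...   | inj₂ i<a  = tr₁ (sm₁ (extend-noncrossing A ρ₁ i a b c i<a a<b b<c (sm₁ v) u)) (sm₁ v)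

    -- In contrast to the collapse onto `A`, this one is monotone: the points outside `T` form [i,j)
    -- and move up to `j`, the next point of `T`.
    toT-mono : ∀ {x y} → x Fin.< y → toT x Fin.≤ toT y
    toT-mono {x} {y} x<y with x ∈? T | y ∈? T
    ... | yes _ | yes _ = ℕ.<⇒≤ x<y
    ... | no _  | no _  = ℕ.≤-refl
    ... | yes _ | no ¬q = ℕ.≤-trans (ℕ.<⇒≤ x<y) (proj₂ (inner⁻ b i j (∉T⇒∈A ¬q)))
    ... | no ¬p | yes q with ∈⟪⟫⁻ (outer? i j) q
    ...   | inj₁ y<i = ⊥-elim (ℕ.<⇒≱ (ℕ.<-trans x<y y<i) (proj₁ (inner⁻ b i j (∉T⇒∈A ¬p))))
    ...   | inj₂ j≤y = j≤y

    nc₂ : NonCrossing Fin._<_ (λ x y → R₂ (toT x) (toT y))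
    nc₂ a b c d a<b b<c c<d u v
      with Fin.<-cmp (toT a) (toT b) | Fin.<-cmp (toT b) (toT c) | Fin.<-cmp (toT c) (toT d)
    ... | tri≈ _ a≡b _ | _ | _ = extend-refl T ρ₂ (retract-∈ T j j∈T a) a≡b
    ... | _ | tri≈ _ b≡c _ | _ = subst (R₂ (toT a)) (≡.sym b≡c) u
    ... | _ | _ | tri≈ _ c≡d _ = extend-trans T ρ₂ u (extend-sym T ρ₂ (subst (R₂ (toT b)) (≡.sym c≡d) v))
    ... | tri> _ _ b<a | _ | _ = ⊥-elim (ℕ.<⇒≱ b<a (toT-mono a<b))
    ... | _ | tri> _ _ c<b | _ = ⊥-elim (ℕ.<⇒≱ c<b (toT-mono b<c))
    ... | _ | _ | tri> _ _ d<c = ⊥-elim (ℕ.<⇒≱ d<c (toT-mono c<d))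
    ... | tri< a<b′ _ _ | tri< b<c′ _ _ | tri< c<d′ _ _ =
      extend-noncrossing T ρ₂ _ _ _ _ a<b′ b<c′ c<d′ u v

    _~?_ : ∀ x y → Dec (x ~ y)
    x ~? y = extend? A ρ₁ (toA x) (toA y) ×-dec extend? T ρ₂ (toT x) (toT y)

    ~-isEquivalence : IsEquivalence _~_
    ~-isEquivalence = record
      { refl  = λ {x} → extend-refl A ρ₁ (retract-∈ A i i∈A x) ≡.refl , extend-refl T ρ₂ (retract-∈ T j j∈T x) ≡.refl
      ; sym   = λ (u , v) → sm₁ u , extend-sym T ρ₂ v
      ; trans = λ (u , v) (u′ , v′) → tr₁ u u′ , extend-trans T ρ₂ v v′
      }

    nc : NonCrossing Fin._<_ _~_
    nc a b c d a<b b<c c<d (u , v) (u′ , v′) = nc₁ a b c d a<b b<c c<d u u′ , nc₂ a b c d a<b b<c c<d v v′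

    open FromRelation _~?_ ~-isEquivalence nc renaming (partition to ρ)

-- Upward induction in NC(n)

module _ {A : Set} {P Q : A → Set} (P? : U.Decidable P) (Q? : U.Decidable Q) (Q⇒P : ∀ {x} → Q x → P x) where

  length-filter-≤ : ∀ xs → length (filter Q? xs) ℕ.≤ length (filter P? xs)
  length-filter-≤ []       = z≤n
  length-filter-≤ (x ∷ xs) with Q? x | P? x
  ... | yes _ | yes _ = s≤s (length-filter-≤ xs)
  ... | yes q | no ¬p = ⊥-elim (¬p (Q⇒P q))
  ... | no _  | yes _ = ℕ.m≤n⇒m≤1+n (length-filter-≤ xs)
  ... | no _  | no _  = length-filter-≤ xs

  length-filter-< : ∀ {xs x} → x ∈ˡ xs → P x → ¬ Q x → length (filter Q? xs) ℕ.< length (filter P? xs)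
  length-filter-< {x ∷ xs} (here ≡.refl) Px ¬Qx with Q? x | P? x
  ... | yes q | _     = ⊥-elim (¬Qx q)
  ... | no _  | yes _ = s≤s (length-filter-≤ xs)
  ... | no _  | no ¬p = ⊥-elim (¬p Px)
  length-filter-< {y ∷ xs} (there x∈) Px ¬Qx with Q? y | P? y
  ... | yes _ | yes _ = s≤s (length-filter-< x∈ Px ¬Qx)
  ... | yes q | no ¬p = ⊥-elim (¬p (Q⇒P q))
  ... | no _  | yes _ = ℕ.m≤n⇒m≤1+n (length-filter-< x∈ Px ¬Qx)
  ... | no _  | no _  = length-filter-< x∈ Px ¬Qx

-- The measure is the number of partitions above `π`, which drops on moving strictly up.
≼-upward : ∀ {n p} (P : NC n → Set p) → (∀ π → (∀ ρ → π ≼ ρ → ρ ≢ π → P ρ) → P π) → ∀ π → P π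
≼-upward {n} P step π = go π (<-wellFounded _)
  where
  height : NC n → ℕ
  height π = length (filter (π ≼?_) (allNC n))
  go : ∀ π → Acc ℕ._<_ (height π) → P π
  go π (acc rs) = step π λ ρ π≼ρ ρ≢π → go ρ (rs
    (length-filter-< (π ≼?_) (ρ ≼?_) (λ {τ} → ≼-trans π ρ τ π≼ρ)
      (∈-allNC π) (≼-refl π) (λ ρ≼π → ρ≢π (≼-antisym ρ π ρ≼π π≼ρ))))

NC0-unique : (π σ : NC 0) → π ≡ σ
NC0-unique π σ = NC-ext (λ ()) (λ ())

∣∁∣< : ∀ {n} (W : Subset n) {x} → x ∈ W → ∣ ∁ W ∣ ℕ.< n
∣∁∣< {n} W {x} x∈W = subst (∣ ∁ W ∣ ℕ.<_) (∣⊤∣≡n n)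
  (p⊂q⇒∣p∣<∣q∣ ((λ _ → ∈⊤) , x , ∈⊤ , x∈p⇒x∉∁p x∈W))

-- Kernels on NC(n), convolution and cancellation

module Kernels {c ℓ} (R : CommutativeRing c ℓ) where

  open CommutativeRing R hiding (zero)
  open BigSum R public
  open BigOp *-commutativeMonoid public using ()
    renaming (⨀ to Prod; ⨀-cong to Prod-cong; ⨀-↭ to Prod-↭; ⨀-++ to Prod-++; ⨀-map to Prod-map)
  open Splitting *-commutativeMonoid public renaming (Quantity to Kernel)
  open import Algebra.Properties.CommutativeSemigroup *-commutativeSemigroup using () renaming (interchange to *-interchange)
  open import Algebra.Properties.Ring ring using (-‿+-comm; -0#≈0#; x[y-z]≈xy-xz)
  open import Algebra.Properties.Group +-group using (x∙y⁻¹≈ε⇒x≈y)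

  Triangular Unital : Kernel → Set ℓ
  Triangular k = ∀ {n} (π σ : NC n) → ¬ π ≼ σ → k π σ ≈ 0#
  Unital k = ∀ {n} (π : NC n) → k π π ≈ 1#

  -- A kernel acts on functions of one partition as a matrix on a column vector, and `⊛` acts on
  -- each column. Cancelling a left factor then concerns one column at a time.
  act : Kernel → ∀ {n} → (NC n → Carrier) → NC n → Carrier
  act k {n} x π = Sum (elements n) λ ρ → k π ρ * x ρ

  infixl 7 _⊛_
  _⊛_ : Kernel → Kernel → Kernel
  (k ⊛ l) π σ = act k (λ ρ → l ρ σ) π

  act-cong : ∀ (k : Kernel) → Triangular k → ∀ {n} (x y : NC n → Carrier) π → (∀ ρ → π ≼ ρ → x ρ ≈ y ρ) → act k x π ≈ act k y π
  act-cong k tri {n} x y π eq = Sum-cong (elements n) λ {ρ} _ → term ρ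
    where
    term : ∀ ρ → k π ρ * x ρ ≈ k π ρ * y ρ
    term ρ with π ≼? ρ
    ... | yes π≼ρ = *-congˡ (eq ρ π≼ρ)
    ... | no π⋠ρ  = trans (trans (*-congʳ (tri π ρ π⋠ρ)) (zeroˡ _)) (sym (trans (*-congʳ (tri π ρ π⋠ρ)) (zeroˡ _)))

  ⊛-assoc : ∀ (k l : Kernel) {n} (x : NC n → Carrier) π → act (k ⊛ l) x π ≈ act k (act l x) π
  ⊛-assoc k l {n} x π = trans
    (Sum-cong (elements n) λ {σ} _ → trans (Sum-*ʳ (elements n) (x σ) _) (Sum-cong (elements n) λ _ → *-assoc _ _ _))
    (trans (Sum-swap (elements n) (elements n) _)
      (Sum-cong (elements n) λ {ρ} _ → sym (Sum-*ˡ (elements n) (k π ρ) _)))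

  ⊛-triangular : ∀ (k l : Kernel) → Triangular k → Triangular l → Triangular (k ⊛ l)
  ⊛-triangular k l tk tl {n} π σ π⋠σ = Sum-0 (elements n) λ {ρ} _ → term ρ
    where
    term : ∀ ρ → k π ρ * l ρ σ ≈ 0#
    term ρ with π ≼? ρ
    ... | no π⋠ρ = trans (*-congʳ (tk π ρ π⋠ρ)) (zeroˡ _)
    ... | yes π≼ρ = trans (*-congˡ (tl ρ σ (π⋠σ ∘ ≼-trans π ρ σ π≼ρ))) (zeroʳ _)

  act-interval : ∀ (k : Kernel) → Triangular k → ∀ {n} (x : NC n → Carrier) π σ →
                 (∀ ρ → ¬ ρ ≼ σ → x ρ ≈ 0#) → act k x π ≈ Sum (segment π σ) (λ ρ → k π ρ * x ρ)
  act-interval k tri {n} x π σ supp = sym (trans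
    (reflexive (cong (λ xs → Sum xs (λ ρ → k π ρ * x ρ)) (segment≡ π σ)))
    (Sum-filter (between? π σ) (elements n) (λ ρ → k π ρ * x ρ) λ {ρ} → out ρ))
    where
    out : ∀ ρ → ¬ (π ≼ ρ × ρ ≼ σ) → k π ρ * x ρ ≈ 0#
    out ρ ¬in with π ≼? ρ
    ... | no π⋠ρ  = trans (*-congʳ (tri π ρ π⋠ρ)) (zeroˡ _)
    ... | yes π≼ρ = trans (*-congˡ (supp ρ λ ρ≼σ → ¬in (π≼ρ , ρ≼σ))) (zeroʳ _)

  -- Restriction to the parts identifies [π,σ] with [π ↾ A, σ ↾ A] × [π ↾ B, σ ↾ B], by
  -- `split-injective` and `split-glue`. The function `x` need not be a column of a kernel:
  -- `splits-cancel` applies this to a product of two columns.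
  act-split : ∀ (k : Kernel) → Triangular k → Splits k → ∀ {n} (A B : Subset n) (π σ : NC n) → π ≼ σ →
    (∀ x → x ∈ A ⊎ x ∈ B) → Separates A B σ →
    (x : NC n → Carrier) (x₁ : NC ∣ A ∣ → Carrier) (x₂ : NC ∣ B ∣ → Carrier) →
    (∀ ρ → ¬ ρ ≼ σ → x ρ ≈ 0#) → (∀ ρ → ¬ ρ ≼ σ ↾ A → x₁ ρ ≈ 0#) → (∀ ρ → ¬ ρ ≼ σ ↾ B → x₂ ρ ≈ 0#) →
    (∀ ρ → ρ ≼ σ → x ρ ≈ x₁ (ρ ↾ A) * x₂ (ρ ↾ B)) →
    act k x π ≈ act k x₁ (π ↾ A) * act k x₂ (π ↾ B)
  act-split k tri splits A B π σ π≼σ cov sep x x₁ x₂ supp supp₁ supp₂ factor = trans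
    (act-interval k tri x π σ supp)
    (trans
      (Sum-factor (segment-! π σ) (segment-! (π ↾ A) (σ ↾ A)) (segment-! (π ↾ B) (σ ↾ B)) (_↾ A) (_↾ B)
        (λ {ρ} ρ∈ → let p , q = ∈-segment⁻ π ρ σ ρ∈ in
          ∈-segment⁺ (π ↾ A) (ρ ↾ A) (σ ↾ A) (↾-mono π ρ p A) (↾-mono ρ σ q A) ,
          ∈-segment⁺ (π ↾ B) (ρ ↾ B) (σ ↾ B) (↾-mono π ρ p B) (↾-mono ρ σ q B))
        (λ {ρ} {ρ′} ρ∈ ρ′∈ → split-injective {A = A} {B} σ cov sep ρ ρ′ (proj₂ (∈-segment⁻ π ρ σ ρ∈)) (proj₂ (∈-segment⁻ π ρ′ σ ρ′∈)))
        (λ {ρ₁} {ρ₂} ρ₁∈ ρ₂∈ →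
          let p₁ , q₁ = ∈-segment⁻ (π ↾ A) ρ₁ (σ ↾ A) ρ₁∈
              p₂ , q₂ = ∈-segment⁻ (π ↾ B) ρ₂ (σ ↾ B) ρ₂∈
              ρ , (p , q) , eq₁ , eq₂ = split-glue {A = A} {B} σ cov sep π π≼σ ρ₁ ρ₂ p₁ q₁ p₂ q₂
          in ρ , ∈-segment⁺ π ρ σ p q , eq₁ , eq₂)
        (λ ρ → k π ρ * x ρ) (λ ρ → k (π ↾ A) ρ * x₁ ρ) (λ ρ → k (π ↾ B) ρ * x₂ ρ)
        (λ {ρ} ρ∈ → let p , q = ∈-segment⁻ π ρ σ ρ∈ in trans
          (*-cong (splits A B π ρ p cov (λ u v → sep u v ∘ ≼⇒∼ ρ σ q)) (factor ρ q))
          (*-interchange _ _ _ _)))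
      (sym (*-cong (act-interval k tri x₁ (π ↾ A) (σ ↾ A) supp₁) (act-interval k tri x₂ (π ↾ B) (σ ↾ B) supp₂))))

  ⊛-splits : ∀ (k l : Kernel) → Triangular k → Triangular l → Splits k → Splits l → Splits (k ⊛ l)
  ⊛-splits k l tk tl sk sl A B π σ π≼σ cov sep =
    act-split k tk sk A B π σ π≼σ cov sep (λ ρ → l ρ σ) (λ ρ → l ρ (σ ↾ A)) (λ ρ → l ρ (σ ↾ B))
      (λ ρ → tl ρ σ) (λ ρ → tl ρ (σ ↾ A)) (λ ρ → tl ρ (σ ↾ B))
      (λ ρ ρ≼σ → sl A B ρ σ ρ≼σ cov sep)

  -- The counterpart of `act-split` for [π,1ₙ] cut along a chord. The factorisation of `x` is asked
  -- only of partitions joining `i` and `j`, which includes everything above `π`.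
  act-chord : ∀ (k : Kernel) → Triangular k → Splits k → ∀ b → ChordLaw b k →
    ∀ {n} (π : NC n) {i j : Fin n} → i Fin.< j → π [ i ∼ j ] →
    (x : NC n → Carrier) (x₁ : NC ∣ inner b i j ∣ → Carrier) (x₂ : NC ∣ outer i j ∣ → Carrier) →
    (∀ ρ → ρ [ i ∼ j ] → x ρ ≈ x₁ (ρ ↾ inner b i j) * x₂ (ρ ↾ outer i j)) →
    act k x π ≈ act k x₁ (π ↾ inner b i j) * act k x₂ (π ↾ outer i j)
  act-chord k tri splits b law {n} π {i} {j} i<j i∼j x x₁ x₂ factor = trans
    (act-interval k tri x π (1ₙ {n}) (λ ρ ρ⋠1 → ⊥-elim (ρ⋠1 (≼1ₙ ρ))))
    (trans
      (Sum-factor (segment-! π 1ₙ) (segment-! (π ↾ A) 1ₙ) (segment-! (π ↾ T) 1ₙ) (_↾ A) (_↾ T)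
        (λ {ρ} ρ∈ → let p = proj₁ (∈-segment⁻ π ρ 1ₙ ρ∈) in
          ∈-segment⁺ (π ↾ A) (ρ ↾ A) 1ₙ (↾-mono π ρ p A) (≼1ₙ (ρ ↾ A)) ,
          ∈-segment⁺ (π ↾ T) (ρ ↾ T) 1ₙ (↾-mono π ρ p T) (≼1ₙ (ρ ↾ T)))
        (λ {ρ} {ρ′} ρ∈ ρ′∈ → chord-injective b i<j ρ ρ′ (above ρ ρ∈) (above ρ′ ρ′∈))
        (λ {ρ₁} {ρ₂} ρ₁∈ ρ₂∈ →
          let ρ , p , eq₁ , eq₂ = chord-glue b i<j π i∼j ρ₁ ρ₂
                (proj₁ (∈-segment⁻ (π ↾ A) ρ₁ 1ₙ ρ₁∈)) (proj₁ (∈-segment⁻ (π ↾ T) ρ₂ 1ₙ ρ₂∈))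
          in ρ , ∈-segment⁺ π ρ 1ₙ p (≼1ₙ ρ) , eq₁ , eq₂)
        (λ ρ → k π ρ * x ρ) (λ ρ → k (π ↾ A) ρ * x₁ ρ) (λ ρ → k (π ↾ T) ρ * x₂ ρ)
        (λ {ρ} ρ∈ → trans
          (*-cong (chord-extend k splits b law π ρ (proj₁ (∈-segment⁻ π ρ 1ₙ ρ∈)) i<j i∼j) (factor ρ (above ρ ρ∈)))
          (*-interchange _ _ _ _)))
      (sym (*-cong (act-interval k tri x₁ (π ↾ A) (1ₙ {∣ A ∣}) λ ρ ρ⋠1 → ⊥-elim (ρ⋠1 (≼1ₙ ρ)))
                   (act-interval k tri x₂ (π ↾ T) (1ₙ {∣ T ∣}) λ ρ ρ⋠1 → ⊥-elim (ρ⋠1 (≼1ₙ ρ))))))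
    where
    A = inner b i j
    T = outer i j
    above : ∀ ρ → ρ ∈ˡ segment π 1ₙ → ρ [ i ∼ j ]
    above ρ ρ∈ = ≼⇒∼ π ρ (proj₁ (∈-segment⁻ π ρ 1ₙ ρ∈)) i∼j

  ⊛-chordLaw : ∀ (k l : Kernel) → Triangular k → Splits k → ∀ b → ChordLaw b k → ChordLaw b l → ChordLaw b (k ⊛ l)
  ⊛-chordLaw k l tk sk b lk ll π i<j i∼j =
    act-chord k tk sk b lk π i<j i∼j (λ ρ → l ρ 1ₙ) (λ ρ → l ρ 1ₙ) (λ ρ → l ρ 1ₙ) (λ ρ → ll ρ i<j)

  Sum-neg : ∀ {A : Set} (xs : List A) (f : A → Carrier) → Sum xs (λ x → - f x) ≈ - Sum xs f
  Sum-neg []       f = sym -0#≈0#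
  Sum-neg (x ∷ xs) f = trans (+-congˡ (Sum-neg xs f)) (-‿+-comm _ _)

  act-single : ∀ (k : Kernel) → Triangular k → Unital k → ∀ {n} (x : NC n → Carrier) π →
               (∀ ρ → π ≼ ρ → ρ ≢ π → x ρ ≈ 0#) → act k x π ≈ x π
  act-single k tri unit {n} x π zero-above = trans
    (Sum-single (elements-! n) (λ ρ → k π ρ * x ρ) (∈-elements π) λ {ρ} → term ρ)
    (trans (*-congʳ (unit π)) (*-identityˡ _))
    where
    term : ∀ ρ → ρ ≢ π → k π ρ * x ρ ≈ 0#
    term ρ ρ≢π with π ≼? ρ
    ... | no π⋠ρ  = trans (*-congʳ (tri π ρ π⋠ρ)) (zeroˡ _)
    ... | yes π≼ρ = trans (*-congˡ (zero-above ρ π≼ρ ρ≢π)) (zeroʳ _)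

  -- Where `x` and `y` agree strictly above `π`, only the diagonal term of the action on x - y is
  -- left, and `k` is 1 there. The up-set `D` allows hypotheses that hold only for partitions
  -- containing a given chord.
  act-cancel : ∀ (k : Kernel) → Triangular k → Unital k → ∀ {n} {D : NC n → Set} → (∀ π ρ → π ≼ ρ → D π → D ρ) →
               (x y : NC n → Carrier) → (∀ π → D π → act k x π ≈ act k y π) → ∀ π → D π → x π ≈ y π
  act-cancel k tri unit {n} {D} up x y eq = ≼-upward (λ π → D π → x π ≈ y π) λ π ih Dπ →
    x∙y⁻¹≈ε⇒x≈y (x π) (y π) (trans
      (sym (act-single k tri unit (λ ρ → x ρ - y ρ) π λ ρ π≼ρ ρ≢π →
        trans (+-congʳ (ih ρ π≼ρ ρ≢π (up π ρ π≼ρ Dπ))) (-‿inverseʳ _)))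
      (trans (difference π) (trans (+-congʳ (eq π Dπ)) (-‿inverseʳ _))))
    where
    difference : ∀ π → act k (λ ρ → x ρ - y ρ) π ≈ act k x π - act k y π
    difference π = trans
      (Sum-cong (elements n) λ {ρ} _ → x[y-z]≈xy-xz (k π ρ) (x ρ) (y ρ))
      (trans (Sum-+ (elements n) _ _) (+-congˡ (Sum-neg (elements n) _)))

  -- The product formula

  blockProd : (∀ {n} → NC n → Carrier) → Kernel
  blockProd φ π σ = Prod (blocks σ) λ W → φ (π ↾ W)

  blockProd-splits : (φ : ∀ {n} → NC n → Carrier) → Splits (blockProd φ)
  blockProd-splits φ A B π σ π≼σ cov sep = trans (Prod-↭ (blocks-split {A = A} {B} σ cov sep) _)
    (trans (Prod-++ (List.map (image A) (blocks (σ ↾ A))) _ _) (*-cong (part A) (part B)))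
    where
    part : ∀ A → Prod (List.map (image A) (blocks (σ ↾ A))) (λ W → φ (π ↾ W)) ≈ blockProd φ (π ↾ A) (σ ↾ A)
    part A = trans (reflexive (Prod-map (image A) (blocks (σ ↾ A)) _))
      (Prod-cong (blocks (σ ↾ A)) λ {V} _ → reflexive (≡.sym
        (↾-↾ A V (image A V) (∈-image⁻ A V) (element-∈-image A V) (λ τ _ → φ τ) π π)))

  blockProd-1ₙ : (φ : ∀ {n} → NC n → Carrier) → ∀ {n} → Fin n → (π : NC n) → blockProd φ π 1ₙ ≈ φ π
  blockProd-1ₙ φ {suc n} _ π = trans
    (reflexive (cong (λ Ws → Prod Ws (λ W → φ (π ↾ W))) (blocks-1ₙ {n})))
    (trans (*-identityʳ _) (reflexive (↾-all ⊤ (λ _ → ∈⊤) (λ τ _ → φ τ) π π)))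

  -- Recovers the product over all blocks, which defines `𝒢̃`, from splitting into two parts: both
  -- sides split off the block of the first point.
  product-formula : ∀ (k : Kernel) → Splits k → Unital k → ∀ {n} (π σ : NC n) → π ≼ σ →
                    k π σ ≈ blockProd (λ τ → k τ 1ₙ) π σ
  product-formula k splits unit {n} π σ π≼σ = go n (<-wellFounded n) π σ π≼σ
    where
    go : ∀ n → Acc ℕ._<_ n → (π σ : NC n) → π ≼ σ → k π σ ≈ blockProd (λ τ → k τ 1ₙ) π σ
    go zero    _        π σ@(mkNC Vec.[] _) _ = trans (reflexive (cong (λ τ → k τ σ) (NC0-unique π σ))) (unit σ)
    go (suc n) (acc rs) π σ π≼σ = trans
      (split-block k splits π σ π≼σ zero)
      (trans (*-cong
          (sym (blockProd-1ₙ (λ τ → k τ 1ₙ) (rank W (∼-refl σ zero)) (π ↾ W)))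
          (go ∣ ∁ W ∣ (rs (∣∁∣< W (∼-refl σ zero))) (π ↾ ∁ W) (σ ↾ ∁ W) (↾-mono π σ π≼σ (∁ W))))
        (sym (split-block (blockProd λ τ → k τ 1ₙ) (blockProd-splits λ τ → k τ 1ₙ) π σ π≼σ zero)))
      where W = block σ zero

-- From functions on pairs to kernels and back

module Totals {c ℓ} (R : CommutativeRing c ℓ) where

  open CommutativeRing R hiding (zero)
  open Kernels R
  open Convolution R

  -- g as a kernel: 0 off the order relation, and 1 on the empty ground set so that empty parts do not matter
  tot : (NC² → Carrier) → Kernel
  tot g {zero}  π σ = 1#
  tot g {suc n} π σ with π ≼? σ
  ... | yes p = g (⟨ π , σ ⟩by p)
  ... | no _  = 0#

  tot-≼ : ∀ g {n} (π σ : NC (suc n)) (p : π ≼ σ) → tot g π σ ≡ g (⟨ π , σ ⟩by p)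
  tot-≼ g π σ p with π ≼? σ
  ... | yes _ = ≡.refl
  ... | no ¬p = ⊥-elim (¬p p)

  tot-1ₙ : ∀ g {n} → .{{_ : ℕ.NonZero n}} (π : NC n) → tot g π 1ₙ ≡ g ⟨ π ,1⟩
  tot-1ₙ g {suc n} π = tot-≼ g π 1ₙ (≼1ₙ π)

  tot-0ₙ : ∀ g {n} → .{{_ : ℕ.NonZero n}} (π : NC n) → tot g 0ₙ π ≡ g ⟨0, π ⟩
  tot-0ₙ g {suc n} π = tot-≼ g 0ₙ π (0ₙ≼ π)

  tot-triangular : ∀ g → Triangular (tot g)
  tot-triangular g {zero}  π σ π⋠σ = ⊥-elim (π⋠σ λ ())
  tot-triangular g {suc n} π σ π⋠σ with π ≼? σ
  ... | yes p = ⊥-elim (π⋠σ p)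
  ... | no _  = refl

  tot-cong : ∀ {f g} → f ≐ g → ∀ {n} (π σ : NC n) → tot f π σ ≈ tot g π σ
  tot-cong f≐g {zero}  π σ = refl
  tot-cong f≐g {suc n} π σ with π ≼? σ
  ... | yes p = f≐g (⟨ π , σ ⟩by p)
  ... | no _  = refl

  ∑≈Sum : ∀ {A : Set} (xs : List A) (f : ∀ {x} → x ∈ˡ xs → Carrier) (f′ : A → Carrier) →
          (∀ {x} (x∈ : x ∈ˡ xs) → f x∈ ≈ f′ x) → ∑ xs f ≈ Sum xs f′
  ∑≈Sum []       f f′ eq = refl
  ∑≈Sum (x ∷ xs) f f′ eq = +-cong (eq (here ≡.refl)) (∑≈Sum xs (f ∘ there) f′ (eq ∘ there))

  ∏≈Prod : ∀ {A : Set} (xs : List A) (f : ∀ {x} → x ∈ˡ xs → Carrier) (f′ : A → Carrier) →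
           (∀ {x} (x∈ : x ∈ˡ xs) → f x∈ ≈ f′ x) → ∏ xs f ≈ Prod xs f′
  ∏≈Prod []       f f′ eq = refl
  ∏≈Prod (x ∷ xs) f f′ eq = *-cong (eq (here ≡.refl)) (∏≈Prod xs (f ∘ there) f′ (eq ∘ there))

  tot-⊛ : ∀ f g {n} (π σ : NC n) → tot (f ⋆ g) π σ ≈ (tot f ⊛ tot g) π σ
  tot-⊛ f g {zero} π σ = sym (trans
    (Sum-single (elements-! 0) _ (∈-elements π) (λ ρ≢π → ⊥-elim (ρ≢π (NC0-unique _ _))))
    (*-identityˡ 1#))
  tot-⊛ f g {suc n} π σ with π ≼? σ
  ... | no π⋠σ = sym (⊛-triangular (tot f) (tot g) (tot-triangular f) (tot-triangular g) π σ π⋠σ)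
  ... | yes _  = trans
    (∑≈Sum (interval π σ) _ (λ ρ → tot f π ρ * tot g ρ σ) λ {ρ} ρ∈ →
      let p , q = ∈-interval π σ ρ∈ in
      reflexive (cong₂ _*_ (≡.sym (tot-≼ f π ρ p)) (≡.sym (tot-≼ g ρ σ q))))
    (trans (reflexive (cong (λ ρs → Sum ρs (λ ρ → tot f π ρ * tot g ρ σ)) (interval≡ π σ)))
      (sym (act-interval (tot f) (tot-triangular f) (λ ρ → tot g ρ σ) π σ (λ ρ → tot-triangular g ρ σ))))

  tot-δ-unital : Unital (tot δ)
  tot-δ-unital {zero}  π = refl
  tot-δ-unital {suc n} π with π ≼? π
  ... | no ¬p = ⊥-elim (¬p (≼-refl π))
  ... | yes _ with blockVec π ≟ᵛ blockVec π
  ...   | yes _ = refl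
  ...   | no ¬eq = ⊥-elim (¬eq ≡.refl)

  tot-δ-≢ : ∀ {n} (π σ : NC n) → σ ≢ π → tot δ π σ ≈ 0#
  tot-δ-≢ {zero}  π σ σ≢π = ⊥-elim (σ≢π (NC0-unique σ π))
  tot-δ-≢ {suc n} π σ σ≢π with π ≼? σ
  ... | no _  = refl
  ... | yes _ with blockVec π ≟ᵛ blockVec σ
  ...   | yes eq = ⊥-elim (σ≢π (≡.sym (blockVec-injective eq)))
  ...   | no _   = refl

  act-inverse : ∀ f g → f ⋆ g ≐ δ → ∀ {n} (x : NC n → Carrier) π → act (tot f) (act (tot g) x) π ≈ x π
  act-inverse f g f⋆g≐δ {n} x π = trans (sym (⊛-assoc (tot f) (tot g) x π)) (trans
    (Sum-cong (elements n) λ {ρ} _ → *-congʳ (trans (sym (tot-⊛ f g π ρ)) (tot-cong f⋆g≐δ π ρ)))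
    (trans (Sum-single (elements-! n) (λ ρ → tot δ π ρ * x ρ) (∈-elements π)
             (λ {ρ} ρ≢π → trans (*-congʳ (tot-δ-≢ π ρ ρ≢π)) (zeroˡ _)))
           (trans (*-congʳ (tot-δ-unital π)) (*-identityˡ _))))

  ∏≈blockProd : ∀ g {n} (π σ : NC n) →
    ∏ (blocks σ) (λ {W} W∈σ → atBlock g π W (∈-blocks⇒nonempty σ W∈σ)) ≈ blockProd (λ τ → tot g τ 1ₙ) π σ
  ∏≈blockProd g π σ = ∏≈Prod (blocks σ) _ _ λ {W} W∈σ →
    reflexive (≡.sym (tot-1ₙ g {{nonempty⇒nonZero W (∈-blocks⇒nonempty σ W∈σ)}} (π ↾ W)))

  module _ {g} (g∈ : 𝒢̃ g) where

    tot-unital : Unital (tot g)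
    tot-unital {zero}  π = refl
    tot-unital {suc n} π = trans (reflexive (tot-≼ g π π (≼-refl π))) (𝒢̃.unital g∈ π)

    tot-product : ∀ {n} (π σ : NC n) → π ≼ σ → tot g π σ ≈ blockProd (λ τ → tot g τ 1ₙ) π σ
    tot-product {zero}  π (mkNC Vec.[] _) _ = refl
    tot-product {suc n} π σ p =
      trans (reflexive (tot-≼ g π σ p)) (trans (𝒢̃.multiplicative g∈ π σ p) (∏≈blockProd g π σ))

    tot-splits : Splits (tot g)
    tot-splits A B π σ π≼σ cov sep = trans (tot-product π σ π≼σ)
      (trans (blockProd-splits (λ τ → tot g τ 1ₙ) A B π σ π≼σ cov sep)
        (sym (*-cong (tot-product (π ↾ A) (σ ↾ A) (↾-mono π σ π≼σ A))
                     (tot-product (π ↾ B) (σ ↾ B) (↾-mono π σ π≼σ B)))))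

  splits⇒𝒢̃ : ∀ g → Unital (tot g) → Splits (tot g) → 𝒢̃ g
  splits⇒𝒢̃ g unit splits = record { unital = unital ; multiplicative = multiplicative }
    where
    unital : ∀ {n} → .{{_ : ℕ.NonZero n}} (π : NC n) → g (⟨ π , π ⟩by ≼-refl π) ≈ 1#
    unital {suc n} π = trans (reflexive (≡.sym (tot-≼ g π π (≼-refl π)))) (unit π)
    multiplicative : ∀ {n} → .{{_ : ℕ.NonZero n}} (π σ : NC n) .(π≼σ : π ≼ σ) → g (⟨ π , σ ⟩by π≼σ) ≈
      ∏ (blocks σ) (λ {W} W∈σ → atBlock g π W (∈-blocks⇒nonempty σ W∈σ))
    multiplicative {suc n} π σ π≼σ = trans
      (reflexive (≡.sym (tot-≼ g π σ (recompute (π ≼? σ) π≼σ))))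
      (trans (product-formula (tot g) splits unit π σ (recompute (π ≼? σ) π≼σ)) (sym (∏≈blockProd g π σ)))

-- Kreweras complement

side : ∀ {n} → Fin n → Fin n → Bool
side x a with toℕ x ℕ.≤? toℕ a
... | yes _ = true
... | no _  = false

-- Membership in the half-open interval (min a b , max a b]
halfOpen : ∀ {n} → Fin n → Fin n → Fin n → Bool
halfOpen a b x = side x a xor side x b

module _ {n} {a b x : Fin n} (a≤b : a Fin.≤ b) where

  halfOpen⁺ : a Fin.< x → x Fin.≤ b → halfOpen a b x ≡ true
  halfOpen⁺ a<x x≤b with toℕ x ℕ.≤? toℕ a | toℕ x ℕ.≤? toℕ b
  ... | yes x≤a | _      = ⊥-elim (ℕ.<⇒≱ a<x x≤a)
  ... | no _    | yes _  = ≡.refl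
  ... | no _    | no x≰b = ⊥-elim (x≰b x≤b)

  halfOpen⁻ : halfOpen a b x ≡ true → a Fin.< x × x Fin.≤ b
  halfOpen⁻ eq with toℕ x ℕ.≤? toℕ a | toℕ x ℕ.≤? toℕ b
  halfOpen⁻ _  | no x≰a  | yes x≤b = ℕ.≰⇒> x≰a , x≤b
  halfOpen⁻ () | no _    | no _
  halfOpen⁻ () | yes _   | yes _
  halfOpen⁻ _  | yes x≤a | no x≰b  = ⊥-elim (x≰b (ℕ.≤-trans x≤a a≤b))

-- In the order 1 < 1′ < 2 < 2′ < ⋯ the unprimed points between a′ and b′ are those of (a,b].
-- Saturation thus says that joining a′ to b′ crosses no block of `π`.
Saturated : ∀ {n} → NC n → Fin n → Fin n → Set
Saturated π a b = ∀ {x y} → π [ x ∼ y ] → a Fin.< x → x Fin.≤ b → a Fin.< y × y Fin.≤ b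

private
  xor-telescope : ∀ p q r → (p xor q) xor (q xor r) ≡ p xor r
  xor-telescope false q     r = refl′ q r
    where
    refl′ : ∀ q r → q xor (q xor r) ≡ r
    refl′ false r     = ≡.refl
    refl′ true  false = ≡.refl
    refl′ true  true  = ≡.refl
  xor-telescope true  false r = ≡.refl
  xor-telescope true  true  false = ≡.refl
  xor-telescope true  true  true  = ≡.refl

  -- The set identity "(a,b] is (a,c] without (b,d]" for a < b < c < d; the three implications
  -- express that the initial segments cut off by a, b, c, d are nested.
  xor-nested : ∀ p q r s → (p ≡ true → q ≡ true) → (q ≡ true → r ≡ true) → (r ≡ true → s ≡ true) →
               p xor q ≡ (p xor r) ∧ not (q xor s)
  xor-nested false false false s     pq qr rs = ≡.refl
  xor-nested false false true  true  pq qr rs = ≡.refl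
  xor-nested false false true  false pq qr rs with () ← rs ≡.refl
  xor-nested false true  false s     pq qr rs with () ← qr ≡.refl
  xor-nested false true  true  true  pq qr rs = ≡.refl
  xor-nested false true  true  false pq qr rs with () ← rs ≡.refl
  xor-nested true  false r     s     pq qr rs with () ← pq ≡.refl
  xor-nested true  true  false s     pq qr rs with () ← qr ≡.refl
  xor-nested true  true  true  s     pq qr rs = ≡.refl

  side-mono : ∀ {n} {a b} (x : Fin n) → a Fin.< b → side x a ≡ true → side x b ≡ true
  side-mono {a = a} {b} x a<b eq with toℕ x ℕ.≤? toℕ a | toℕ x ℕ.≤? toℕ b
  side-mono x a<b _  | yes x≤a | yes _  = ≡.refl
  side-mono x a<b _  | yes x≤a | no x≰b = ⊥-elim (x≰b (ℕ.≤-trans x≤a (ℕ.<⇒≤ a<b)))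
  side-mono x a<b () | no _    | _

module Kreweras {n} (π : NC n) where

  private
    -- The indicator of the interval between `a` and `b` is constant on blocks of `π`. Since it is a
    -- sum modulo 2, symmetry needs no case distinction on the order and transitivity is
    -- telescoping.
    _~_ : Fin n → Fin n → Set
    a ~ b = ∀ x y → π [ x ∼ y ] → halfOpen a b x ≡ halfOpen a b y

    _~?_ : ∀ a b → Dec (a ~ b)
    a ~? b = Fin.all? λ x → Fin.all? λ y → ∼? π x y →-dec (halfOpen a b x Bool.≟ halfOpen a b y)

    rf : ∀ {a} → a ~ a
    rf {a} x y _ = ≡.trans (Bool.xor-same (side x a)) (≡.sym (Bool.xor-same (side y a)))

    sm : ∀ {a b} → a ~ b → b ~ a
    sm {a} {b} r x y x∼y = ≡.trans (Bool.xor-comm (side x b) (side x a))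
      (≡.trans (r x y x∼y) (Bool.xor-comm (side y a) (side y b)))

    tr : ∀ {a b c} → a ~ b → b ~ c → a ~ c
    tr {a} {b} {c} r s x y x∼y = ≡.trans (≡.sym (xor-telescope (side x a) (side x b) (side x c)))
      (≡.trans (cong₂ _xor_ (r x y x∼y) (s x y x∼y)) (xor-telescope (side y a) (side y b) (side y c)))

    nc : NonCrossing Fin._<_ _~_
    nc a b c d a<b b<c c<d r s x y x∼y = ≡.trans (nested x)
      (≡.trans (cong₂ (λ p q → p ∧ not q) (r x y x∼y) (s x y x∼y)) (≡.sym (nested y)))
      where
      nested : ∀ x → halfOpen a b x ≡ halfOpen a c x ∧ not (halfOpen b d x)
      nested x = xor-nested (side x a) (side x b) (side x c) (side x d)
        (side-mono x a<b) (side-mono x b<c) (side-mono x c<d)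

    ~-isEquivalence : IsEquivalence _~_
    ~-isEquivalence = record { refl = λ {a} → rf {a} ; sym = sm ; trans = λ {a} {b} {c} → tr {a} {b} {c} }

    open FromRelation _~?_ ~-isEquivalence nc

  abstract
    complement : NC n
    complement = partition

    complement⁺ : ∀ {a b} → a Fin.≤ b → Saturated π a b → complement [ a ∼ b ]
    complement⁺ {a} {b} a≤b sat = ∼⁺ λ x y x∼y → same x∼y
      where
      same : ∀ {x y} → π [ x ∼ y ] → halfOpen a b x ≡ halfOpen a b y
      same {x} {y} x∼y with halfOpen a b x in eqx | halfOpen a b y in eqy
      ... | true  | true  = ≡.refl
      ... | false | false = ≡.refl
      ... | true  | false = let a<x , x≤b = halfOpen⁻ a≤b eqx ; a<y , y≤b = sat x∼y a<x x≤b
                            in ≡.trans (≡.sym (halfOpen⁺ a≤b a<y y≤b)) eqy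
      ... | false | true  = let a<y , y≤b = halfOpen⁻ a≤b eqy ; a<x , x≤b = sat (∼-sym π x∼y) a<y y≤b
                            in ≡.trans (≡.sym eqx) (halfOpen⁺ a≤b a<x x≤b)

    complement⁻ : ∀ {a b} → a Fin.≤ b → complement [ a ∼ b ] → Saturated π a b
    complement⁻ {a} {b} a≤b a∼b {x} {y} x∼y a<x x≤b =
      halfOpen⁻ a≤b (≡.trans (≡.sym (∼⁻ a∼b x y x∼y)) (halfOpen⁺ a≤b a<x x≤b))

open Kreweras public using (complement; complement⁺; complement⁻)

∼-wlog : ∀ {n} (σ τ : NC n) → (∀ {a b} → a Fin.≤ b → σ [ a ∼ b ] → τ [ a ∼ b ]) →
         ∀ {a b} → σ [ a ∼ b ] → τ [ a ∼ b ]
∼-wlog σ τ f {a} {b} a∼b with ℕ.≤-total (toℕ a) (toℕ b)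
... | inj₁ a≤b = f a≤b a∼b
... | inj₂ b≤a = ∼-sym τ (f b≤a (∼-sym σ a∼b))

private
  even<odd⁻ : ∀ {a b} → 2 ℕ.* a ℕ.< 1 ℕ.+ 2 ℕ.* b → a ℕ.≤ b
  even<odd⁻ lt = ℕ.*-cancelˡ-≤ 2 (s≤s⁻¹ lt)

  odd<even⁻ : ∀ {a b} → 1 ℕ.+ 2 ℕ.* a ℕ.< 2 ℕ.* b → a ℕ.< b
  odd<even⁻ {a} {b} lt = ℕ.*-cancelˡ-< 2 a b (ℕ.<-trans (ℕ.n<1+n _) lt)

  even<odd⁺ : ∀ {a b} → a ℕ.≤ b → 2 ℕ.* a ℕ.< 1 ℕ.+ 2 ℕ.* b
  even<odd⁺ a≤b = s≤s (ℕ.*-monoʳ-≤ 2 a≤b)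

  odd<even⁺ : ∀ {a b} → a ℕ.< b → 1 ℕ.+ 2 ℕ.* a ℕ.< 2 ℕ.* b
  odd<even⁺ {a} {b} a<b = subst (ℕ._≤ 2 ℕ.* b) (ℕ.*-suc 2 a) (ℕ.*-monoʳ-≤ 2 a<b)

complement-isKreweras : ∀ {n} (π : NC n) → complement π IsKrewerasComplementOf π
complement-isKreweras π = record { compatible = compatible ; largest = largest }
  where
  κ = complement π
  compatible : Compatible π κ
  compatible (inj₁ a) (inj₁ b) (inj₁ c) (inj₁ d) a<b b<c c<d (inj₁ a∼c) (inj₁ b∼d) = inj₁
    (noncrossing π a b c d (ℕ.*-cancelˡ-< 2 _ _ a<b) (ℕ.*-cancelˡ-< 2 _ _ b<c) (ℕ.*-cancelˡ-< 2 _ _ c<d) a∼c b∼d)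
  compatible (inj₂ a) (inj₂ b) (inj₂ c) (inj₂ d) a<b b<c c<d (inj₂ a∼c) (inj₂ b∼d) = inj₂
    (noncrossing κ a b c d (ℕ.*-cancelˡ-< 2 _ _ (s<s⁻¹ a<b)) (ℕ.*-cancelˡ-< 2 _ _ (s<s⁻¹ b<c))
      (ℕ.*-cancelˡ-< 2 _ _ (s<s⁻¹ c<d)) a∼c b∼d)
  compatible (inj₁ a) (inj₂ b) (inj₁ c) (inj₂ d) a<b b<c c<d (inj₁ a∼c) (inj₂ b∼d) = ⊥-elim
    (ℕ.<⇒≱ (proj₁ (complement⁻ π (ℕ.<⇒≤ (ℕ.<-≤-trans (odd<even⁻ {toℕ b} {toℕ c} b<c) (even<odd⁻ c<d))) b∼d
      (∼-sym π a∼c) (odd<even⁻ {toℕ b} {toℕ c} b<c) (even<odd⁻ c<d))) (even<odd⁻ a<b))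
  compatible (inj₂ a) (inj₁ b) (inj₂ c) (inj₁ d) a<b b<c c<d (inj₂ a∼c) (inj₁ b∼d) = ⊥-elim
    (ℕ.<⇒≱ (odd<even⁻ {toℕ c} {toℕ d} c<d)
      (proj₂ (complement⁻ π (ℕ.<⇒≤ (ℕ.<-≤-trans (odd<even⁻ {toℕ a} {toℕ b} a<b) (even<odd⁻ b<c))) a∼c
        b∼d (odd<even⁻ {toℕ a} {toℕ b} a<b) (even<odd⁻ b<c))))

  largest : ∀ σ → Compatible π σ → σ ≼ κ
  largest σ comp = ∼⇒≼ σ κ (∼-wlog σ κ λ {a} {b} a≤b a∼b → complement⁺ π a≤b (sat a b a∼b))
    where
    sat : ∀ a b → σ [ a ∼ b ] → Saturated π a b
    sat a b a∼b {x} {y} x∼y a<x x≤b with ℕ.<-≤-connex (toℕ a) (toℕ y) | ℕ.<-≤-connex (toℕ b) (toℕ y)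
    ... | inj₁ a<y | inj₂ y≤b = a<y , y≤b
    -- A block of `π` leaving (a,b] crosses the chord from a′ to b′, and compatibility would join an
    -- unprimed point to a primed one.
    ... | inj₂ y≤a | _ with () ← comp (inj₁ y) (inj₂ a) (inj₁ x) (inj₂ b)
                              (even<odd⁺ y≤a) (odd<even⁺ a<x) (even<odd⁺ x≤b) (inj₁ (∼-sym π x∼y)) (inj₂ a∼b)
    sat a b a∼b {x} {y} x∼y a<x x≤b | _ | inj₁ b<y
      with () ← comp (inj₂ a) (inj₁ x) (inj₂ b) (inj₁ y)
                  (odd<even⁺ a<x) (even<odd⁺ x≤b) (odd<even⁺ b<y) (inj₂ a∼b) (inj₁ x∼y)

kreweras-unique : ∀ {n} (κ π : NC n) → κ IsKrewerasComplementOf π → κ ≡ complement π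
kreweras-unique κ π isK = ≼-antisym κ (complement π)
  (Kr.largest (complement-isKreweras π) κ (Kr.compatible isK))
  (Kr.largest isK (complement π) (Kr.compatible (complement-isKreweras π)))
  where module Kr = _IsKrewerasComplementOf_

complement-0ₙ : ∀ {n} → complement (0ₙ {n}) ≡ 1ₙ
complement-0ₙ {n} = ≡1ₙ λ a b → ∼-wlog 1ₙ (complement 0ₙ) (λ {a} {b} a≤b _ → complement⁺ 0ₙ {a} {b} a≤b
  λ {x} {y} x∼y a<x x≤b → subst (λ z → a Fin.< z × z Fin.≤ b) (0ₙ-∼ x∼y) (a<x , x≤b)) {a} {b} (1ₙ-∼ a b)

-- Complements and chords

element-<⁻ : ∀ {n} (W : Subset n) {a b} → element W a Fin.< element W b → a Fin.< b
element-<⁻ W = increasing⇒reflects-< (element-mono-< W)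

element-≤⁺ : ∀ {n} (W : Subset n) {a b} → a Fin.≤ b → element W a Fin.≤ element W b
element-≤⁺ W a≤b = ℕ.≮⇒≥ λ lt → ℕ.<⇒≱ (element-<⁻ W lt) a≤b

element-≤⁻ : ∀ {n} (W : Subset n) {a b} → element W a Fin.≤ element W b → a Fin.≤ b
element-≤⁻ W a≤b = ℕ.≮⇒≥ λ lt → ℕ.<⇒≱ (element-mono-< W lt) a≤b

saturated-↾⁺ : ∀ {n} (π : NC n) W {a b} → Saturated π (element W a) (element W b) → Saturated (π ↾ W) a b
saturated-↾⁺ π W sat x∼y a<x x≤b =
  let a<y , y≤b = sat (↾-∼⁻ π W x∼y) (element-mono-< W a<x) (element-≤⁺ W x≤b)
  in element-<⁻ W a<y , element-≤⁻ W y≤b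

saturated-↾⁻ : ∀ {n} (π : NC n) W {a b} → Saturated (π ↾ W) a b → ∀ {x y} → x ∈ W → y ∈ W → π [ x ∼ y ] →
               element W a Fin.< x → x Fin.≤ element W b → element W a Fin.< y × y Fin.≤ element W b
saturated-↾⁻ π W {a} {b} sat {x} {y} p q x∼y a<x x≤b =
  let a<y , y≤b = sat (↾-rank⁺ π W p q x∼y)
        (element-<⁻ W (subst (element W a Fin.<_) (≡.sym (element-rank W p)) a<x))
        (element-≤⁻ W (subst (Fin._≤ element W b) (≡.sym (element-rank W p)) x≤b))
  in subst (element W a Fin.<_) (element-rank W q) (element-mono-< W a<y) ,
     subst (Fin._≤ element W b) (element-rank W q) (element-≤⁺ W y≤b)

-- Saturation always passes to a restriction, which gives one inclusion; the lifting of saturated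
-- intervals gives the other.
complement-↾ : ∀ {n} (π : NC n) W →
               (∀ {a b} → a Fin.≤ b → Saturated (π ↾ W) a b → Saturated π (element W a) (element W b)) →
               complement π ↾ W ≡ complement (π ↾ W)
complement-↾ π W lift = NC-ext
  (λ _ _ → ∼-wlog (complement π ↾ W) (complement (π ↾ W)) λ a≤b a∼b → complement⁺ (π ↾ W) a≤b
    (saturated-↾⁺ π W (complement⁻ π (element-≤⁺ W a≤b) (↾-∼⁻ (complement π) W a∼b))))
  (λ _ _ → ∼-wlog (complement (π ↾ W)) (complement π ↾ W) λ a≤b a∼b → ↾-∼⁺ (complement π) W
    (complement⁺ π (element-≤⁺ W a≤b) (lift a≤b (complement⁻ (π ↾ W) a≤b a∼b))))

module _ {n} (π : NC n) {i j : Fin n} (i<j : i Fin.< j) (i∼j : π [ i ∼ j ]) where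

  private
    A T : Subset n
    A = inner false i j
    T = outer i j

    ct = cut false π i<j i∼j

    A⁻ : ∀ {x} → x ∈ A → i Fin.≤ x × x Fin.< j
    A⁻ = ∈⟪⟫⁻ (inner? false i j)

    T⁻ : ∀ {x} → x ∈ T → x Fin.< i ⊎ j Fin.≤ x
    T⁻ = ∈⟪⟫⁻ (outer? i j)

    i∈A : i ∈ A
    i∈A = inner⁺ false i j ℕ.≤-refl i<j

    j∈T : j ∈ T
    j∈T = ∈⟪⟫⁺ (outer? i j) (inj₂ ℕ.≤-refl)

  -- The half-open interval between a point of [i,j) and a point of the outer side contains exactly
  -- one of `i` and `j`, so it is not saturated.
  complement-separates : Separates A T (complement π)
  complement-separates {x} {y} p q x∼y with i≤x , x<j ← A⁻ p with T⁻ q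
  ... | inj₁ y<i = ℕ.<⇒≱ x<j (proj₂ (complement⁻ π (ℕ.<⇒≤ (ℕ.<-≤-trans y<i i≤x))
                     (∼-sym (complement π) x∼y) i∼j y<i i≤x))
  ... | inj₂ j≤y = ℕ.<⇒≱ (proj₁ (complement⁻ π (ℕ.<⇒≤ (ℕ.<-≤-trans x<j j≤y)) x∼y (∼-sym π i∼j) x<j j≤y)) i≤x

  complement-inner : complement π ↾ A ≡ complement (π ↾ A)
  complement-inner = complement-↾ π A λ {a} {b} _ sat {x} {y} → lift sat {x} {y}
    where
    lift : ∀ {a b} → Saturated (π ↾ A) a b → Saturated π (element A a) (element A b)
    lift {a} {b} sat {x} {y} x∼y a<x x≤b = go (cover ct y)
      where
      i≤a = proj₁ (A⁻ (element-∈ A a))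
      x∈A : x ∈ A
      x∈A = inner⁺ false i j (ℕ.≤-trans i≤a (ℕ.<⇒≤ a<x)) (ℕ.≤-<-trans x≤b (proj₂ (A⁻ (element-∈ A b))))
      go : y ∈ A ⊎ y ∈ T → element A a Fin.< y × y Fin.≤ element A b
      go (inj₁ y∈A) = saturated-↾⁻ π A sat x∈A y∈A x∼y a<x x≤b
      -- A block leaving `A` contains `i`, which is not in (a,b] because i ≤ a.
      go (inj₂ y∈T) = ⊥-elim (ℕ.<⇒≱
        (proj₁ (saturated-↾⁻ π A sat x∈A i∈A (∼-sym π (apart ct x∈A y∈T x∼y)) a<x x≤b)) i≤a)

  complement-outer : complement π ↾ T ≡ complement (π ↾ T)
  complement-outer = complement-↾ π T λ {a} {b} _ sat {x} {y} → lift sat {x} {y}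
    where
    lift : ∀ {a b} → Saturated (π ↾ T) a b → Saturated π (element T a) (element T b)
    lift {a} {b} sat {x} {y} x∼y a<x x≤b = go (cover ct x) (cover ct y)
      where
      -- With both ends in `T`, the interval (a,b] contains `j` as soon as it meets `A`, and then it
      -- contains all of `A`. Hence `j` can stand in for points of `A`.
      spans : element T a Fin.< j → j Fin.≤ element T b → ∀ {z} → z ∈ A → element T a Fin.< z × z Fin.≤ element T b
      spans a<j j≤b z∈A with i≤z , z<j ← A⁻ z∈A with T⁻ (element-∈ T a)
      ... | inj₁ a<i = ℕ.<-≤-trans a<i i≤z , ℕ.<⇒≤ (ℕ.<-≤-trans z<j j≤b)
      ... | inj₂ j≤a = ⊥-elim (ℕ.<⇒≱ a<j j≤a)

      spans′ : x ∈ A → element T a Fin.< j × j Fin.≤ element T b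
      spans′ x∈A with i≤x , x<j ← A⁻ x∈A with T⁻ (element-∈ T b)
      ... | inj₁ b<i = ⊥-elim (ℕ.<⇒≱ b<i (ℕ.≤-trans i≤x x≤b))
      ... | inj₂ j≤b = ℕ.<-trans a<x x<j , j≤b

      go : x ∈ A ⊎ x ∈ T → y ∈ A ⊎ y ∈ T → element T a Fin.< y × y Fin.≤ element T b
      go (inj₂ x∈T) (inj₂ y∈T) = saturated-↾⁻ π T sat x∈T y∈T x∼y a<x x≤b
      go (inj₂ x∈T) (inj₁ y∈A) =
        let x∼j = ∼-trans π x∼y (∼-trans π (∼-sym π (apart ct y∈A x∈T (∼-sym π x∼y))) i∼j)
            a<j , j≤b = saturated-↾⁻ π T sat x∈T j∈T x∼j a<x x≤b
        in spans a<j j≤b y∈A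
      go (inj₁ x∈A) (inj₁ y∈A) = let a<j , j≤b = spans′ x∈A in spans a<j j≤b y∈A
      go (inj₁ x∈A) (inj₂ y∈T) =
        let a<j , j≤b = spans′ x∈A
            j∼y = ∼-trans π (∼-sym π i∼j) (∼-trans π (apart ct x∈A y∈T x∼y) x∼y)
        in saturated-↾⁻ π T sat j∈T y∈T j∼y a<j j≤b

-- Induction along chords

∉⇒∣∣< : ∀ {n} (W : Subset n) {x} → x ∉ W → ∣ W ∣ ℕ.< n
∉⇒∣∣< {n} W {x} x∉W = subst (∣ W ∣ ℕ.<_) (∣⊤∣≡n n) (p⊂q⇒∣p∣<∣q∣ ((λ _ → ∈⊤) , x , ∈⊤ , x∉W))

inner-< : ∀ {n} {i j : Fin n} → i Fin.< j → ∣ inner false i j ∣ ℕ.< n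
inner-< {i = i} {j} i<j = ∉⇒∣∣< (inner false i j) {j} λ j∈ → ℕ.<-irrefl ≡.refl (proj₂ (∈⟪⟫⁻ (inner? false i j) j∈))

outer-< : ∀ {n} {i j : Fin n} → i Fin.< j → ∣ outer i j ∣ ℕ.< n
outer-< {i = i} {j} i<j = ∉⇒∣∣< (outer i j) {i} λ i∈ → case (∈⟪⟫⁻ (outer? i j) i∈)
  where
  case : i Fin.< i ⊎ j Fin.≤ i → ⊥
  case (inj₁ i<i) = ℕ.<-irrefl ≡.refl i<i
  case (inj₂ j≤i) = ℕ.<⇒≱ i<j j≤i

chord-or-0ₙ : ∀ {n} (π : NC n) → (Σ[ i ∈ Fin n ] Σ[ j ∈ Fin n ] i Fin.< j × π [ i ∼ j ]) ⊎ π ≡ 0ₙ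
chord-or-0ₙ π with Fin.any? (λ i → Fin.any? (λ j → (i Fin.<? j) ×-dec ∼? π i j))
... | yes chord = inj₁ chord
... | no ¬chord = inj₂ (≡0ₙ only)
  where
  only : ∀ {x y} → π [ x ∼ y ] → x ≡ y
  only {x} {y} x∼y with Fin.<-cmp x y
  ... | tri< x<y _ _ = ⊥-elim (¬chord (x , y , x<y , x∼y))
  ... | tri≈ _ x≡y _ = x≡y
  ... | tri> _ _ y<x = ⊥-elim (¬chord (y , x , y<x , ∼-sym π x∼y))

-- With the half-open side both parts are smaller for every chord, even for the one between the
-- first and the last point.
chord-induction : ∀ {p} (P : ∀ {n} → NC n → Set p) → (∀ {n} → P (0ₙ {n})) →
  (∀ {n} (π : NC n) {i j} → i Fin.< j → π [ i ∼ j ] → P (π ↾ inner false i j) → P (π ↾ outer i j) → P π) →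
  ∀ {n} (π : NC n) → P π
chord-induction P base step {n} π = go n (<-wellFounded n) π
  where
  go : ∀ n → Acc ℕ._<_ n → (π : NC n) → P π
  go n (acc rs) π with chord-or-0ₙ π
  ... | inj₁ (i , j , i<j , i∼j) = step π i<j i∼j
          (go ∣ inner false i j ∣ (rs (inner-< i<j)) (π ↾ inner false i j))
          (go ∣ outer i j ∣ (rs (outer-< i<j)) (π ↾ outer i j))
  ... | inj₂ π≡0 = subst P (≡.sym π≡0) base

#blocks-0ₙ : ∀ {n} → #blocks (0ₙ {n}) ≡ n
#blocks-0ₙ {n} = ≡.trans (↭-length (unique⇒↭ (blocks-! (0ₙ {n})) (Unique.tabulate⁺ singleton-injective) to from))
                       (List.length-tabulate ⁅_⁆)
  where
  singleton-injective : ∀ {x y : Fin n} → ⁅ x ⁆ ≡ ⁅ y ⁆ → x ≡ y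
  singleton-injective {x} {y} eq = x∈⁅y⁆⇒x≡y y (subst (x ∈_) eq (x∈⁅x⁆ x))
  row : ∀ x → block (0ₙ {n}) x ≡ ⁅ x ⁆
  row = lookup∘tabulate ⁅_⁆
  to : ∀ {W} → W ∈ˡ blocks 0ₙ → W ∈ˡ List.tabulate ⁅_⁆
  to W∈ with x , ≡.refl ← ∈-blocks⁻ 0ₙ W∈ = subst (_∈ˡ List.tabulate ⁅_⁆) (≡.sym (row x)) (∈-tabulate⁺ {f = ⁅_⁆} x)
  from : ∀ {W} → W ∈ˡ List.tabulate ⁅_⁆ → W ∈ˡ blocks 0ₙ
  from W∈ with x , ≡.refl ← ∈-tabulate⁻ {f = ⁅_⁆} W∈ = subst (_∈ˡ blocks 0ₙ) (row x) (∈-blocks⁺ 0ₙ x)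

-- Points are counted as blocks of `0ₙ`, which reduces this to `#blocks-split`.
chord-sizes : ∀ {n} {i j : Fin n} → i Fin.< j → ∣ inner false i j ∣ ℕ.+ ∣ outer i j ∣ ≡ n
chord-sizes {n} {i} {j} i<j = ≡.sym (≡.trans (≡.sym (#blocks-0ₙ {n}))
  (≡.trans (#blocks-split {A = A} {T} 0ₙ (cover (cut false 1ₙ i<j (1ₙ-∼ i j))) sep)
    (cong₂ ℕ._+_ (≡.trans (cong #blocks (0ₙ↾ A)) (#blocks-0ₙ {∣ A ∣})) (≡.trans (cong #blocks (0ₙ↾ T)) (#blocks-0ₙ {∣ T ∣})))))
  where
  A = inner false i j
  T = outer i j
  sep : Separates A T 0ₙ
  sep {x} p q x∼y with ≡.refl ← 0ₙ-∼ {x = x} x∼y with ∈⟪⟫⁻ (inner? false i j) p | ∈⟪⟫⁻ (outer? i j) q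
  ... | i≤x , _ | inj₁ x<i = ℕ.<⇒≱ x<i i≤x
  ... | _ , x<j | inj₂ j≤x = ℕ.<⇒≱ x<j j≤x

private
  add-counts : ∀ {p k p₁ p₂ k₁ k₂ a t n} → suc p ≡ p₁ ℕ.+ p₂ → k ≡ k₁ ℕ.+ k₂ →
               p₁ ℕ.+ k₁ ≡ suc a → p₂ ℕ.+ k₂ ≡ suc t → a ℕ.+ t ≡ n → p ℕ.+ k ≡ suc n
  add-counts {p} {k} {p₁} {p₂} {k₁} {k₂} {a} {t} {n} p≡ k≡ eq₁ eq₂ a+t≡n = ℕ.suc-injective (begin
    suc p ℕ.+ k                       ≡⟨ cong₂ ℕ._+_ p≡ k≡ ⟩
    (p₁ ℕ.+ p₂) ℕ.+ (k₁ ℕ.+ k₂)       ≡⟨ interchange p₁ p₂ k₁ k₂ ⟩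
    (p₁ ℕ.+ k₁) ℕ.+ (p₂ ℕ.+ k₂)       ≡⟨ cong₂ ℕ._+_ eq₁ eq₂ ⟩
    suc a ℕ.+ suc t                   ≡⟨ cong suc (ℕ.+-suc a t) ⟩
    suc (suc (a ℕ.+ t))               ≡⟨ cong (λ m → suc (suc m)) a+t≡n ⟩
    suc (suc n)                       ∎)
    where
    open ≡.≡-Reasoning
    open import Algebra.Properties.CommutativeSemigroup ℕ.+-commutativeSemigroup using (interchange)

-- Cutting along a chord doubles one block of `π` and no block of the complement, while the sizes of
-- the parts add up to n. The argument in `Fin n` ensures n > 0: at n = 0 both counts are 0.
#blocks-complement : ∀ {n} (π : NC n) → Fin n → #blocks π ℕ.+ #blocks (complement π) ≡ suc n
#blocks-complement = chord-induction (λ {n} π → Fin n → #blocks π ℕ.+ #blocks (complement π) ≡ suc n) base step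
  where
  base : ∀ {n} → Fin n → #blocks (0ₙ {n}) ℕ.+ #blocks (complement (0ₙ {n})) ≡ suc n
  base {n} x = ≡.trans (cong₂ ℕ._+_ (#blocks-0ₙ {n}) (≡.trans (cong #blocks (complement-0ₙ {n})) (#blocks-1ₙ x))) (ℕ.+-comm n 1)

  step : ∀ {n} (π : NC n) {i j : Fin n} → i Fin.< j → π [ i ∼ j ] →
         let A = inner false i j ; T = outer i j in
         (Fin ∣ A ∣ → #blocks (π ↾ A) ℕ.+ #blocks (complement (π ↾ A)) ≡ suc ∣ A ∣) →
         (Fin ∣ T ∣ → #blocks (π ↾ T) ℕ.+ #blocks (complement (π ↾ T)) ≡ suc ∣ T ∣) →
         Fin n → #blocks π ℕ.+ #blocks (complement π) ≡ suc n
  step {n} π {i} {j} i<j i∼j ihA ihT _ =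
    add-counts {#blocks π} {#blocks κ} {#blocks (π ↾ A)} {#blocks (π ↾ T)}
               {#blocks (complement (π ↾ A))} {#blocks (complement (π ↾ T))} {∣ A ∣} {∣ T ∣} {n}
      (#blocks-chord false π i<j i∼j)
      (≡.trans (#blocks-split {A = A} {T} κ (cover (cut false π i<j i∼j)) (complement-separates π i<j i∼j))
        (cong₂ ℕ._+_ (cong #blocks (complement-inner π i<j i∼j)) (cong #blocks (complement-outer π i<j i∼j))))
      (ihA (rank A (inner⁺ false i j ℕ.≤-refl i<j)))
      (ihT (rank T (∈⟪⟫⁺ (outer? i j) (inj₂ ℕ.≤-refl))))
      (chord-sizes i<j)
    where
    A = inner false i j
    T = outer i j
    κ = complement π

-- Injectivity of the complement

least : ∀ {n} {P : Fin n → Set} → U.Decidable P → (Σ[ x ∈ Fin n ] P x × (∀ {y} → P y → x Fin.≤ y)) ⊎ (∀ x → ¬ P x)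
least {zero}  P? = inj₂ λ ()
least {suc n} P? with P? zero
... | yes P0 = inj₁ (zero , P0 , λ _ → z≤n)
... | no ¬P0 with least (P? ∘ suc)
...   | inj₁ (x , Px , min) = inj₁ (suc x , Px , λ { {zero} P0 → ⊥-elim (¬P0 P0) ; {suc y} Py → s≤s (min Py) })
...   | inj₂ none           = inj₂ λ { zero → ¬P0 ; (suc x) → none x }

greatest : ∀ {n} {P : Fin n → Set} → U.Decidable P → (Σ[ x ∈ Fin n ] P x × (∀ {y} → P y → y Fin.≤ x)) ⊎ (∀ x → ¬ P x)
greatest {zero}  P? = inj₂ λ ()
greatest {suc n} P? with greatest (P? ∘ suc)
... | inj₁ (x , Px , max) = inj₁ (suc x , Px , λ { {zero} _ → z≤n ; {suc y} Py → s≤s (max Py) })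
... | inj₂ none with P? zero
...   | yes P0 = inj₁ (zero , P0 , λ { {zero} _ → z≤n ; {suc y} Py → ⊥-elim (none y Py) })
...   | no ¬P0 = inj₂ λ { zero → ¬P0 ; (suc x) → none x }

-- (a,b] contains exactly one of i and j.  As a and b share a block of Kr(π), the complement determines π.
Distinguished : ∀ {n} → NC n → Fin n → Fin n → Set
Distinguished {n} π i j = Σ[ a ∈ Fin n ] Σ[ b ∈ Fin n ] (a Fin.≤ b) × Saturated π a b ×
  ((a Fin.< j × j Fin.≤ b × i Fin.≤ a) ⊎ (a Fin.< i × i Fin.≤ b × b Fin.< j))

module _ {n} (π : NC n) {i j : Fin n} (i<j : i Fin.< j) (i≁j : ¬ π [ i ∼ j ]) where

  private
    below? : U.Decidable (λ x → π [ i ∼ x ] × x Fin.< j)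
    below? x = ∼? π i x ×-dec (x Fin.<? j)

    above? : U.Decidable (λ x → π [ i ∼ x ] × j Fin.< x)
    above? x = ∼? π i x ×-dec (j Fin.<? x)

  distinguished : Distinguished π i j
  distinguished with greatest below?
  ... | inj₂ none = ⊥-elim (none i (∼-refl π i , i<j))
  ... | inj₁ (m , (i∼m , m<j) , max) with least above?
  -- Here `m` and `suc p` are consecutive points of the block of `i` with `j` between them, and
  -- (m,p] is the gap between them, which no block leaves.
  ...   | inj₁ (suc p , (i∼p , j<p) , min) =
    m , inject₁ p , ≤-pred (ℕ.<-trans m<j j<p) , sat , inj₁ (m<j , ≤-pred j<p , max (∼-refl π i , i<j))
    where
    ≤-pred : ∀ {x : Fin n} → x Fin.< suc p → x Fin.≤ inject₁ p
    ≤-pred {x} x<p = subst (toℕ x ℕ.≤_) (≡.sym (Fin.toℕ-inject₁ p)) (s≤s⁻¹ x<p)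

    ≤-pred⁻ : ∀ {x : Fin n} → x Fin.≤ inject₁ p → x Fin.< suc p
    ≤-pred⁻ {x} x≤ = s≤s (subst (toℕ x ℕ.≤_) (Fin.toℕ-inject₁ p) x≤)

    notB : ∀ {x} → m Fin.< x → x Fin.< suc p → ¬ π [ i ∼ x ]
    notB {x} m<x x<p i∼x with Fin.<-cmp x j
    ... | tri< x<j _ _    = ℕ.<⇒≱ m<x (max (i∼x , x<j))
    ... | tri≈ _ ≡.refl _   = i≁j i∼x
    ... | tri> _ _ j<x    = ℕ.<⇒≱ x<p (min (i∼x , j<x))

    sat : Saturated π m (inject₁ p)
    sat {x} {y} x∼y m<x x≤ with x<p ← ≤-pred⁻ x≤ with Fin.<-cmp m y | Fin.<-cmp y (suc p)
    ... | tri< m<y _ _  | tri< y<p _ _  = m<y , ≤-pred y<p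
    ... | tri≈ _ ≡.refl _ | _             = ⊥-elim (notB m<x x<p (∼-trans π i∼m (∼-sym π x∼y)))
    ... | _             | tri≈ _ ≡.refl _ = ⊥-elim (notB m<x x<p (∼-trans π i∼p (∼-sym π x∼y)))
    ... | tri> _ _ y<m  | _             = ⊥-elim (notB m<x x<p (∼-trans π i∼m (∼-trans π
      (∼-sym π (noncrossing π y m x (suc p) y<m m<x x<p (∼-sym π x∼y) (∼-trans π (∼-sym π i∼m) i∼p))) (∼-sym π x∼y))))
    ... | _             | tri> _ _ p<y  = ⊥-elim (notB m<x x<p (∼-trans π i∼m
      (noncrossing π m x (suc p) y m<x x<p p<y (∼-trans π (∼-sym π i∼m) i∼p) x∼y)))
  ...   | inj₂ none with least (∼? π i)
  ...     | inj₂ none′ = ⊥-elim (none′ i (∼-refl π i))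
  ...     | inj₁ (m₀ , i∼m₀ , min) = around m₀ i∼m₀ min
    where
    ≤m : ∀ {x} → π [ i ∼ x ] → x Fin.≤ m
    ≤m {x} i∼x with Fin.<-cmp x j
    ... | tri< x<j _ _  = max (i∼x , x<j)
    ... | tri≈ _ ≡.refl _ = ⊥-elim (i≁j i∼x)
    ... | tri> _ _ j<x  = ⊥-elim (none x (i∼x , j<x))

    -- The block of `i` has no point above `j` here, so [m₀,m] is its convex hull. By non-crossing,
    -- a block meeting the hull lies in it.
    hull : ∀ {m₀} → π [ i ∼ m₀ ] → (∀ {y} → π [ i ∼ y ] → m₀ Fin.≤ y) →
           ∀ {x y} → π [ x ∼ y ] → m₀ Fin.≤ x → x Fin.≤ m → m₀ Fin.≤ y × y Fin.≤ m
    hull {m₀} i∼m₀ min {x} {y} x∼y m₀≤x x≤m with ∼? π i x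
    ... | yes i∼x = min (∼-trans π i∼x x∼y) , ≤m (∼-trans π i∼x x∼y)
    ... | no i≁x with Fin.<-cmp m₀ x | Fin.<-cmp x m
    ...   | tri≈ _ ≡.refl _ | _ = ⊥-elim (i≁x i∼m₀)
    ...   | tri> _ _ x<m₀ | _ = ⊥-elim (ℕ.<⇒≱ x<m₀ m₀≤x)
    ...   | _ | tri≈ _ ≡.refl _ = ⊥-elim (i≁x i∼m)
    ...   | _ | tri> _ _ m<x  = ⊥-elim (ℕ.<⇒≱ m<x x≤m)
    ...   | tri< m₀<x _ _ | tri< x<m _ _ = ℕ.≮⇒≥ not-below , ℕ.≮⇒≥ not-above
      where
      m₀∼m = ∼-trans π (∼-sym π i∼m₀) i∼m
      not-below : ¬ y Fin.< m₀
      not-below y<m₀ = i≁x (∼-trans π i∼m₀ (∼-trans π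
        (∼-sym π (noncrossing π y m₀ x m y<m₀ m₀<x x<m (∼-sym π x∼y) m₀∼m)) (∼-sym π x∼y)))
      not-above : ¬ m Fin.< y
      not-above m<y = i≁x (∼-trans π i∼m₀ (noncrossing π m₀ x m y m₀<x x<m m<y m₀∼m x∼y))

    top : ∀ {k} → Fin k → Σ[ t ∈ Fin k ] (∀ (x : Fin k) → x Fin.≤ t)
    top {suc k} _ = fromℕ k , Fin.≤fromℕ

    -- As a half-open interval the hull is (m₀-1,m]. For m₀ = 0 this left end does not exist, and
    -- the rest (m,t] up to the last point `t` takes its place.
    around : ∀ m₀ → π [ i ∼ m₀ ] → (∀ {y} → π [ i ∼ y ] → m₀ Fin.≤ y) → Distinguished π i j
    around zero i∼0 min = let t , ≤t = top i in
      m , t , ≤t m ,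
      (λ {x} {y} x∼y m<x _ → ℕ.≰⇒> (λ y≤m → ℕ.<⇒≱ m<x
        (proj₂ (hull {zero} i∼0 min (∼-sym π x∼y) z≤n y≤m))) , ≤t y) ,
      inj₁ (m<j , ≤t j , max (∼-refl π i , i<j))
    around (suc k) i∼m₀ min = inject₁ k , m , ℕ.<⇒≤ (k<⁺ (min i∼m)) ,
      (λ x∼y k<x x≤m → let m₀≤y , y≤m = hull i∼m₀ min x∼y (k<⁻ k<x) x≤m in k<⁺ m₀≤y , y≤m) ,
      inj₂ (k<⁺ (min (∼-refl π i)) , ≤m (∼-refl π i) , m<j)
      where
      k<⁺ : ∀ {x : Fin n} → suc k Fin.≤ x → inject₁ k Fin.< x
      k<⁺ {x} = subst (ℕ._< toℕ x) (≡.sym (Fin.toℕ-inject₁ k))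
      k<⁻ : ∀ {x : Fin n} → inject₁ k Fin.< x → suc k Fin.≤ x
      k<⁻ {x} = subst (ℕ._< toℕ x) (Fin.toℕ-inject₁ k)

complement-injective : ∀ {n} (π σ : NC n) → complement π ≡ complement σ → π ≡ σ
complement-injective π σ eq = NC-ext (λ _ _ → ⊆∼ σ π (≡.sym eq)) (λ _ _ → ⊆∼ π σ eq)
  where
  ⊆∼ : ∀ π σ → complement π ≡ complement σ → ∀ {x y} → σ [ x ∼ y ] → π [ x ∼ y ]
  ⊆∼ π σ eq {x} {y} = ordered
    where
    lt : ∀ {x y} → x Fin.< y → σ [ x ∼ y ] → π [ x ∼ y ]
    lt {x} {y} x<y x∼y with ∼? π x y
    ... | yes r = r
    ... | no ¬r with a , b , a≤b , sat , where′ ← distinguished π x<y ¬r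
      with satσ ← complement⁻ σ a≤b (subst (λ κ → κ [ a ∼ b ]) eq (complement⁺ π a≤b sat)) = ⊥-elim (impossible where′)
      where
      impossible : (a Fin.< y × y Fin.≤ b × x Fin.≤ a) ⊎ (a Fin.< x × x Fin.≤ b × b Fin.< y) → ⊥
      impossible (inj₁ (a<y , y≤b , x≤a)) = ℕ.<⇒≱ (proj₁ (satσ (∼-sym σ x∼y) a<y y≤b)) x≤a
      impossible (inj₂ (a<x , x≤b , b<y)) = ℕ.<⇒≱ b<y (proj₂ (satσ x∼y a<x x≤b))

    ordered : σ [ x ∼ y ] → π [ x ∼ y ]
    ordered x∼y with Fin.<-cmp x y
    ... | tri< x<y _ _  = lt x<y x∼y
    ... | tri≈ _ ≡.refl _ = ∼-refl π x
    ... | tri> _ _ y<x  = ∼-sym π (lt y<x (∼-sym σ x∼y))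

unique-⊆⇒length≤ : ∀ {A : Set} {xs ys : List A} → Unique xs → (∀ {x} → x ∈ˡ xs → x ∈ˡ ys) →
                   length xs ℕ.≤ length ys
unique-⊆⇒length≤ [] sub = z≤n
unique-⊆⇒length≤ {xs = x ∷ xs} (x∉ ∷ xs!) sub with us , vs , ≡.refl ← ∈-∃++ (sub (here ≡.refl)) =
  subst (suc (length xs) ℕ.≤_) (≡.sym size)
    (s≤s (unique-⊆⇒length≤ {ys = us ++ vs} xs! λ y∈ → drop y∈ (∈-++⁻ us (sub (there y∈)))))
  where
  size : length (us ++ x ∷ vs) ≡ suc (length (us ++ vs))
  size = ≡.trans (List.length-++ us) (≡.trans (ℕ.+-suc (length us) (length vs)) (cong suc (≡.sym (List.length-++ us))))
  drop : ∀ {y} → y ∈ˡ xs → y ∈ˡ us ⊎ y ∈ˡ (x ∷ vs) → y ∈ˡ us ++ vs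
  drop y∈ (inj₁ p)             = ∈-++⁺ˡ p
  drop y∈ (inj₂ (here ≡.refl)) = ⊥-elim (All.lookup x∉ y∈ ≡.refl)
  drop y∈ (inj₂ (there p))     = ∈-++⁺ʳ us p

-- Pigeonhole: a missed `κ` together with the image of the injective complement map would be a list
-- without repetition longer than `elements n`.
complement-surjective : ∀ {n} (κ : NC n) → ∃ λ π → π ∈ˡ elements n × complement π ≡ κ
complement-surjective {n} κ with any? (κ ≟ᴺ_) (List.map complement (elements n))
... | yes κ∈ = let π , π∈ , eq = ∈-map⁻ complement κ∈ in π , π∈ , ≡.sym eq
... | no κ∉  = ⊥-elim (ℕ.<-irrefl (List.length-map complement (elements n))
  (unique-⊆⇒length≤ {ys = elements n} (All.¬Any⇒All¬ _ κ∉ ∷ Unique.map⁺ (complement-injective _ _) (elements-! n))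
    λ {π} _ → ∈-elements π))

-- Monotonicity of block numbers, ground sets with at most one point

private
  +-∸-+ : ∀ {a b c d} → c ℕ.≤ a → d ℕ.≤ b → (a ℕ.+ b) ℕ.∸ (c ℕ.+ d) ≡ (a ℕ.∸ c) ℕ.+ (b ℕ.∸ d)
  +-∸-+ {a} {b} {c} {d} c≤a d≤b = ≡.trans (≡.sym (ℕ.∸-+-assoc (a ℕ.+ b) c d))
    (≡.trans (cong (ℕ._∸ d) (ℕ.+-∸-comm b c≤a)) (ℕ.+-∸-assoc (a ℕ.∸ c) d≤b))

#blocks>0 : ∀ {n} (π : NC n) → Fin n → 1 ℕ.≤ #blocks π
#blocks>0 π x = nonempty (blocks π) (∈-blocks⁺ π x)
  where
  nonempty : ∀ Ws → block π x ∈ˡ Ws → 1 ℕ.≤ length Ws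
  nonempty (_ ∷ _) _ = s≤s z≤n

#blocks-mono : ∀ {n} (π σ : NC n) → π ≼ σ → #blocks σ ℕ.≤ #blocks π
#blocks-mono {n} π σ π≼σ = go n (<-wellFounded n) π σ π≼σ
  where
  go : ∀ n → Acc ℕ._<_ n → (π σ : NC n) → π ≼ σ → #blocks σ ℕ.≤ #blocks π
  go zero    _        π σ _   = ℕ.≤-reflexive (cong #blocks (NC0-unique σ π))
  go (suc n) (acc rs) π σ π≼σ = subst₂ ℕ._≤_ (≡.sym splitσ) (≡.sym splitπ)
    (ℕ.+-mono-≤ (#blocks>0 (π ↾ W) (rank W 0∈W))
      (go ∣ ∁ W ∣ (rs (∣∁∣< W 0∈W)) (π ↾ ∁ W) (σ ↾ ∁ W) (↾-mono π σ π≼σ (∁ W))))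
    where
    open Splitting ℕ.+-0-commutativeMonoid
    W = block σ zero
    0∈W = ∼-refl σ zero
    splitσ : #blocks σ ≡ 1 ℕ.+ #blocks (σ ↾ ∁ W)
    splitσ = ≡.trans (split-block #blocksˡ #blocks-splits σ σ (≼-refl σ) zero)
      (cong (ℕ._+ #blocks (σ ↾ ∁ W)) (≡.trans (cong #blocks (block-↾ σ zero)) (#blocks-1ₙ (rank W 0∈W))))
    splitπ : #blocks π ≡ #blocks (π ↾ W) ℕ.+ #blocks (π ↾ ∁ W)
    splitπ = split-block #blocksˡ #blocks-splits π σ π≼σ zero

-- At most one point, the empty case included; there every unital kernel has the value 1.
AllEqual : ℕ → Set
AllEqual n = (a b : Fin n) → a ≡ b

allEqual⇒≡ : ∀ {n} → AllEqual n → (π σ : NC n) → π ≡ σ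
allEqual⇒≡ eq π σ = NC-ext (λ x y _ → ∼-reflexive σ (eq x y)) (λ x y _ → ∼-reflexive π (eq x y))

allEqual : ∀ {n} (W : Subset n) i → (∀ {x} → x ∈ W → x ≡ i) → AllEqual ∣ W ∣
allEqual W i eq a b = element-injective W (≡.trans (eq (element-∈ W a)) (≡.sym (eq (element-∈ W b))))

-- Inheritance of the factorisation laws, the zeta function, powers of q

module KernelLemmas {c ℓ} (R : CommutativeRing c ℓ) where

  open CommutativeRing R hiding (zero)
  open Kernels R public

  unital-allEqual : ∀ (k : Kernel) → Unital k → ∀ {n} → AllEqual n → (π σ : NC n) → k π σ ≈ 1#
  unital-allEqual k unit eq π σ = trans (reflexive (cong (k π) (allEqual⇒≡ eq σ π))) (unit π)

  act-cong′ : ∀ (k : Kernel) {n} {x y : NC n → Carrier} π → (∀ ρ → x ρ ≈ y ρ) → act k x π ≈ act k y π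
  act-cong′ k {n} π eq = Sum-cong (elements n) λ {ρ} _ → *-congˡ (eq ρ)

  act-outside : ∀ (k : Kernel) → Triangular k → ∀ {n} (x : NC n → Carrier) (π σ : NC n) → ¬ π ≼ σ →
                (∀ ρ → ¬ ρ ≼ σ → x ρ ≈ 0#) → act k x π ≈ 0#
  act-outside k tri {n} x π σ π⋠σ supp = Sum-0 (elements n) λ {ρ} _ → term ρ
    where
    term : ∀ ρ → k π ρ * x ρ ≈ 0#
    term ρ with π ≼? ρ
    ... | no π⋠ρ  = trans (*-congʳ (tri π ρ π⋠ρ)) (zeroˡ _)
    ... | yes π≼ρ = trans (*-congˡ (supp ρ λ ρ≼σ → π⋠σ (≼-trans π ρ σ π≼ρ ρ≼σ))) (zeroʳ _)

  -- The column of `h` at `σ` is compared with the product of its two restrictions, extended by 0 to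
  -- partitions not below `σ`. By the splitting of `k` and `m` the kernel `k` takes both to the same
  -- function, so they agree by `act-cancel`.
  splits-cancel : ∀ (k h m : Kernel) → Triangular k → Unital k → Splits k → Triangular h → Splits m →
                  (∀ {n} (π σ : NC n) → (k ⊛ h) π σ ≈ m π σ) → Splits h
  splits-cancel k h m tk uk sk th sm k⊛h≈m {n} A B π σ π≼σ cov sep =
    trans (act-cancel k tk uk {D = λ _ → Unit} _ (λ ρ → h ρ σ) y (λ π _ → agree π (π ≼? σ)) π tt)
          (y-in π π≼σ)
    where
    product : NC n → Carrier
    product ρ = h (ρ ↾ A) (σ ↾ A) * h (ρ ↾ B) (σ ↾ B)

    y : NC n → Carrier
    y ρ with ρ ≼? σ
    ... | yes _ = product ρ
    ... | no _  = 0#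

    y-in : ∀ ρ → ρ ≼ σ → y ρ ≈ product ρ
    y-in ρ ρ≼σ with ρ ≼? σ
    ... | yes _  = refl
    ... | no ρ⋠σ = ⊥-elim (ρ⋠σ ρ≼σ)

    y-out : ∀ ρ → ¬ ρ ≼ σ → y ρ ≈ 0#
    y-out ρ ρ⋠σ with ρ ≼? σ
    ... | yes ρ≼σ = ⊥-elim (ρ⋠σ ρ≼σ)
    ... | no _    = refl

    agree : ∀ π → Dec (π ≼ σ) → act k (λ ρ → h ρ σ) π ≈ act k y π
    agree π (no π⋠σ)  = trans (act-outside k tk (λ ρ → h ρ σ) π σ π⋠σ (λ ρ → th ρ σ))
                              (sym (act-outside k tk y π σ π⋠σ y-out))
    agree π (yes π≼σ) = trans (k⊛h≈m π σ) (trans (sm A B π σ π≼σ cov sep) (trans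
      (*-cong (sym (k⊛h≈m (π ↾ A) (σ ↾ A))) (sym (k⊛h≈m (π ↾ B) (σ ↾ B))))
      (sym (act-split k tk sk A B π σ π≼σ cov sep y (λ ρ → h ρ (σ ↾ A)) (λ ρ → h ρ (σ ↾ B))
        y-out (λ ρ → th ρ (σ ↾ A)) (λ ρ → th ρ (σ ↾ B)) y-in))))

  -- The argument of `splits-cancel`, carried out in the up-set of partitions joining `i` and `j`,
  -- where the law for `m` is available.
  chordLaw-cancel : ∀ (k h m : Kernel) → Triangular k → Unital k → Splits k → ∀ b → ChordLaw b k → ChordLaw b m →
                    (∀ {n} (π σ : NC n) → (k ⊛ h) π σ ≈ m π σ) → ChordLaw b h
  chordLaw-cancel k h m tk uk sk b lk lm k⊛h≈m {n} π {i} {j} i<j i∼j =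
    act-cancel k tk uk {D = _[ i ∼ j ]} (λ π ρ π≼ρ → ≼⇒∼ π ρ π≼ρ) (λ ρ → h ρ 1ₙ) y agree π i∼j
    where
    A = inner b i j
    T = outer i j
    y : NC n → Carrier
    y ρ = h (ρ ↾ A) 1ₙ * h (ρ ↾ T) 1ₙ
    agree : ∀ π → π [ i ∼ j ] → act k (λ ρ → h ρ 1ₙ) π ≈ act k y π
    agree π i∼j = trans (k⊛h≈m π 1ₙ) (trans (lm π i<j i∼j) (trans
      (*-cong (sym (k⊛h≈m (π ↾ A) 1ₙ)) (sym (k⊛h≈m (π ↾ T) 1ₙ)))
      (sym (act-chord k tk sk b lk π i<j i∼j y (λ ρ → h ρ 1ₙ) (λ ρ → h ρ 1ₙ) (λ _ _ → refl)))))

  -- Cutting [i,j] along its own chord leaves [i,j) and the single point j.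
  chordLaw-closed : ∀ (Q : Kernel) → (∀ {n} → AllEqual n → (π : NC n) → Q π 1ₙ ≈ 1#) →
                    ChordLaw false Q → ChordLaw true Q
  chordLaw-closed Q trivial law {n} π {i} {j} i<j i∼j = trans (law π i<j i∼j) (*-congʳ (sym shrink))
    where
    A = inner false i j
    S = inner true i j
    S⁺ : ∀ {x} → i Fin.≤ x → x Fin.≤ j → x ∈ S
    S⁺ p q = ∈⟪⟫⁺ (inner? true i j) (p , q)
    i∈S = S⁺ ℕ.≤-refl (ℕ.<⇒≤ i<j)
    j∈S = S⁺ (ℕ.<⇒≤ i<j) ℕ.≤-refl
    i′ = rank S i∈S
    j′ = rank S j∈S
    A′ = inner false i′ j′
    T′ = outer i′ j′

    A⇒ : ∀ {x} → x ∈ A → Σ[ p ∈ x ∈ S ] rank S p ∈ A′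
    A⇒ {x} x∈A =
      let u , v = ∈⟪⟫⁻ (inner? false i j) x∈A
          p = S⁺ u (ℕ.<⇒≤ v)
      in p , ∈⟪⟫⁺ (inner? false i′ j′)
           ( element-≤⁻ S (subst₂ Fin._≤_ (≡.sym (element-rank S i∈S)) (≡.sym (element-rank S p)) u)
           , rank-mono-< S p j∈S v)

    A⇐ : ∀ {a} → a ∈ A′ → element S a ∈ A
    A⇐ {a} a∈ = let u , v = ∈⟪⟫⁻ (inner? false i′ j′) a∈ in ∈⟪⟫⁺ (inner? false i j)
      ( subst (Fin._≤ element S a) (element-rank S i∈S) (element-≤⁺ S u)
      , subst (element S a Fin.<_) (element-rank S j∈S) (element-mono-< S v))

    T′⇒j : ∀ {a} → a ∈ T′ → a ≡ j′
    T′⇒j {a} a∈ with ∈⟪⟫⁻ (outer? i′ j′) a∈ | ∈⟪⟫⁻ (inner? true i j) (element-∈ S a)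
    ... | inj₁ a<i | i≤a , _ = ⊥-elim (ℕ.<⇒≱ (subst (element S a Fin.<_) (element-rank S i∈S) (element-mono-< S a<i)) i≤a)
    ... | inj₂ j≤a | _ , a≤j = Fin.toℕ-injective (ℕ.≤-antisym
      (element-≤⁻ S (subst (element S a Fin.≤_) (≡.sym (element-rank S j∈S)) a≤j)) j≤a)

    shrink : Q (π ↾ S) 1ₙ ≈ Q (π ↾ A) 1ₙ
    shrink = trans (law (π ↾ S) (rank-mono-< S i∈S j∈S i<j) (↾-rank⁺ π S i∈S j∈S i∼j)) (trans
      (*-cong (reflexive (↾-↾ S A′ A A⇒ A⇐ (λ τ _ → Q τ 1ₙ) π π)) (trivial (allEqual T′ j′ T′⇒j) (π ↾ S ↾ T′)))
      (*-identityʳ _))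

  -- A function of π alone; the second argument only makes it a Kernel.
  fromBelow : Kernel → Kernel
  fromBelow k π _ = k 0ₙ (complement π)

  -- The complement turns the chord into a separation of [i,j) from the outer side, so splitting
  -- over parts becomes a chord law.
  fromBelow-chordLaw : ∀ (k : Kernel) → Splits k → ChordLaw false (fromBelow k)
  fromBelow-chordLaw k splits π {i} {j} i<j i∼j = trans
    (splits A T 0ₙ (complement π) (0ₙ≼ (complement π)) (cover (cut false π i<j i∼j)) (complement-separates π i<j i∼j))
    (reflexive (cong₂ _*_ (cong₂ k (0ₙ↾ A) (complement-inner π i<j i∼j)) (cong₂ k (0ₙ↾ T) (complement-outer π i<j i∼j))))
    where
    A = inner false i j
    T = outer i j

  chordLaw-cong : ∀ (Q Q′ : Kernel) b → (∀ {n} (π : NC n) → Q π 1ₙ ≈ Q′ π 1ₙ) → ChordLaw b Q → ChordLaw b Q′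
  chordLaw-cong Q Q′ b eq law π {i} {j} i<j i∼j = trans (sym (eq π)) (trans (law π i<j i∼j)
    (*-cong (eq (π ↾ inner b i j)) (eq (π ↾ outer i j))))

  Sum-complement : ∀ n (x : NC n → Carrier) → Sum (elements n) (λ π → x (complement π)) ≈ Sum (elements n) x
  Sum-complement n = Sum-reindex (elements-! n) (elements-! n) complement (λ {π} _ → ∈-elements (complement π))
    (λ {π} {σ} _ _ → complement-injective π σ) (λ {κ} _ → complement-surjective κ)

  -- The zeta function of NC(n). It is the constant weight with which `act-chord` factors a plain
  -- sum over [η,1ₙ].
  ζ : Kernel
  ζ π σ with π ≼? σ
  ... | yes _ = 1#
  ... | no _  = 0#

  ζ-≼ : ∀ {n} (π σ : NC n) → π ≼ σ → ζ π σ ≈ 1#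
  ζ-≼ π σ π≼σ with π ≼? σ
  ... | yes _ = refl
  ... | no ¬p = ⊥-elim (¬p π≼σ)

  ζ-triangular : Triangular ζ
  ζ-triangular π σ π⋠σ with π ≼? σ
  ... | yes p = ⊥-elim (π⋠σ p)
  ... | no _  = refl

  ζ-splits : Splits ζ
  ζ-splits A B π σ π≼σ _ _ = trans (ζ-≼ π σ π≼σ) (sym (trans
    (*-cong (ζ-≼ (π ↾ A) (σ ↾ A) (↾-mono π σ π≼σ A)) (ζ-≼ (π ↾ B) (σ ↾ B) (↾-mono π σ π≼σ B))) (*-identityˡ 1#)))

  ζ-chordLaw : ∀ b → ChordLaw b ζ
  ζ-chordLaw b π {i} {j} i<j i∼j = trans (ζ-≼ π 1ₙ (≼1ₙ π)) (sym (trans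
    (*-cong (ζ-≼ (π ↾ inner b i j) 1ₙ (≼1ₙ (π ↾ inner b i j))) (ζ-≼ (π ↾ outer i j) 1ₙ (≼1ₙ (π ↾ outer i j)))) (*-identityˡ 1#)))

  module Powers (q : Carrier) where

    open import Algebra.Properties.Semiring.Exp semiring using (_^_; ^-homo-*)

    -- The multiplicative function with z(π,1ₙ) = q^(|π|-1)
    z : Kernel
    z π σ with π ≼? σ
    ... | yes _ = q ^ (#blocks π ℕ.∸ #blocks σ)
    ... | no _  = 0#

    z-≼ : ∀ {n} (π σ : NC n) → π ≼ σ → z π σ ≈ q ^ (#blocks π ℕ.∸ #blocks σ)
    z-≼ π σ π≼σ with π ≼? σ
    ... | yes _ = refl
    ... | no ¬p = ⊥-elim (¬p π≼σ)

    z-triangular : Triangular z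
    z-triangular π σ π⋠σ with π ≼? σ
    ... | yes p = ⊥-elim (π⋠σ p)
    ... | no _  = refl

    z-unital : Unital z
    z-unital π = trans (z-≼ π π (≼-refl π)) (reflexive (cong (q ^_) (ℕ.n∸n≡0 (#blocks π))))

    z-splits : Splits z
    z-splits A B π σ π≼σ cov sep = trans (z-≼ π σ π≼σ) (trans
      (reflexive (cong (q ^_) (≡.trans
        (cong₂ ℕ._∸_ (#blocks-split {A = A} {B} π cov (λ u v → sep u v ∘ ≼⇒∼ π σ π≼σ)) (#blocks-split {A = A} {B} σ cov sep))
        (+-∸-+ (#blocks-mono (π ↾ A) (σ ↾ A) πA≼σA) (#blocks-mono (π ↾ B) (σ ↾ B) πB≼σB)))))
      (trans (^-homo-* q (#blocks (π ↾ A) ℕ.∸ #blocks (σ ↾ A)) (#blocks (π ↾ B) ℕ.∸ #blocks (σ ↾ B)))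
        (sym (*-cong (z-≼ (π ↾ A) (σ ↾ A) πA≼σA) (z-≼ (π ↾ B) (σ ↾ B) πB≼σB)))))
      where
      πA≼σA = ↾-mono π σ π≼σ A
      πB≼σB = ↾-mono π σ π≼σ B

    z-1ₙ : ∀ {n} (π : NC n) → Fin n → z π 1ₙ ≈ q ^ (#blocks π ℕ.∸ 1)
    z-1ₙ π x = trans (z-≼ π 1ₙ (≼1ₙ π)) (reflexive (cong (λ m → q ^ (#blocks π ℕ.∸ m)) (#blocks-1ₙ x)))

    chord-power : ∀ b {n} (π : NC n) {i j : Fin n} → i Fin.< j → π [ i ∼ j ] →
      q ^ (#blocks π ℕ.∸ 1) ≈ q ^ (#blocks (π ↾ inner b i j) ℕ.∸ 1) * q ^ (#blocks (π ↾ outer i j) ℕ.∸ 1)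
    chord-power b π {i} {j} i<j i∼j = trans
      (reflexive (cong (q ^_) (counts (#blocks-chord b π i<j i∼j)
        (#blocks>0 (π ↾ A) (rank A (inner⁺ b i j ℕ.≤-refl i<j)))
        (#blocks>0 (π ↾ T) (rank T (∈⟪⟫⁺ (outer? i j) (inj₂ ℕ.≤-refl)))))))
      (^-homo-* q (#blocks (π ↾ A) ℕ.∸ 1) (#blocks (π ↾ T) ℕ.∸ 1))
      where
      A = inner b i j
      T = outer i j
      counts : ∀ {p a t} → suc p ≡ a ℕ.+ t → 1 ℕ.≤ a → 1 ℕ.≤ t → p ℕ.∸ 1 ≡ (a ℕ.∸ 1) ℕ.+ (t ℕ.∸ 1)
      counts {p} {suc a} {suc t} eq _ _ =
        ≡.trans (cong (ℕ._∸ 1) (ℕ.suc-injective eq)) (cong (ℕ._∸ 1) (ℕ.+-suc a t))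

    z-chordLaw : ChordLaw false z
    z-chordLaw π {i} {j} i<j i∼j = trans (z-1ₙ π i) (trans (chord-power false π i<j i∼j)
      (sym (*-cong (z-1ₙ (π ↾ inner false i j) (rank (inner false i j) (inner⁺ false i j ℕ.≤-refl i<j)))
                   (z-1ₙ (π ↾ outer i j) (rank (outer i j) (∈⟪⟫⁺ (outer? i j) (inj₂ ℕ.≤-refl)))))))

    -- By `#blocks-complement` the exponents n - |ρ| and |Kr(ρ)| - 1 agree. The complement is on the
    -- opposite side compared with `tot-kreweras`; the base case of `F⊛z≈z⊛F` uses the two forms
    -- together.
    z-complement : ∀ {n} (ρ : NC n) → z 0ₙ ρ ≈ z (complement ρ) 1ₙ
    z-complement {zero}  ρ = trans (unital-allEqual z z-unital (λ ()) 0ₙ ρ) (sym (unital-allEqual z z-unital (λ ()) (complement ρ) 1ₙ))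
    z-complement {suc n} ρ = trans (z-≼ 0ₙ ρ (0ₙ≼ ρ)) (trans
      (reflexive (cong (q ^_) (≡.trans (cong (ℕ._∸ #blocks ρ) (#blocks-0ₙ {suc n}))
        (counts (#blocks-complement ρ zero) (#blocks>0 (complement ρ) zero)))))
      (sym (z-1ₙ (complement ρ) zero)))
      where
      counts : ∀ {p k m} → p ℕ.+ k ≡ suc m → 1 ℕ.≤ k → m ℕ.∸ p ≡ k ℕ.∸ 1
      counts {p} {suc k} {m} eq _ = ≡.trans
        (cong (ℕ._∸ p) (≡.sym (ℕ.suc-injective (≡.trans (≡.sym (ℕ.+-suc p k)) eq)))) (ℕ.m+n∸m≡n p k)

-- The ends are described by extremality because a restriction has size `∣ W ∣`, which is not of the
-- form `suc n`, so that `zero` and `fromℕ` cannot name them.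
Least Greatest : ∀ {n} → Fin n → Set
Least    {n} x = ∀ (z : Fin n) → x Fin.≤ z
Greatest {n} y = ∀ (z : Fin n) → z Fin.≤ y

rank-least : ∀ {n} (W : Subset n) {x} (p : x ∈ W) → (∀ {z} → z ∈ W → x Fin.≤ z) → Least (rank W p)
rank-least W p min a = element-≤⁻ W (subst (Fin._≤ element W a) (≡.sym (element-rank W p)) (min (element-∈ W a)))

rank-greatest : ∀ {n} (W : Subset n) {y} (p : y ∈ W) → (∀ {z} → z ∈ W → z Fin.≤ y) → Greatest (rank W p)
rank-greatest W p max a = element-≤⁻ W (subst (element W a Fin.≤_) (≡.sym (element-rank W p)) (max (element-∈ W a)))

extremes : ∀ {n} → Fin n → Σ[ x ∈ Fin n ] Σ[ y ∈ Fin n ] Least x × Greatest y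
extremes {suc n} _ = zero , fromℕ n , (λ _ → z≤n) , Fin.≤fromℕ

≤-antisymᶠ : ∀ {n} {x y : Fin n} → x Fin.≤ y → y Fin.≤ x → x ≡ y
≤-antisymᶠ p q = Fin.toℕ-injective (ℕ.≤-antisym p q)

-- Chord laws of f and u, and the conjugate

module Conjugation {c ℓ} (R : CommutativeRing c ℓ) where

  open CommutativeRing R hiding (zero)
  open KernelLemmas R
  open Totals R
  open Convolution R
  open import Algebra.Properties.Semiring.Exp semiring using (_^_)

  module _ {g} (g∈ : 𝒢 g) where

    private
      k = tot g
      splits = tot-splits (𝒢.semi-multiplicative g∈)
      unit = tot-unital (𝒢.semi-multiplicative g∈)

    tot-kreweras : ∀ {n} (π : NC n) → k π 1ₙ ≈ k 0ₙ (complement π)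
    tot-kreweras {zero}  π = refl
    tot-kreweras {suc n} π = trans (reflexive (tot-1ₙ g π))
      (trans (𝒢.kreweras g∈ π (complement π) (complement-isKreweras π)) (sym (reflexive (tot-0ₙ g (complement π)))))

    tot-chordLaw-open : ChordLaw false k
    tot-chordLaw-open = chordLaw-cong (fromBelow k) k false (λ π → sym (tot-kreweras π)) (fromBelow-chordLaw k splits)

    tot-chordLaw-closed : ChordLaw true k
    tot-chordLaw-closed = chordLaw-closed k (λ eq π → unital-allEqual k unit eq π 1ₙ) tot-chordLaw-open

  module _ {q u} (u∈ : IsU q u) where

    open Powers q

    private
      U = tot u
      splits = tot-splits (IsU.semi-multiplicative u∈)
      unit = tot-unital (IsU.semi-multiplicative u∈)

      least≡ : ∀ {n} {x : Fin (suc n)} → Least x → x ≡ zero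
      least≡ min = ≤-antisymᶠ (min zero) z≤n

      greatest≡ : ∀ {n} {y : Fin (suc n)} → Greatest y → y ≡ fromℕ n
      greatest≡ {n} {y} max = ≤-antisymᶠ (Fin.≤fromℕ y) (max (fromℕ n))

    tot-irreducible : ∀ {n} (π : NC n) {x y} → Least x → Greatest y → π [ x ∼ y ] → U π 1ₙ ≈ q ^ (#blocks π ℕ.∸ 1)
    tot-irreducible {suc n} π min max x∼y = trans (reflexive (tot-1ₙ u π))
      (IsU.irreducible u∈ π (subst₂ (π [_∼_]) (least≡ min) (greatest≡ max) x∼y))

    tot-reducible : ∀ {n} (π : NC n) {x y} → Least x → Greatest y → ¬ π [ x ∼ y ] → U π 1ₙ ≈ 0#
    tot-reducible {suc n} π min max x≁y = trans (reflexive (tot-1ₙ u π))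
      (IsU.reducible u∈ π (x≁y ∘ subst₂ (π [_∼_]) (≡.sym (least≡ min)) (≡.sym (greatest≡ max))))

    -- Some block of `τ` has at least two points. On it `0ₙ` is reducible, so the factor of this
    -- block vanishes.
    tot-u-0ₙ : ∀ {n} (τ : NC n) → τ ≢ 0ₙ → U 0ₙ τ ≈ 0#
    tot-u-0ₙ τ τ≢0 with chord-or-0ₙ τ
    ... | inj₂ τ≡0 = ⊥-elim (τ≢0 τ≡0)
    ... | inj₁ (i , j , i<j , i∼j) = trans (split-block U splits 0ₙ τ (0ₙ≼ τ) i)
      (trans (*-congʳ (trans (reflexive (cong (λ π → U π 1ₙ) (0ₙ↾ W))) reducible)) (zeroˡ _))
      where
      W = block τ i
      i′ = rank W (∼-refl τ i)
      j′ = rank W i∼j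
      i′<j′ : i′ Fin.< j′
      i′<j′ = rank-mono-< W (∼-refl τ i) i∼j i<j
      reducible : U (0ₙ {∣ W ∣}) 1ₙ ≈ 0#
      reducible with x , y , min , max ← extremes i′ = tot-reducible (0ₙ {∣ W ∣}) min max λ x∼y →
        ℕ.<⇒≱ i′<j′ (ℕ.≤-trans (max j′) (subst (Fin._≤ i′) (0ₙ-∼ x∼y) (min i′)))

    act-u-0ₙ : ∀ {n} (x : NC n → Carrier) → act U x 0ₙ ≈ x 0ₙ
    act-u-0ₙ {n} x = trans
      (Sum-single (elements-! n) (λ τ → U 0ₙ τ * x τ) (∈-elements (0ₙ {n}))
        (λ {τ} τ≢0 → trans (*-congʳ (tot-u-0ₙ τ τ≢0)) (zeroˡ _)))
      (trans (*-congʳ (unit (0ₙ {n}))) (*-identityˡ _))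

    private
      module ChordEnds {n} (π : NC (suc n)) {i j : Fin (suc n)} (i<j : i Fin.< j) (i∼j : π [ i ∼ j ]) where

        S = inner true i j
        T = outer i j

        i∈S : i ∈ S
        i∈S = inner⁺ true i j ℕ.≤-refl i<j
        j∈S : j ∈ S
        j∈S = ∈⟪⟫⁺ (inner? true i j) (ℕ.<⇒≤ i<j , ℕ.≤-refl)

        inner-value : U (π ↾ S) 1ₙ ≈ q ^ (#blocks (π ↾ S) ℕ.∸ 1)
        inner-value = tot-irreducible (π ↾ S) (rank-least S i∈S (proj₁ ∘ inner⁻ true i j))
          (rank-greatest S j∈S (proj₂ ∘ inner⁻ true i j)) (↾-rank⁺ π S i∈S j∈S i∼j)

        y∈T : fromℕ n ∈ T
        y∈T = ∈⟪⟫⁺ (outer? i j) (inj₂ (Fin.≤fromℕ j))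

        -- The first point of `T` is `zero`, or `j` if i = 0. Either way `π` joins it to `zero`, so
        -- the ends of `T` are joined exactly when those of `π` are.
        bottom : Σ[ t ∈ Fin (suc n) ] t ∈ T × (∀ {z} → z ∈ T → t Fin.≤ z) × π [ zero ∼ t ]
        bottom with Fin.<-cmp zero i
        ... | tri< 0<i _ _ = zero , ∈⟪⟫⁺ (outer? i j) (inj₁ 0<i) , (λ _ → z≤n) , ∼-refl π zero
        ... | tri≈ _ ≡.refl _ = j , ∈⟪⟫⁺ (outer? i j) (inj₂ ℕ.≤-refl) , least-j , i∼j
          where
          least-j : ∀ {z} → z ∈ T → j Fin.≤ z
          least-j z∈T with ∈⟪⟫⁻ (outer? i j) z∈T
          ... | inj₂ j≤z = j≤z

        t = proj₁ bottom
        t∈T = proj₁ (proj₂ bottom)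
        t≤ : ∀ {z} → z ∈ T → t Fin.≤ z
        t≤ = proj₁ (proj₂ (proj₂ bottom))
        0∼t = proj₂ (proj₂ (proj₂ bottom))

    -- The closed inner side of a chord is irreducible, and the outer side is irreducible iff π is.
    tot-u-chordLaw : ChordLaw true U
    tot-u-chordLaw {suc n} π {i} {j} i<j i∼j with ∼? π zero (fromℕ n)
    ... | yes irr = trans (tot-irreducible π (λ _ → z≤n) Fin.≤fromℕ irr) (trans (chord-power true π i<j i∼j)
          (sym (*-cong inner-value (outer-value irr))))
      where
      open ChordEnds π i<j i∼j
      outer-value : π [ zero ∼ fromℕ n ] → U (π ↾ T) 1ₙ ≈ q ^ (#blocks (π ↾ T) ℕ.∸ 1)
      outer-value irr = tot-irreducible (π ↾ T) (rank-least T t∈T t≤) (rank-greatest T y∈T λ {z} _ → Fin.≤fromℕ z)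
        (↾-rank⁺ π T t∈T y∈T (∼-trans π (∼-sym π 0∼t) irr))
    ... | no red = trans (tot-reducible π (λ _ → z≤n) Fin.≤fromℕ red) (sym (trans (*-congˡ outer-value) (zeroʳ _)))
      where
      open ChordEnds π i<j i∼j
      outer-value : U (π ↾ T) 1ₙ ≈ 0#
      outer-value = tot-reducible (π ↾ T) (rank-least T t∈T t≤) (rank-greatest T y∈T λ {z} _ → Fin.≤fromℕ z)
        (λ t∼y → red (∼-trans π 0∼t (↾-rank⁻ π T t∈T y∈T t∼y)))

  module Conjugate (q : Carrier) (u u⁻¹ f : NC² → Carrier)
                   (u∈ : IsU q u) (inv : u⁻¹ IsInverseOf u) (f∈ : 𝒢 f) where

    open Powers q

    h : NC² → Carrier
    h = (u⁻¹ ⋆ f) ⋆ u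

    U V F H : Kernel
    U = tot u
    V = tot u⁻¹
    F = tot f
    H = tot h

    U-triangular : Triangular U
    U-triangular = tot-triangular u
    V-triangular : Triangular V
    V-triangular = tot-triangular u⁻¹
    F-triangular : Triangular F
    F-triangular = tot-triangular f
    H-triangular : Triangular H
    H-triangular = tot-triangular h

    U-unital : Unital U
    U-unital = tot-unital (IsU.semi-multiplicative u∈)
    U-splits : Splits U
    U-splits = tot-splits (IsU.semi-multiplicative u∈)

    F-unital : Unital F
    F-unital = tot-unital (𝒢.semi-multiplicative f∈)
    F-splits : Splits F
    F-splits = tot-splits (𝒢.semi-multiplicative f∈)

    U⊛V : ∀ {n} (x : NC n → Carrier) π → act U (act V x) π ≈ x π
    U⊛V = act-inverse u u⁻¹ (_IsInverseOf_.inverseʳ inv)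

    -- Unitality, splitting, the closed chord law and the commutation relation for `H` all follow
    -- from this equation by cancelling the unitriangular `U`.
    U⊛H≈F⊛U : ∀ {n} (π σ : NC n) → (U ⊛ H) π σ ≈ (F ⊛ U) π σ
    U⊛H≈F⊛U {n} π σ = trans (act-cong′ U π λ ρ → trans (tot-⊛ (u⁻¹ ⋆ f) u ρ σ)
        (trans (Sum-cong (elements n) λ {τ} _ → *-congʳ (tot-⊛ u⁻¹ f ρ τ)) (⊛-assoc V F (λ τ → U τ σ) ρ)))
      (U⊛V (act F λ τ → U τ σ) π)

    F⊛U-splits : Splits (F ⊛ U)
    F⊛U-splits = ⊛-splits F U F-triangular U-triangular F-splits U-splits

    H-unital : Unital H
    H-unital π = trans (sym (act-single U U-triangular U-unital (λ ρ → H ρ π) π (λ ρ → above H H-triangular ρ)))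
      (trans (U⊛H≈F⊛U π π) (trans
        (act-single F F-triangular F-unital (λ ρ → U ρ π) π (λ ρ → above U U-triangular ρ)) (U-unital π)))
      where
      above : ∀ (k : Kernel) → Triangular k → ∀ ρ → π ≼ ρ → ρ ≢ π → k ρ π ≈ 0#
      above k tri ρ π≼ρ ρ≢π = tri ρ π λ ρ≼π → ρ≢π (≼-antisym ρ π ρ≼π π≼ρ)

    H-splits : Splits H
    H-splits = splits-cancel U H (F ⊛ U) U-triangular U-unital U-splits H-triangular F⊛U-splits U⊛H≈F⊛U

    H-chordLaw : ChordLaw true H
    H-chordLaw = chordLaw-cancel U H (F ⊛ U) U-triangular U-unital U-splits true (tot-u-chordLaw u∈)
      (⊛-chordLaw F U F-triangular F-splits true (tot-chordLaw-closed f∈) (tot-u-chordLaw u∈)) U⊛H≈F⊛U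

    v : Kernel
    v = V ⊛ z

    v-triangular : Triangular v
    v-triangular = ⊛-triangular V z V-triangular z-triangular

    U⊛v≈z : ∀ {n} (π σ : NC n) → (U ⊛ v) π σ ≈ z π σ
    U⊛v≈z π σ = U⊛V (λ τ → z τ σ) π

    v-splits : Splits v
    v-splits = splits-cancel U v z U-triangular U-unital U-splits v-triangular z-splits U⊛v≈z

    -- At `0ₙ` the action of `U` is the identity, so U ⊛ v = z reads v = z there.
    v-0ₙ : ∀ {n} (ρ : NC n) → v 0ₙ ρ ≈ z 0ₙ ρ
    v-0ₙ ρ = trans (sym (act-u-0ₙ u∈ λ τ → v τ ρ)) (U⊛v≈z 0ₙ ρ)

    -- The column of the identity kernel at `1ₙ`: acting on it with `k` reads off k(·,1ₙ).
    isTop : ∀ {n} → NC n → Carrier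
    isTop π with π ≟ᴺ 1ₙ
    ... | yes _ = 1#
    ... | no _  = 0#

    isTop-≡ : ∀ {n} (π : NC n) → π ≡ 1ₙ → isTop π ≈ 1#
    isTop-≡ π eq with π ≟ᴺ 1ₙ
    ... | yes _ = refl
    ... | no ¬p = ⊥-elim (¬p eq)

    isTop-≢ : ∀ {n} (π : NC n) → π ≢ 1ₙ → isTop π ≈ 0#
    isTop-≢ π ¬eq with π ≟ᴺ 1ₙ
    ... | yes p = ⊥-elim (¬eq p)
    ... | no _  = refl

    act-isTop : ∀ (k : Kernel) {n} (π : NC n) → act k isTop π ≈ k π 1ₙ
    act-isTop k {n} π = trans
      (Sum-single (elements-! n) (λ ρ → k π ρ * isTop ρ) (∈-elements (1ₙ {n}))
        (λ {ρ} ρ≢1 → trans (*-congˡ (isTop-≢ ρ ρ≢1)) (zeroʳ _)))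
      (trans (*-congˡ (isTop-≡ (1ₙ {n}) ≡.refl)) (*-identityʳ _))

    -- z and u agree at (π,1ₙ) for irreducible π.
    v-irreducible : ∀ {n} (π : NC n) {x y} → Least x → Greatest y → π [ x ∼ y ] → v π 1ₙ ≈ isTop π
    v-irreducible {n} π {x} {y} min max = act-cancel U U-triangular U-unital {D = _[ x ∼ y ]}
      (λ π ρ π≼ρ → ≼⇒∼ π ρ π≼ρ) (λ ρ → v ρ 1ₙ) isTop
      (λ π x∼y → trans (U⊛v≈z π 1ₙ) (trans (z-1ₙ π x)
        (trans (sym (tot-irreducible u∈ π min max x∼y)) (sym (act-isTop U π))))) π

    -- Both sides obey the half-open chord law, which leaves π = `0ₙ`. There, substituting
    -- complements for the summation variable exchanges the two factors.
    F⊛z≈z⊛F : ∀ {n} (π : NC n) → (F ⊛ z) π 1ₙ ≈ (z ⊛ F) π 1ₙ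
    F⊛z≈z⊛F = chord-induction (λ π → (F ⊛ z) π 1ₙ ≈ (z ⊛ F) π 1ₙ) base λ π i<j i∼j ihA ihT →
      trans (⊛-chordLaw F z F-triangular F-splits false (tot-chordLaw-open f∈) z-chordLaw π i<j i∼j)
        (trans (*-cong ihA ihT)
          (sym (⊛-chordLaw z F z-triangular z-splits false z-chordLaw (tot-chordLaw-open f∈) π i<j i∼j)))
      where
      base : ∀ {n} → (F ⊛ z) (0ₙ {n}) 1ₙ ≈ (z ⊛ F) 0ₙ 1ₙ
      base {n} = trans (Sum-cong (elements n) λ _ → *-comm _ _)
        (trans (sym (Sum-complement n λ κ → z κ 1ₙ * F 0ₙ κ))
          (Sum-cong (elements n) λ {ρ} _ → *-cong (sym (z-complement ρ)) (sym (tot-kreweras f∈ ρ))))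

    -- Cancel `U` in U ⊛ H ⊛ v = F ⊛ U ⊛ v = F ⊛ z = z ⊛ F = U ⊛ v ⊛ F.
    H⊛v≈v⊛F : ∀ {n} (π : NC n) → (H ⊛ v) π 1ₙ ≈ (v ⊛ F) π 1ₙ
    H⊛v≈v⊛F {n} π = act-cancel U U-triangular U-unital {D = λ _ → Unit} _
      (λ ρ → (H ⊛ v) ρ 1ₙ) (λ ρ → (v ⊛ F) ρ 1ₙ) (λ π _ → agree π) π tt
      where
      agree : ∀ π → act U (λ ρ → (H ⊛ v) ρ (1ₙ {n})) π ≈ act U (λ ρ → (v ⊛ F) ρ 1ₙ) π
      agree π =
        trans (sym (⊛-assoc U H (λ ρ → v ρ 1ₙ) π))
        (trans (Sum-cong (elements n) λ {ρ} _ → *-congʳ (U⊛H≈F⊛U π ρ))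
        (trans (⊛-assoc F U (λ ρ → v ρ 1ₙ) π)
        (trans (act-cong′ F π λ ρ → U⊛v≈z ρ 1ₙ)
        (trans (F⊛z≈z⊛F π)
        (trans (Sum-cong (elements n) λ {ρ} _ → *-congʳ (sym (U⊛v≈z π ρ)))
               (⊛-assoc U v (λ ρ → F ρ 1ₙ) π))))))

    -- The partition whose only chord joins the first and the last point

    module Base {n} (η : NC n) {i j : Fin n} (i<j : i Fin.< j) (i∼j : η [ i ∼ j ])
                (min : Least i) (max : Greatest j)
                (pair : ∀ {x} → η [ i ∼ x ] → x ≡ i ⊎ x ≡ j)
                (rest : ∀ {x y} → η [ x ∼ y ] → ¬ η [ i ∼ x ] → x ≡ y) where

      private
        A T : Subset n
        A = inner false i j
        T = outer i j

        i∈A : i ∈ A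
        i∈A = inner⁺ false i j ℕ.≤-refl i<j

        A⁻ : ∀ {x} → x ∈ A → x ≢ j
        A⁻ x∈A ≡.refl = ℕ.<-irrefl ≡.refl (proj₂ (∈⟪⟫⁻ (inner? false i j) x∈A))

        A⁺ : ∀ {x} → x ≢ j → x ∈ A
        A⁺ {x} x≢j = inner⁺ false i j (min x) (ℕ.≤∧≢⇒< (max x) (x≢j ∘ Fin.toℕ-injective))

      T-single : AllEqual ∣ T ∣
      T-single = allEqual T j λ {x} x∈T → case (∈⟪⟫⁻ (outer? i j) x∈T)
        where
        case : ∀ {x} → x Fin.< i ⊎ j Fin.≤ x → x ≡ j
        case {x} (inj₁ x<i) = ⊥-elim (ℕ.<⇒≱ x<i (min x))
        case {x} (inj₂ j≤x) = ≤-antisymᶠ (max x) j≤x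

      η↾A : η ↾ A ≡ 0ₙ
      η↾A = ≡0ₙ λ {a} {b} a∼b → element-injective A (same (element-∈ A a) (element-∈ A b) (↾-∼⁻ η A a∼b))
        where
        same : ∀ {x y} → x ∈ A → y ∈ A → η [ x ∼ y ] → x ≡ y
        same {x} {y} x∈A y∈A x∼y with ∼? η i x
        ... | no i≁x = rest x∼y i≁x
        ... | yes i∼x with pair i∼x | pair (∼-trans η i∼x x∼y)
        ...   | inj₂ x≡j | _        = ⊥-elim (A⁻ x∈A x≡j)
        ...   | inj₁ _   | inj₂ y≡j = ⊥-elim (A⁻ y∈A y≡j)
        ...   | inj₁ x≡i | inj₁ y≡i = ≡.trans x≡i (≡.sym y≡i)

      private
        η≼ : ∀ ρ → ρ [ i ∼ j ] → η ≼ ρ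
        η≼ ρ i∼ρj = ∼⇒≼ η ρ below
          where
          i∼ : ∀ {x} → η [ i ∼ x ] → ρ [ i ∼ x ]
          i∼ i∼x with pair i∼x
          ... | inj₁ ≡.refl = ∼-refl ρ i
          ... | inj₂ ≡.refl = i∼ρj
          below : ∀ {x y} → η [ x ∼ y ] → ρ [ x ∼ y ]
          below {x} {y} x∼y with ∼? η i x
          ... | no i≁x  = ∼-reflexive ρ (rest x∼y i≁x)
          ... | yes i∼x = ∼-trans ρ (∼-sym ρ (i∼ i∼x)) (i∼ (∼-trans η i∼x x∼y))

      module _ (ρ : NC n) (i∼ρj : ρ [ i ∼ j ]) where

        private
          W = block ρ i
          i∈W = ∼-refl ρ i
          κ = complement (ρ ↾ A)
          ends = extremes (rank A i∈A)
          x₀ = proj₁ ends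
          y₀ = proj₁ (proj₂ ends)
          min₀ : Least x₀
          min₀ = proj₁ (proj₂ (proj₂ ends))
          max₀ : Greatest y₀
          max₀ = proj₂ (proj₂ (proj₂ ends))

          x₀≡i : element A x₀ ≡ i
          x₀≡i = ≤-antisymᶠ (subst (element A x₀ Fin.≤_) (element-rank A i∈A) (element-≤⁺ A (min₀ (rank A i∈A)))) (min _)

          Small : Set
          Small = ∀ {x} → ρ [ i ∼ x ] → x ≡ i ⊎ x ≡ j

          -- The complement `κ` joins the ends of `A` iff the points of `A` after `i` form a union
          -- of blocks of ρ ↾ A, that is, iff `i` is a singleton there.
          irreducible⇒small : κ [ x₀ ∼ y₀ ] → Small
          irreducible⇒small x∼y {x} i∼x with x Fin.≟ i | x Fin.≟ j
          ... | yes x≡i | _       = inj₁ x≡i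
          ... | no _    | yes x≡j = inj₂ x≡j
          ... | no x≢i  | no x≢j  = ⊥-elim (ℕ.<-irrefl ≡.refl
            (ℕ.<-≤-trans (proj₁ (complement⁻ (ρ ↾ A) (min₀ y₀) x∼y (↾-rank⁺ ρ A x∈A i∈A (∼-sym ρ i∼x)) x₀<x (max₀ _)))
              (element-≤⁻ A (subst₂ Fin._≤_ (≡.sym (element-rank A i∈A)) (≡.sym x₀≡i) ℕ.≤-refl))))
            where
            x∈A = A⁺ x≢j
            x₀<x : x₀ Fin.< rank A x∈A
            x₀<x = element-<⁻ A (subst₂ Fin._<_ (≡.sym x₀≡i) (≡.sym (element-rank A x∈A))
              (ℕ.≤∧≢⇒< (min x) (x≢i ∘ ≡.sym ∘ Fin.toℕ-injective)))

          small⇒irreducible : Small → κ [ x₀ ∼ y₀ ]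
          small⇒irreducible small = complement⁺ (ρ ↾ A) (min₀ y₀) sat
            where
            sat : Saturated (ρ ↾ A) x₀ y₀
            sat {a} {b} a∼b x₀<a _ with Fin.<-cmp x₀ b
            ... | tri< x₀<b _ _ = x₀<b , max₀ b
            ... | tri> _ _ b<x₀ = ⊥-elim (ℕ.<⇒≱ b<x₀ (min₀ b))
            ... | tri≈ _ ≡.refl _ with small (subst (λ x → ρ [ x ∼ element A a ]) x₀≡i (∼-sym ρ (↾-∼⁻ ρ A a∼b)))
            ...   | inj₁ a≡i = ⊥-elim (ℕ.<-irrefl (cong toℕ (element-injective A (≡.trans x₀≡i (≡.sym a≡i)))) x₀<a)
            ...   | inj₂ a≡j = ⊥-elim (A⁻ (element-∈ A a) a≡j)

          small⇒top : Small → η ↾ W ≡ 1ₙ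
          small⇒top small = ↾-1ₙ η W i λ x∈W → case (small x∈W)
            where
            case : ∀ {x} → x ≡ i ⊎ x ≡ j → η [ i ∼ x ]
            case (inj₁ ≡.refl) = ∼-refl η i
            case (inj₂ ≡.refl) = i∼j

          top⇒small : η ↾ W ≡ 1ₙ → Small
          top⇒small eq x∈W = pair (↾-rank⁻ η W i∈W x∈W (subst (λ τ → τ [ rank W i∈W ∼ rank W x∈W ]) (≡.sym eq) (1ₙ-∼ _ _)))

          η↾∁W : η ↾ ∁ W ≡ 0ₙ
          η↾∁W = ≡0ₙ λ {a} {b} a∼b → element-injective (∁ W)
            (rest (↾-∼⁻ η (∁ W) a∼b) λ i∼a → x∈∁p⇒x∉p (element-∈ (∁ W) a) (≼⇒∼ η ρ (η≼ ρ i∼ρj) i∼a))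

          v-block : v (η ↾ W) 1ₙ ≈ isTop (η ↾ W)
          v-block = v-irreducible (η ↾ W) (rank-least W i∈W λ {z} _ → min z) (rank-greatest W i∼ρj λ {z} _ → max z)
            (↾-rank⁺ η W i∈W i∼ρj i∼j)

          split : v η ρ ≈ v (η ↾ W) 1ₙ * z 0ₙ (ρ ↾ ∁ W)
          split = trans (split-block v v-splits η ρ (η≼ ρ i∼ρj) i)
            (*-congˡ (trans (reflexive (cong (λ τ → v τ (ρ ↾ ∁ W)) η↾∁W)) (v-0ₙ (ρ ↾ ∁ W))))

          -- If {i,j} is a block of ρ, then i is a singleton of ρ ↾ A.
          z-rest : Small → z 0ₙ (ρ ↾ ∁ W) ≈ z κ 1ₙ
          z-rest small = sym (trans (sym (z-complement (ρ ↾ A)))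
            (trans (reflexive (cong (λ τ → z τ (ρ ↾ A)) (≡.sym (0ₙ↾ A))))
            (trans (split-at z z-splits 0ₙ ρ (0ₙ≼ ρ) A W (∼-trans ρ))
            (trans (*-cong (unital-allEqual z z-unital (allEqual (A ∩ W) i only-i) _ _)
                           (reflexive (cong₂ z (0ₙ↾ (A ∩ ∁ W)) ≡.refl)))
            (trans (*-identityˡ _) (reflexive (cong (λ S → z (0ₙ {∣ S ∣}) (ρ ↾ S)) A∩∁W)))))))
            where
            only-i : ∀ {x} → x ∈ A ∩ W → x ≡ i
            only-i p with small (p∩q⊆q A W p)
            ... | inj₁ x≡i = x≡i
            ... | inj₂ x≡j = ⊥-elim (A⁻ (p∩q⊆p A W p) x≡j)
            A∩∁W : A ∩ ∁ W ≡ ∁ W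
            A∩∁W = ⊆-antisym (p∩q⊆q A (∁ W)) λ x∈ → x∈p∩q⁺
              (A⁺ (λ { ≡.refl → x∈∁p⇒x∉p x∈ i∼ρj }) , x∈)

        -- Split off the block W of `ρ` through the chord. Its factor is 1 if W = {i,j} and 0
        -- otherwise, matching the irreducibility of `κ`. Off W the partition `η` is `0ₙ`, where `v`
        -- equals `z` and supplies the power of q.
        v-η : v η ρ ≈ U κ 1ₙ
        v-η with ∼? κ x₀ y₀
        ... | yes irr = trans split (trans
                (*-cong (trans v-block (isTop-≡ (η ↾ W) (small⇒top (irreducible⇒small irr)))) (z-rest (irreducible⇒small irr)))
                (trans (*-identityˡ _) (trans (z-1ₙ κ x₀) (sym (tot-irreducible u∈ κ min₀ max₀ irr)))))
        ... | no red  = trans split (trans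
                (*-congʳ (trans v-block (isTop-≢ (η ↾ W) (red ∘ small⇒irreducible ∘ λ eq {x} → top⇒small eq {x}))))
                (trans (zeroˡ _) (sym (tot-reducible u∈ κ min₀ max₀ red))))

      H-contract : H η 1ₙ ≈ H (0ₙ {∣ A ∣}) 1ₙ
      H-contract =
        trans (sym (act-isTop H η))
        (trans (act-cong H H-triangular isTop (λ ρ → v ρ 1ₙ) η λ ρ η≼ρ → sym (v-irreducible ρ min max (≼⇒∼ η ρ η≼ρ i∼j)))
        (trans (H⊛v≈v⊛F η)
        (trans (sym weigh)
        -- The sum over [η,1ₙ] factors along the chord. The outer side is the single point `j` and
        -- contributes 1; on `A` the partition `η` is `0ₙ`, so the inner sum runs over all
        -- partitions of `A`.
        (trans (act-chord ζ ζ-triangular ζ-splits false (ζ-chordLaw false) η i<j i∼j G G₁ (λ _ → 1#) factor)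
        (trans (*-cong inner-sum outer-sum)
        (trans (*-identityʳ _)
        -- Replacing ρ by its complement κ leaves the sum of U(κ,1ₙ) F(0ₙ,κ), which is (F ⊛
        -- U)(0ₙ,1ₙ).
        (trans (Sum-complement ∣ A ∣ λ κ → U κ 1ₙ * F 0ₙ κ)
        (trans (Sum-cong (elements ∣ A ∣) λ _ → *-comm _ _)
        (trans (sym (U⊛H≈F⊛U 0ₙ 1ₙ))
               (act-u-0ₙ u∈ λ ρ → H ρ 1ₙ))))))))))
        where
        G : NC n → Carrier
        G ρ = v η ρ * F ρ 1ₙ

        G₁ : NC ∣ A ∣ → Carrier
        G₁ ρ = U (complement ρ) 1ₙ * F 0ₙ (complement ρ)

        weigh : act ζ G η ≈ (v ⊛ F) η 1ₙ
        weigh = Sum-cong (elements n) λ {ρ} _ → term ρ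
          where
          term : ∀ ρ → ζ η ρ * G ρ ≈ G ρ
          term ρ with η ≼? ρ
          ... | yes η≼ρ = *-identityˡ _
          ... | no η⋠ρ  = trans (zeroˡ _) (sym (trans (*-congʳ (v-triangular η ρ η⋠ρ)) (zeroˡ _)))

        factor : ∀ ρ → ρ [ i ∼ j ] → G ρ ≈ G₁ (ρ ↾ A) * 1#
        factor ρ i∼ρj = trans (*-cong (v-η ρ i∼ρj)
            (trans (tot-chordLaw-open f∈ ρ i<j i∼ρj)
              (trans (*-cong (tot-kreweras f∈ (ρ ↾ A)) (unital-allEqual F F-unital T-single (ρ ↾ T) 1ₙ)) (*-identityʳ _))))
          (sym (*-identityʳ _))

        inner-sum : act ζ G₁ (η ↾ A) ≈ Sum (elements ∣ A ∣) G₁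
        inner-sum = trans (reflexive (cong (act ζ G₁) η↾A))
          (Sum-cong (elements ∣ A ∣) λ {ρ} _ → trans (*-congʳ (ζ-≼ 0ₙ ρ (0ₙ≼ ρ))) (*-identityˡ _))

        outer-sum : act ζ (λ _ → 1#) (η ↾ T) ≈ 1#
        outer-sum = act-single ζ ζ-triangular (λ π → ζ-≼ π π (≼-refl π)) (λ _ → 1#) (η ↾ T)
          (λ ρ _ ρ≢ → ⊥-elim (ρ≢ (allEqual⇒≡ T-single ρ (η ↾ T))))

    H-kreweras : ∀ {n} (π : NC n) → H π 1ₙ ≈ H 0ₙ (complement π)
    H-kreweras {n} π = go n (<-wellFounded n) π
      where
      Q : Kernel
      Q = fromBelow H

      Q-trivial : ∀ {n} → AllEqual n → (π : NC n) → Q π 1ₙ ≈ 1#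
      Q-trivial eq π = unital-allEqual H H-unital eq 0ₙ (complement π)

      Q-0ₙ : ∀ {n} → Q (0ₙ {n}) 1ₙ ≈ H (0ₙ {n}) 1ₙ
      Q-0ₙ {n} = reflexive (cong (H (0ₙ {n})) (complement-0ₙ {n}))

      Q-open : ChordLaw false Q
      Q-open = fromBelow-chordLaw H H-splits

      Q-closed : ChordLaw true Q
      Q-closed = chordLaw-closed Q Q-trivial Q-open

      -- The closed chord law allows induction only if [i,j] is not everything; the outer side is
      -- smaller in any case.
      ProperChord : ∀ {n} → NC n → Set
      ProperChord {n} π = Σ[ i ∈ Fin n ] Σ[ j ∈ Fin n ] i Fin.< j × π [ i ∼ j ] × ∣ inner true i j ∣ ℕ.< n

      properChord? : ∀ {n} (π : NC n) → Dec (ProperChord π)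
      properChord? {n} π = Fin.any? λ i → Fin.any? λ j →
        (i Fin.<? j) ×-dec (∼? π i j) ×-dec (∣ inner true i j ∣ ℕ.<? n)

      go : ∀ n → Acc ℕ._<_ n → (π : NC n) → H π 1ₙ ≈ Q π 1ₙ
      go n (acc rs) π with properChord? π
      ... | yes (i , j , i<j , i∼j , small) = trans (H-chordLaw π i<j i∼j) (trans
              (*-cong (go ∣ inner true i j ∣ (rs small) (π ↾ inner true i j)) (go ∣ outer i j ∣ (rs (outer-< i<j)) (π ↾ outer i j)))
              (sym (Q-closed π i<j i∼j)))
      -- Without a proper chord every chord spans all points, so there is at most one, between the
      -- first and the last point.
      ... | no ¬proper with chord-or-0ₙ π
      ...   | inj₂ ≡.refl = sym (Q-0ₙ {n})
      -- For `Q` the half-open law does the contraction: it leaves the value at `0ₙ` on [i,j), whose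
      -- complement is `1ₙ`, and the factor 1 of a single point.
      ...   | inj₁ (i , j , i<j , i∼j) = trans H-contract (sym (trans
              (Q-open π i<j i∼j) (trans
              (*-cong (trans (reflexive (cong (λ τ → Q τ 1ₙ) η↾A)) (Q-0ₙ {∣ inner false i j ∣})) (Q-trivial T-single (π ↾ outer i j)))
              (*-identityʳ _))))
        where
        all-inside : ∀ {i j} → i Fin.< j → π [ i ∼ j ] → ∀ x → x ∈ inner true i j
        all-inside {i} {j} i<j i∼j x with x ∈? inner true i j
        ... | yes x∈ = x∈
        ... | no x∉  = ⊥-elim (¬proper (i , j , i<j , i∼j , ∉⇒∣∣< (inner true i j) x∉))

        min : Least i
        min x = proj₁ (inner⁻ true i j (all-inside i<j i∼j x))
        max : Greatest j
        max x = proj₂ (inner⁻ true i j (all-inside i<j i∼j x))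

        only : ∀ {x y} → x Fin.< y → π [ x ∼ y ] → x ≡ i × y ≡ j
        only {x} {y} x<y x∼y =
          ≤-antisymᶠ (proj₁ (inner⁻ true x y (all-inside x<y x∼y i))) (min x) ,
          ≤-antisymᶠ (max y) (proj₂ (inner⁻ true x y (all-inside x<y x∼y j)))

        pair : ∀ {x} → π [ i ∼ x ] → x ≡ i ⊎ x ≡ j
        pair {x} i∼x with Fin.<-cmp i x
        ... | tri< i<x _ _  = inj₂ (proj₂ (only i<x i∼x))
        ... | tri≈ _ i≡x _  = inj₁ (≡.sym i≡x)
        ... | tri> _ _ x<i  = ⊥-elim (ℕ.<⇒≱ x<i (min x))

        rest : ∀ {x y} → π [ x ∼ y ] → ¬ π [ i ∼ x ] → x ≡ y
        rest {x} {y} x∼y i≁x with Fin.<-cmp x y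
        ... | tri≈ _ x≡y _ = x≡y
        ... | tri< x<y _ _ = ⊥-elim (i≁x (∼-reflexive π (≡.sym (proj₁ (only x<y x∼y)))))
        ... | tri> _ _ y<x = ⊥-elim (i≁x (subst (λ w → π [ i ∼ w ]) (≡.sym (proj₂ (only y<x (∼-sym π x∼y)))) i∼j))

        open Base π i<j i∼j min max pair rest using (H-contract; T-single; η↾A)

    conjugate-multiplicative : 𝒢 (Convolution._⋆_ R (Convolution._⋆_ R u⁻¹ f) u)
    conjugate-multiplicative = record
      { semi-multiplicative = splits⇒𝒢̃ h H-unital H-splits
      ; kreweras = λ π κ isK → trans (reflexive (≡.sym (tot-1ₙ h π))) (trans (H-kreweras π)
          (trans (reflexive (tot-0ₙ h (complement π))) (reflexive (cong (λ τ → h ⟨0, τ ⟩) (≡.sym (kreweras-unique κ π isK))))))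
      }

open import Defs

theorem10p1 : (q : ℝ) (u u⁻¹ f : NC² → ℂ) →
    IsU (fromℝ q) u →
    u⁻¹ IsInverseOf u →
    𝒢 f →
    𝒢 ((u⁻¹ ⋆ f) ⋆ u)
theorem10p1 q u u⁻¹ f u∈ inv f∈ = subst (λ _⋆′_ → 𝒢 ((u⁻¹ ⋆′ f) ⋆′ u)) ⋆≡⋆
  (Conjugation.Conjugate.conjugate-multiplicative ℂ-commutativeRing (fromℝ q) u u⁻¹ f u∈ inv f∈)
  where
  -- The same function under two names; substituting avoids comparing the convolutions of u⁻¹, f and u by evaluation.
  ⋆≡⋆ : Convolution._⋆_ ℂ-commutativeRing ≡ _⋆_
  ⋆≡⋆ = ≡.refl
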